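{- There exists an absolute constant $n_0$ such that the following holds for all integers $n\geq n_0$. For any positive integer $m$ with $n\geq 3m$, let $\mathcal{F}=\{F_1,\ldots,F_m\}$ be a family of $3$-graphs on the same vertex set $[n]$ such that $|F_i|> f(n,m,3)$ for all $i\in[m]$. Then $\mathcal{F}$ admits a rainbow matching.
   Context: For positive integers $n,m,k$ with $n\ge km$, $f(n,m,k):=\max\left\{\binom{n}{k}-\binom{n-m+1}{k},\binom{km-1}{k}\right\}$. A $k$-graph is a hypergraph all of whose edges have size $k$; $|F|$ denotes its number of edges. For a family $\mathcal{F}=\{F_1,\ldots,F_m\}$ of hypergraphs on the same vertex set, a rainbow matching is a set of $m$ pairwise disjoint edges $e_1,\ldots,e_m$ with $e_i\in F_i$ for each $i$; $\mathcal{F}$ admits a rainbow matching if one exists. -}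

module Defs where

open import Data.Nat using (ℕ; _+_; _∸_; _*_; _⊔_)
open import Data.Nat.Combinatorics using (_C_)
open import Data.Fin using (Fin)
open import Data.Fin.Subset using (Subset; ∣_∣; _∩_; ⊥)
open import Data.List using (List; length)
open import Data.List.Relation.Unary.All using (All)
open import Data.List.Relation.Unary.Unique.Propositional using (Unique)
open import Data.List.Membership.Propositional using (_∈_)
open import Relation.Binary.PropositionalEquality using (_≡_)
open import Relation.Nullary using (¬_)
open import Data.Product using (Σ; _×_)

-- f(n,m,k) = max { C(n,k) - C(n-m+1,k) , C(km-1,k) }
-- (under the standing assumption n ≥ km the truncated subtractions are exact)
f : ℕ → ℕ → ℕ → ℕ
f n m k = ((n C k) ∸ ((n ∸ m + 1) C k)) ⊔ ((k * m ∸ 1) C k)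

record Hypergraph (k n : ℕ) : Set where
  field
    edges    : List (Subset n)
    distinct : Unique edges
    uniform  : All (λ e → ∣ e ∣ ≡ k) edges

open Hypergraph public

∣_∣ₑ : ∀ {k n} → Hypergraph k n → ℕ
∣ F ∣ₑ = length (edges F)

RainbowMatching : ∀ {k n m} → (Fin m → Hypergraph k n) → Set
RainbowMatching {k} {n} {m} F =
  Σ (Fin m → Subset n) λ e →
    ((i : Fin m) → e i ∈ edges (F i)) ×
    ((i j : Fin m) → ¬ i ≡ j → (e i ∩ e j) ≡ ⊥)

{-# OPTIONS --safe #-}
{-
Adjacent shifts preserve the sizes of the families and create no rainbow matching, so all families may be
taken closed under lowering vertices.  A rainbow matching of such families can be compressed, by replacing
each vertex by its rank, onto {0 , … , 3m-1}.  Write n = 3m + N.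

Induction on m.  If some family contains (0 , 3m-2 , 3m-1), match the others on the vertices ≥ 1, compress
them and add that edge; the hypothesis passes exactly to (n-1 , m-1).  Otherwise every edge has y < 3m-2 or
z < 3m-1, so only the triples inside [0 , 3m) and the pairs completed by 3m-1 count.  If N ≥ 5m, the edge
(0 , 1 , 3m-1) of one family is used in the same way, and the hypothesis passes to (n-2 , m-1).

For N < 5m cut [0 , 3m) into a large constant number of blocks and choose an edge for one family after the
other, up to blocks, always a cheapest one with respect to the current excess loads of the blocks; the sum of
the squared excesses grows linearly, so if the families leave some slack on average then all loads fit in the
end.  A family without a cheap edge is contained in a set {w(x) + w(y) + w(z) ≥ t} where w has mean about t/3.
For independent x, y, z then P(w(x) + w(y) + w(z) < t) ≥ P(w(x) + w(y) ≥ t) / 2, so the family misses at least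
about m/2 triples for each pair it completes.  This contradicts its size when N > 0.49 m, and also when
N ≤ 0.49 m and the family completes at least m²/40 pairs (a fat family).  It remains that N ≤ 0.49 m with few
fat families.  These (or one arbitrary family) take the edges (2i , 2i+1 , ·) and are removed together with as
many top vertices; the other families lose so few edges that the hypothesis passes to (n-3q , m-q).
-}
module Submission where

-- Compare a stuck family with the clique on [0 , 3m). A pair completed by 3m-1 brings at most N
-- edges with last vertex beyond 3m-1, and by the probability inequality it costs about m/2 triples
-- inside, so completing pairs pays only for N > m/2. On the other hand the two terms of `f` cross,
-- to leading order, where 15ν + 3ν² = 8 with ν = N/m, that is at ν ≈ 0.486. The proof lives on
-- 0.486 < 0.49 < 0.5: from 0.49 m on the cover term refutes every stuck family, and up to 0.49 m
-- the clique term refutes every fat one.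
--
-- The factor 1/2 is obtained by linear programming duality: a multiplier attached to each pair,
-- which averages out against w(z) - t/3, makes the inequality hold pointwise.
--
-- Block estimates carry an error of a small multiple of m³, so a family barely above a clique on
-- 3m-1 vertices cannot be refuted on that scale. This is why thin families are left to an induction
-- with exact counts.

-- Finite sums over increasing pairs and triples, and binomial coefficients.

module Sums where

  open import Data.Bool using (Bool; true; false; not; T)
  open import Data.Nat
  open import Data.Nat.Properties
  open import Data.Nat.Combinatorics using (_C_; nCk+nC[k+1]≡[n+1]C[k+1])
  open import Data.Nat.Tactic.RingSolver using (solve-∀)
  open import Algebra.Properties.CommutativeSemigroup +-commutativeSemigroup using (interchange)
  open import Function using (_∘_)
  open import Relation.Binary.PropositionalEquality

  𝟙 : Bool → ℕ
  𝟙 true  = 1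
  𝟙 false = 0

  𝟙≤1 : ∀ b → 𝟙 b ≤ 1
  𝟙≤1 true  = ≤-refl
  𝟙≤1 false = z≤n

  𝟙-mono : ∀ {b c} → (T b → T c) → 𝟙 b ≤ 𝟙 c
  𝟙-mono {false}         _ = z≤n
  𝟙-mono {true}  {true}  _ = ≤-refl
  𝟙-mono {true}  {false} h with () ← h _

  𝟙+𝟙not : ∀ b → 𝟙 b + 𝟙 (not b) ≡ 1
  𝟙+𝟙not true  = refl
  𝟙+𝟙not false = refl

  sum : ℕ → (ℕ → ℕ) → ℕ
  sum zero    f = 0
  sum (suc n) f = f 0 + sum n (f ∘ suc)

  sum-cong : ∀ n {f g} → (∀ i → i < n → f i ≡ g i) → sum n f ≡ sum n g
  sum-cong zero    h = refl
  sum-cong (suc n) h = cong₂ _+_ (h 0 z<s) (sum-cong n λ i i<n → h (suc i) (s<s i<n))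

  sum-mono : ∀ n {f g} → (∀ i → i < n → f i ≤ g i) → sum n f ≤ sum n g
  sum-mono zero    h = z≤n
  sum-mono (suc n) h = +-mono-≤ (h 0 z<s) (sum-mono n λ i i<n → h (suc i) (s<s i<n))

  sum-+ : ∀ n f g → sum n (λ i → f i + g i) ≡ sum n f + sum n g
  sum-+ zero    f g = refl
  sum-+ (suc n) f g = trans (cong (f 0 + g 0 +_) (sum-+ n (f ∘ suc) (g ∘ suc)))
                            (interchange (f 0) (g 0) _ _)

  sum-*ˡ : ∀ n c f → sum n (λ i → c * f i) ≡ c * sum n f
  sum-*ˡ zero    c f = sym (*-zeroʳ c)
  sum-*ˡ (suc n) c f = trans (cong (c * f 0 +_) (sum-*ˡ n c (f ∘ suc))) (sym (*-distribˡ-+ c (f 0) _))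

  sum-const : ∀ n c → sum n (λ _ → c) ≡ n * c
  sum-const zero    c = refl
  sum-const (suc n) c = cong (c +_) (sum-const n c)

  sum-≤const : ∀ n c {f} → (∀ i → i < n → f i ≤ c) → sum n f ≤ n * c
  sum-≤const n c h = ≤-trans (sum-mono n h) (≤-reflexive (sum-const n c))

  sum-zero : ∀ n {f} → (∀ i → i < n → f i ≡ 0) → sum n f ≡ 0
  sum-zero n h = trans (sum-cong n h) (trans (sum-const n 0) (*-zeroʳ n))

  sum-split : ∀ a b f → sum (a + b) f ≡ sum a f + sum b (λ i → f (a + i))
  sum-split zero    b f = refl
  sum-split (suc a) b f = trans (cong (f 0 +_) (sum-split a b (f ∘ suc))) (sym (+-assoc (f 0) _ _))

  sum-range-mono : ∀ {a b} f → a ≤ b → sum a f ≤ sum b f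
  sum-range-mono {a} {b} f a≤b = subst (λ n → sum a f ≤ sum n f) (m+[n∸m]≡n a≤b)
    (subst (sum a f ≤_) (sym (sum-split a (b ∸ a) f)) (m≤m+n _ _))

  sum-swap : ∀ m n (f : ℕ → ℕ → ℕ) → sum m (λ i → sum n (f i)) ≡ sum n (λ j → sum m (λ i → f i j))
  sum-swap zero    n f = sym (sum-zero n λ _ _ → refl)
  sum-swap (suc m) n f = trans (cong (sum n (f 0) +_) (sum-swap m n (f ∘ suc)))
                               (sym (sum-+ n (f 0) _))

  sum-blocks : ∀ c b f → sum (c * b) f ≡ sum c (λ α → sum b (λ j → f (α * b + j)))
  sum-blocks zero    b f = refl
  sum-blocks (suc c) b f = trans (sum-split b (c * b) f) (cong (sum b f +_)
    (trans (sum-blocks c b (λ i → f (b + i)))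
      (sum-cong c λ α _ → sum-cong b λ j _ → cong f (sym (+-assoc b (α * b) j)))))

  term≤sum : ∀ n f i → i < n → f i ≤ sum n f
  term≤sum (suc n) f zero    _         = m≤m+n _ _
  term≤sum (suc n) f (suc i) (s<s i<n) = ≤-trans (term≤sum n (f ∘ suc) i i<n) (m≤n+m _ _)

  tri₂ : ℕ → (ℕ → ℕ → ℕ) → ℕ
  tri₂ n G = sum n λ y → sum y λ x → G x y

  tri₃ : ℕ → (ℕ → ℕ → ℕ → ℕ) → ℕ
  tri₃ n F = sum n λ z → tri₂ z λ x y → F x y z

  -- The cases are whether the least vertex is 0. Pascal's rule and the counts of shifted families
  -- both rest on this splitting.
  tri₂-suc : ∀ n G → tri₂ (suc n) G ≡ sum n (λ y → G 0 (suc y)) + tri₂ n (λ x y → G (suc x) (suc y))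
  tri₂-suc n G = sum-+ n _ _

  tri₃-suc : ∀ n F → tri₃ (suc n) F ≡ tri₂ n (λ y z → F 0 (suc y) (suc z)) + tri₃ n (λ x y z → F (suc x) (suc y) (suc z))
  tri₃-suc n F = trans (sum-cong n λ z _ → tri₂-suc z λ x y → F x y (suc z)) (sum-+ n _ _)

  tri₂-mono : ∀ n {G H} → (∀ x y → x < y → y < n → G x y ≤ H x y) → tri₂ n G ≤ tri₂ n H
  tri₂-mono n h = sum-mono n λ y y<n → sum-mono y λ x x<y → h x y x<y y<n

  tri₃-mono : ∀ n {F G} → (∀ x y z → x < y → y < z → z < n → F x y z ≤ G x y z) → tri₃ n F ≤ tri₃ n G
  tri₃-mono n h = sum-mono n λ z z<n → tri₂-mono z λ x y x<y y<z → h x y z x<y y<z z<n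

  tri₂-+ : ∀ n F G → tri₂ n (λ x y → F x y + G x y) ≡ tri₂ n F + tri₂ n G
  tri₂-+ n F G = trans (sum-cong n λ y _ → sum-+ y _ _) (sum-+ n _ _)

  tri₃-+ : ∀ n F G → tri₃ n (λ x y z → F x y z + G x y z) ≡ tri₃ n F + tri₃ n G
  tri₃-+ n F G = trans (sum-cong n λ z _ → tri₂-+ z _ _) (sum-+ n _ _)

  tri₂-total : ∀ n → tri₂ n (λ _ _ → 1) ≡ n C 2
  tri₂-total zero    = refl
  tri₂-total (suc n) = begin
    tri₂ (suc n) (λ _ _ → 1)             ≡⟨ tri₂-suc n (λ _ _ → 1) ⟩
    sum n (λ _ → 1) + tri₂ n (λ _ _ → 1) ≡⟨ cong₂ _+_ (trans (sum-const n 1) (*-identityʳ n)) (tri₂-total n) ⟩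
    n + n C 2                            ≡⟨ cong (_+ n C 2) (sym (nC1≡n n)) ⟩
    n C 1 + n C 2                        ≡⟨ nCk+nC[k+1]≡[n+1]C[k+1] n 1 ⟩
    suc n C 2                            ∎
    where
    open ≡-Reasoning
    open import Data.Nat.Combinatorics using (nC1≡n)

  tri₃-total : ∀ n → tri₃ n (λ _ _ _ → 1) ≡ n C 3
  tri₃-total zero    = refl
  tri₃-total (suc n) = trans (tri₃-suc n (λ _ _ _ → 1))
    (trans (cong₂ _+_ (tri₂-total n) (tri₃-total n)) (nCk+nC[k+1]≡[n+1]C[k+1] n 2))

  Pascal₂ : ∀ n → suc n C 2 ≡ n + n C 2
  Pascal₂ n = trans (sym (nCk+nC[k+1]≡[n+1]C[k+1] n 1)) (cong (_+ n C 2) (nC1≡n n))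
    where open import Data.Nat.Combinatorics using (nC1≡n)

  Pascal₃ : ∀ n → suc n C 3 ≡ n C 2 + n C 3
  Pascal₃ n = sym (nCk+nC[k+1]≡[n+1]C[k+1] n 2)

  2C₂ : ∀ n → 2 * (suc n C 2) ≡ suc n * n
  2C₂ zero    = refl
  2C₂ (suc n) = begin
    2 * (suc (suc n) C 2)       ≡⟨ cong (2 *_) (Pascal₂ (suc n)) ⟩
    2 * (suc n + suc n C 2)     ≡⟨ *-distribˡ-+ 2 (suc n) (suc n C 2) ⟩
    2 * suc n + 2 * (suc n C 2) ≡⟨ cong (2 * suc n +_) (2C₂ n) ⟩
    2 * suc n + suc n * n       ≡⟨ lem n ⟩
    suc (suc n) * suc n         ∎
    where
    open ≡-Reasoning
    lem : ∀ n → 2 * suc n + suc n * n ≡ suc (suc n) * suc n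
    lem = solve-∀

  6C₃ : ∀ n → 6 * (suc (suc n) C 3) ≡ suc (suc n) * suc n * n
  6C₃ zero    = refl
  6C₃ (suc n) = begin
    6 * (suc (suc (suc n)) C 3)                      ≡⟨ cong (6 *_) (Pascal₃ (suc (suc n))) ⟩
    6 * (suc (suc n) C 2 + suc (suc n) C 3)          ≡⟨ *-distribˡ-+ 6 (suc (suc n) C 2) (suc (suc n) C 3) ⟩
    6 * (suc (suc n) C 2) + 6 * (suc (suc n) C 3)    ≡⟨ cong₂ _+_ (trans (*-assoc 3 2 (suc (suc n) C 2)) (cong (3 *_)
        (2C₂ (suc n)))) (6C₃ n) ⟩
    3 * (suc (suc n) * suc n) + suc (suc n) * suc n * n ≡⟨ lem n ⟩
    suc (suc (suc n)) * suc (suc n) * suc n          ∎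
    where
    open ≡-Reasoning
    lem : ∀ n → 3 * (suc (suc n) * suc n) + suc (suc n) * suc n * n ≡ suc (suc (suc n)) * suc (suc n) * suc n
    lem = solve-∀

-- Polynomial nonnegativity certificates for the multipliers.

module Certificates where

  open import Data.Integer hiding (suc)
  open import Data.Integer.Properties
  open import Data.Integer.Tactic.RingSolver using (solve-∀)
  open import Data.Nat as ℕ using (ℕ; suc; z≤n)
  open import Relation.Binary.PropositionalEquality

  -- The multiplier of a pair: both small; mixed with sum below t; mixed with sum at least t; both big.
  ΞA ΞB ΞC ΞD : ℤ → ℤ → ℤ → ℤ
  ΞA t x y = + 8 * (t * t) + + 10 * (t * (x + y)) - + 52 * (x * y)
  ΞB t x y = + 24 * (t * t) - + 20 * (t * (x + y))
  ΞC t x y = + 20 * (t * x) + + 12 * (t * y) - + 8 * (t * t)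
  ΞD t x y = + 17 * (t * t) - + 7 * (t * (x + y))

  0≤+ : ∀ {a b} → 0ℤ ≤ a → 0ℤ ≤ b → 0ℤ ≤ a + b
  0≤+ = +-mono-≤

  0≤* : ∀ {a b} → 0ℤ ≤ a → 0ℤ ≤ b → 0ℤ ≤ a * b
  0≤* {+ m} {+ n} _ _ = subst (0ℤ ≤_) (pos-* m n) (+≤+ z≤n)

  0≤c* : ∀ c {a} → 0ℤ ≤ a → 0ℤ ≤ + c * a
  0≤c* c = 0≤* {+ c} (+≤+ z≤n)

  -- The certificates have rational coefficients; `d` is the common denominator cleared in each
  -- identity.
  0≤-cancel : ∀ d .{{_ : ℕ.NonZero d}} {a} → 0ℤ ≤ + d * a → 0ℤ ≤ a
  0≤-cancel (suc d) {a} h = *-cancelˡ-≤-pos 0ℤ a (+ suc d) (subst (_≤ + suc d * a) (sym (*-zeroʳ (+ suc d))) h)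

  -- Handelman certificates, found by linear programming, for 0 ≤ x ≤ y ≤ z ≤ t.  The letters tell which of
  -- x, y, z are small (below t/2) or big, the index counts the pairs of sum at least t, and ˡ and ʰ stand
  -- for 3y ≤ t and 3y ≥ t.
  cert-sss< : ∀ x y z t → 0ℤ ≤ t → 0ℤ ≤ x → 0ℤ ≤ (y - x) → 0ℤ ≤ (z - y) → 0ℤ ≤ (t - + 2 * z) →
    0ℤ ≤ ΞA t x y * (+ 3 * z - t) + ΞA t x z * (+ 3 * y - t) + ΞA t y z * (+ 3 * x - t) + + 24 * (t * t * t)
  cert-sss< x y z t 0≤t h0 h1 h2 h3 = 0≤-cancel 1 (subst (0ℤ ≤_) (sym (identity x y z t)) (0≤+ (0≤+ (0≤+ (0≤+ (0≤+
      (0≤+ (0≤+ (0≤+ (0≤+ (0≤c* 8 (0≤* (0≤* h1 0≤t) 0≤t)) (0≤c* 214 (0≤* (0≤* h0 h1) 0≤t))) (0≤c* 102 (0≤* (0≤* h0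
      h0) 0≤t))) (0≤c* 234 (0≤* (0≤* h0 h1) h3))) (0≤c* 4 (0≤* (0≤* h2 0≤t) 0≤t))) (0≤c* 12 (0≤* (0≤* h0 0≤t) 0≤t)))
      (0≤c* 234 (0≤* (0≤* h0 h0) h3))) (0≤c* 224 (0≤* (0≤* h0 h2) 0≤t))) (0≤c* 112 (0≤* (0≤* h1 h1) 0≤t))) (0≤c* 112
      (0≤* (0≤* h1 h2) 0≤t))))
    where
    identity : ∀ x y z t → + 1 * ((+ 8 * (t * t) + + 10 * (t * (x + y)) - + 52 * (x * y)) * (+ 3 * z - t)
        + (+ 8 * (t * t) + + 10 * (t * (x + z)) - + 52 * (x * z)) * (+ 3 * y - t) + (+ 8 * (t * t) + + 10 * (t * (y
        + z)) - + 52 * (y * z)) * (+ 3 * x - t) + + 24 * (t * t * t)) ≡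
      + 8 * ((y - x) * t * t) + + 214 * (x * (y - x) * t) + + 102 * (x * x * t) + + 234 * (x * (y - x) * (t -
          + 2 * z)) + + 4 * ((z - y) * t * t) + + 12 * (x * t * t) + + 234 * (x * x * (t - + 2 * z)) +
          + 224 * (x * (z - y) * t) + + 112 * ((y - x) * (y - x) * t) + + 112 * ((y - x) * (z - y) * t)
    identity = solve-∀

  cert-sss≥ : ∀ x y z t → 0ℤ ≤ t → 0ℤ ≤ x → 0ℤ ≤ (y - x) → 0ℤ ≤ (z - y) → 0ℤ ≤ (t - + 2 * z) → 0ℤ ≤ (x + y + z - t) →
    0ℤ ≤ ΞA t x y * (+ 3 * z - t) + ΞA t x z * (+ 3 * y - t) + ΞA t y z * (+ 3 * x - t)
  cert-sss≥ x y z t 0≤t h0 h1 h2 h3 h4 = 0≤-cancel 3 (subst (0ℤ ≤_) (sym (identity x y z t)) (0≤+ (0≤+ (0≤+ (0≤+ (0≤+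
      (0≤+ (0≤+ (0≤+ (0≤+ (0≤+ (0≤+ (0≤+ (0≤+ (0≤+ (0≤+ (0≤c* 18 (0≤* (0≤* h2 h4) h4)) (0≤c* 27 (0≤* (0≤* h1 h2)
      0≤t))) (0≤c* 90 (0≤* (0≤* h3 h3) h4))) (0≤c* 96 (0≤* (0≤* h1 h4) 0≤t))) (0≤c* 45 (0≤* (0≤* h4 0≤t) 0≤t))) (0≤c*
      44 (0≤* (0≤* h1 h1) 0≤t))) (0≤c* 51 (0≤* (0≤* h1 h2) h3))) (0≤c* 66 (0≤* (0≤* h3 h4) 0≤t))) (0≤c* 60 (0≤* (0≤*
      h2 h2) h3))) (0≤c* 129 (0≤* (0≤* h3 h4) h4))) (0≤c* 104 (0≤* (0≤* h1 h1) h1))) (0≤c* 72 (0≤* (0≤* h0 h2) h2)))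
      (0≤c* 183 (0≤* (0≤* h2 h4) 0≤t))) (0≤c* 27 (0≤* (0≤* h0 h3) h4))) (0≤c* 104 (0≤* (0≤* h1 h1) h4))) (0≤c* 190
      (0≤* (0≤* h1 h1) h2))))
    where
    identity : ∀ x y z t → + 3 * ((+ 8 * (t * t) + + 10 * (t * (x + y)) - + 52 * (x * y)) * (+ 3 * z - t)
        + (+ 8 * (t * t) + + 10 * (t * (x + z)) - + 52 * (x * z)) * (+ 3 * y - t) + (+ 8 * (t * t) + + 10 * (t * (y
        + z)) - + 52 * (y * z)) * (+ 3 * x - t)) ≡
      + 18 * ((z - y) * (x + y + z - t) * (x + y + z - t)) + + 27 * ((y - x) * (z - y) * t) + + 90 * ((t -
          + 2 * z) * (t - + 2 * z) * (x + y + z - t)) + + 96 * ((y - x) * (x + y + z - t) * t) + + 45 * ((x + y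
          + z - t) * t * t) + + 44 * ((y - x) * (y - x) * t) + + 51 * ((y - x) * (z - y) * (t - + 2 * z)) +
          + 66 * ((t - + 2 * z) * (x + y + z - t) * t) + + 60 * ((z - y) * (z - y) * (t - + 2 * z)) + + 129 * ((t -
          + 2 * z) * (x + y + z - t) * (x + y + z - t)) + + 104 * ((y - x) * (y - x) * (y - x)) +
          + 72 * (x * (z - y) * (z - y)) + + 183 * ((z - y) * (x + y + z - t) * t) + + 27 * (x * (t - + 2 * z) * (x
          + y + z - t)) + + 104 * ((y - x) * (y - x) * (x + y + z - t)) + + 190 * ((y - x) * (y - x) * (z - y))
    identity = solve-∀

  cert-ssb< : ∀ x y z t → 0ℤ ≤ t → 0ℤ ≤ x → 0ℤ ≤ (y - x) → 0ℤ ≤ (t - + 2 * y) → 0ℤ ≤ (+ 2 * z - t) → 0ℤ ≤ (t - (x + y + z)) →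
    0ℤ ≤ ΞA t x y * (+ 3 * z - t) + ΞB t x z * (+ 3 * y - t) + ΞB t y z * (+ 3 * x - t) + + 24 * (t * t * t)
  cert-ssb< x y z t 0≤t h0 h1 h2 h3 h4 = 0≤-cancel 2 (subst (0ℤ ≤_) (sym (identity x y z t)) (0≤+ (0≤+ (0≤+ (0≤+ (0≤+
      (0≤+ (0≤+ (0≤c* 78 (0≤* (0≤* h0 h2) h3)) (0≤c* 122 (0≤* (0≤* h0 0≤t) 0≤t))) (0≤c* 5 (0≤* (0≤* h3 h3) 0≤t)))
      (0≤c* 146 (0≤* (0≤* h0 h2) 0≤t))) (0≤c* 98 (0≤* (0≤* h1 h3) 0≤t))) (0≤c* 59 (0≤* (0≤* h2 h3) 0≤t))) (0≤c* 134
      (0≤* (0≤* h1 0≤t) 0≤t))) (0≤c* 10 (0≤* (0≤* h3 h4) 0≤t))))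
    where
    identity : ∀ x y z t → + 2 * ((+ 8 * (t * t) + + 10 * (t * (x + y)) - + 52 * (x * y)) * (+ 3 * z - t)
        + (+ 24 * (t * t) - + 20 * (t * (x + z))) * (+ 3 * y - t) + (+ 24 * (t * t) - + 20 * (t * (y
        + z))) * (+ 3 * x - t) + + 24 * (t * t * t)) ≡
      + 78 * (x * (t - + 2 * y) * (+ 2 * z - t)) + + 122 * (x * t * t) + + 5 * ((+ 2 * z - t) * (+ 2 * z - t) * t)
          + + 146 * (x * (t - + 2 * y) * t) + + 98 * ((y - x) * (+ 2 * z - t) * t) + + 59 * ((t -
          + 2 * y) * (+ 2 * z - t) * t) + + 134 * ((y - x) * t * t) + + 10 * ((+ 2 * z - t) * (t - (x + y + z)) * t)
    identity = solve-∀

  cert-ssb₀ : ∀ x y z t → 0ℤ ≤ t → 0ℤ ≤ x → 0ℤ ≤ (y - x) → 0ℤ ≤ (t - + 2 * y) → 0ℤ ≤ (+ 2 * z - t) → 0ℤ ≤ (x + y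
      + z - t) → 0ℤ ≤ (t - (x + z)) →
    0ℤ ≤ ΞA t x y * (+ 3 * z - t) + ΞB t x z * (+ 3 * y - t) + ΞB t y z * (+ 3 * x - t)
  cert-ssb₀ x y z t 0≤t h0 h1 h2 h3 h4 h5 = 0≤-cancel 4 (subst (0ℤ ≤_) (sym (identity x y z t)) (0≤+ (0≤+ (0≤+ (0≤+
      (0≤+ (0≤+ (0≤+ (0≤+ (0≤+ (0≤+ (0≤+ (0≤+ (0≤+ (0≤+ (0≤c* 152 (0≤* (0≤* h0 h2) h3)) (0≤c* 14 (0≤* (0≤* h1 h4)
      0≤t))) (0≤c* 2 (0≤* (0≤* h1 h1) h3))) (0≤c* 3 (0≤* (0≤* h1 0≤t) 0≤t))) (0≤c* 32 (0≤* (0≤* h3 h3) 0≤t))) (0≤c* 2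
      (0≤* (0≤* h0 h3) h3))) (0≤c* 76 (0≤* (0≤* h1 h3) 0≤t))) (0≤c* 2 (0≤* (0≤* h2 h3) h4))) (0≤c* 46 (0≤* (0≤* h4
      0≤t) 0≤t))) (0≤c* 6 (0≤* (0≤* h0 0≤t) 0≤t))) (0≤c* 146 (0≤* (0≤* h1 h1) 0≤t))) (0≤c* 132 (0≤* (0≤* h4 h5)
      0≤t))) (0≤c* 1 (0≤* (0≤* h1 h3) h3))) (0≤c* 80 (0≤* (0≤* h2 h4) 0≤t))) (0≤c* 2 (0≤* (0≤* h1 h3) h4))))
    where
    identity : ∀ x y z t → + 4 * ((+ 8 * (t * t) + + 10 * (t * (x + y)) - + 52 * (x * y)) * (+ 3 * z - t)
        + (+ 24 * (t * t) - + 20 * (t * (x + z))) * (+ 3 * y - t) + (+ 24 * (t * t) - + 20 * (t * (y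
        + z))) * (+ 3 * x - t)) ≡
      + 152 * (x * (t - + 2 * y) * (+ 2 * z - t)) + + 14 * ((y - x) * (x + y + z - t) * t) +
          + 2 * ((y - x) * (y - x) * (+ 2 * z - t)) + + 3 * ((y - x) * t * t) +
          + 32 * ((+ 2 * z - t) * (+ 2 * z - t) * t) + + 2 * (x * (+ 2 * z - t) * (+ 2 * z - t)) +
          + 76 * ((y - x) * (+ 2 * z - t) * t) + + 2 * ((t - + 2 * y) * (+ 2 * z - t) * (x + y + z - t)) +
          + 46 * ((x + y + z - t) * t * t) + + 6 * (x * t * t) + + 146 * ((y - x) * (y - x) * t) + + 132 * ((x + y
          + z - t) * (t - (x + z)) * t) + + 1 * ((y - x) * (+ 2 * z - t) * (+ 2 * z - t)) + + 80 * ((t -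
          + 2 * y) * (x + y + z - t) * t) + + 2 * ((y - x) * (+ 2 * z - t) * (x + y + z - t))
    identity = solve-∀

  cert-ssb₁ˡ : ∀ x y z t → 0ℤ ≤ t → 0ℤ ≤ x → 0ℤ ≤ (y - x) → 0ℤ ≤ (+ 2 * z - t) → 0ℤ ≤ (y + z - t) → 0ℤ ≤ (t - z)
      → 0ℤ ≤ (t - + 3 * y) →
    0ℤ ≤ ΞA t x y * (+ 3 * z - t) + ΞB t x z * (+ 3 * y - t) + ΞC t y z * (+ 3 * x - t) - + 4 * (t * t * t)
  cert-ssb₁ˡ x y z t 0≤t h0 h1 h2 h3 h4 h5 = 0≤-cancel 3 (subst (0ℤ ≤_) (sym (identity x y z t)) (0≤+ (0≤+ (0≤+ (0≤+
      (0≤+ (0≤+ (0≤c* 12 (0≤* (0≤* h0 h2) 0≤t)) (0≤c* 72 (0≤* (0≤* h3 0≤t) 0≤t))) (0≤c* 18 (0≤* (0≤* h1 h4) 0≤t)))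
      (0≤c* 78 (0≤* (0≤* h0 h2) h5))) (0≤c* 40 (0≤* (0≤* h0 0≤t) 0≤t))) (0≤c* 12 (0≤* (0≤* h2 h5) 0≤t))) (0≤c* 26
      (0≤* (0≤* h0 h5) 0≤t))))
    where
    identity : ∀ x y z t → + 3 * ((+ 8 * (t * t) + + 10 * (t * (x + y)) - + 52 * (x * y)) * (+ 3 * z - t)
        + (+ 24 * (t * t) - + 20 * (t * (x + z))) * (+ 3 * y - t) + (+ 20 * (t * y) + + 12 * (t * z) -
        + 8 * (t * t)) * (+ 3 * x - t) - + 4 * (t * t * t)) ≡
      + 12 * (x * (+ 2 * z - t) * t) + + 72 * ((y + z - t) * t * t) + + 18 * ((y - x) * (t - z) * t) +
          + 78 * (x * (+ 2 * z - t) * (t - + 3 * y)) + + 40 * (x * t * t) + + 12 * ((+ 2 * z - t) * (t -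
          + 3 * y) * t) + + 26 * (x * (t - + 3 * y) * t)
    identity = solve-∀

  cert-ssb₁ʰ : ∀ x y z t → 0ℤ ≤ t → 0ℤ ≤ x → 0ℤ ≤ (t - + 2 * y) → 0ℤ ≤ (+ 2 * z - t) → 0ℤ ≤ (y + z - t) → 0ℤ
      ≤ (t - (x + z)) → 0ℤ ≤ (+ 3 * y - t) →
    0ℤ ≤ ΞA t x y * (+ 3 * z - t) + ΞB t x z * (+ 3 * y - t) + ΞC t y z * (+ 3 * x - t) - + 4 * (t * t * t)
  cert-ssb₁ʰ x y z t 0≤t h0 h1 h2 h3 h4 h5 = 0≤-cancel 3 (subst (0ℤ ≤_) (sym (identity x y z t)) (0≤+ (0≤+ (0≤+ (0≤+
      (0≤+ (0≤+ (0≤+ (0≤+ (0≤c* 2 (0≤* (0≤* h2 0≤t) 0≤t)) (0≤c* 9 (0≤* (0≤* h2 h2) 0≤t))) (0≤c* 36 (0≤* (0≤* h3 0≤t)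
      0≤t))) (0≤c* 14 (0≤* (0≤* h4 h5) 0≤t))) (0≤c* 117 (0≤* (0≤* h0 h1) h2))) (0≤c* 25 (0≤* (0≤* h0 0≤t) 0≤t)))
      (0≤c* 3 (0≤* (0≤* h1 h2) 0≤t))) (0≤c* 2 (0≤* (0≤* h5 0≤t) 0≤t))) (0≤c* 36 (0≤* (0≤* h3 h4) 0≤t))))
    where
    identity : ∀ x y z t → + 3 * ((+ 8 * (t * t) + + 10 * (t * (x + y)) - + 52 * (x * y)) * (+ 3 * z - t)
        + (+ 24 * (t * t) - + 20 * (t * (x + z))) * (+ 3 * y - t) + (+ 20 * (t * y) + + 12 * (t * z) -
        + 8 * (t * t)) * (+ 3 * x - t) - + 4 * (t * t * t)) ≡
      + 2 * ((+ 2 * z - t) * t * t) + + 9 * ((+ 2 * z - t) * (+ 2 * z - t) * t) + + 36 * ((y + z - t) * t * t) +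
          + 14 * ((t - (x + z)) * (+ 3 * y - t) * t) + + 117 * (x * (t - + 2 * y) * (+ 2 * z - t)) +
          + 25 * (x * t * t) + + 3 * ((t - + 2 * y) * (+ 2 * z - t) * t) + + 2 * ((+ 3 * y - t) * t * t) +
          + 36 * ((y + z - t) * (t - (x + z)) * t)
    identity = solve-∀

  cert-ssb₂ˡ : ∀ x y z t → 0ℤ ≤ t → 0ℤ ≤ x → 0ℤ ≤ (y - x) → 0ℤ ≤ (+ 2 * z - t) → 0ℤ ≤ (x + z - t) → 0ℤ ≤ (t - z)
      → 0ℤ ≤ (t - + 3 * y) →
    0ℤ ≤ ΞA t x y * (+ 3 * z - t) + ΞC t x z * (+ 3 * y - t) + ΞC t y z * (+ 3 * x - t) - + 8 * (t * t * t)
  cert-ssb₂ˡ x y z t 0≤t h0 h1 h2 h3 h4 h5 = 0≤-cancel 3 (subst (0ℤ ≤_) (sym (identity x y z t)) (0≤+ (0≤+ (0≤+ (0≤+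
      (0≤+ (0≤+ (0≤+ (0≤+ (0≤c* 52 (0≤* (0≤* h3 0≤t) 0≤t)) (0≤c* 20 (0≤* (0≤* h0 h2) 0≤t))) (0≤c* 52 (0≤* (0≤* h4 h5)
      h5))) (0≤c* 44 (0≤* (0≤* h0 h3) 0≤t))) (0≤c* 15 (0≤* (0≤* h1 0≤t) 0≤t))) (0≤c* 48 (0≤* (0≤* h0 h1) 0≤t))) (0≤c*
      156 (0≤* (0≤* h1 h4) h5))) (0≤c* 4 (0≤* (0≤* h0 h0) 0≤t))) (0≤c* 21 (0≤* (0≤* h1 h2) 0≤t))))
    where
    identity : ∀ x y z t → + 3 * ((+ 8 * (t * t) + + 10 * (t * (x + y)) - + 52 * (x * y)) * (+ 3 * z - t)
        + (+ 20 * (t * x) + + 12 * (t * z) - + 8 * (t * t)) * (+ 3 * y - t) + (+ 20 * (t * y) + + 12 * (t * z) -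
        + 8 * (t * t)) * (+ 3 * x - t) - + 8 * (t * t * t)) ≡
      + 52 * ((x + z - t) * t * t) + + 20 * (x * (+ 2 * z - t) * t) + + 52 * ((t - z) * (t - + 3 * y) * (t -
          + 3 * y)) + + 44 * (x * (x + z - t) * t) + + 15 * ((y - x) * t * t) + + 48 * (x * (y - x) * t) +
          + 156 * ((y - x) * (t - z) * (t - + 3 * y)) + + 4 * (x * x * t) + + 21 * ((y - x) * (+ 2 * z - t) * t)
    identity = solve-∀

  cert-ssb₂ʰ : ∀ x y z t → 0ℤ ≤ t → 0ℤ ≤ x → 0ℤ ≤ (y - x) → 0ℤ ≤ (t - + 2 * y) → 0ℤ ≤ (+ 2 * z - t) → 0ℤ ≤ (x
      + z - t) → 0ℤ ≤ (t - z) → 0ℤ ≤ (+ 3 * y - t) →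
    0ℤ ≤ ΞA t x y * (+ 3 * z - t) + ΞC t x z * (+ 3 * y - t) + ΞC t y z * (+ 3 * x - t) - + 8 * (t * t * t)
  cert-ssb₂ʰ x y z t 0≤t h0 h1 h2 h3 h4 h5 h6 = 0≤-cancel 3 (subst (0ℤ ≤_) (sym (identity x y z t)) (0≤+ (0≤+ (0≤+
      (0≤+ (0≤+ (0≤+ (0≤+ (0≤c* 64 (0≤* (0≤* h4 0≤t) 0≤t)) (0≤c* 6 (0≤* (0≤* h1 h3) h6))) (0≤c* 64 (0≤* (0≤* h4 h6)
      0≤t))) (0≤c* 63 (0≤* (0≤* h0 h2) h3))) (0≤c* 3 (0≤* (0≤* h2 h3) 0≤t))) (0≤c* 60 (0≤* (0≤* h0 h5) h6))) (0≤c* 33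
      (0≤* (0≤* h1 0≤t) 0≤t))) (0≤c* 3 (0≤* (0≤* h2 h3) h6))))
    where
    identity : ∀ x y z t → + 3 * ((+ 8 * (t * t) + + 10 * (t * (x + y)) - + 52 * (x * y)) * (+ 3 * z - t)
        + (+ 20 * (t * x) + + 12 * (t * z) - + 8 * (t * t)) * (+ 3 * y - t) + (+ 20 * (t * y) + + 12 * (t * z) -
        + 8 * (t * t)) * (+ 3 * x - t) - + 8 * (t * t * t)) ≡
      + 64 * ((x + z - t) * t * t) + + 6 * ((y - x) * (+ 2 * z - t) * (+ 3 * y - t)) + + 64 * ((x
          + z - t) * (+ 3 * y - t) * t) + + 63 * (x * (t - + 2 * y) * (+ 2 * z - t)) + + 3 * ((t -
          + 2 * y) * (+ 2 * z - t) * t) + + 60 * (x * (t - z) * (+ 3 * y - t)) + + 33 * ((y - x) * t * t) +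
          + 3 * ((t - + 2 * y) * (+ 2 * z - t) * (+ 3 * y - t))
    identity = solve-∀

  cert-sbb₁ : ∀ x y z t → 0ℤ ≤ t → 0ℤ ≤ x → 0ℤ ≤ (z - y) → 0ℤ ≤ (t - + 2 * x) → 0ℤ ≤ (+ 2 * y - t) → 0ℤ ≤ (t - (x
      + z)) → 0ℤ ≤ (t - z) →
    0ℤ ≤ ΞB t x y * (+ 3 * z - t) + ΞB t x z * (+ 3 * y - t) + ΞD t y z * (+ 3 * x - t) - + 4 * (t * t * t)
  cert-sbb₁ x y z t 0≤t h0 h1 h2 h3 h4 h5 = 0≤-cancel 2 (subst (0ℤ ≤_) (sym (identity x y z t)) (0≤+ (0≤+ (0≤+ (0≤+
      (0≤+ (0≤c* 3 (0≤* (0≤* h1 0≤t) 0≤t)) (0≤c* 12 (0≤* (0≤* h0 h5) 0≤t))) (0≤c* 120 (0≤* (0≤* h3 h4) 0≤t))) (0≤c*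
      14 (0≤* (0≤* h0 0≤t) 0≤t))) (0≤c* 75 (0≤* (0≤* h1 h2) 0≤t))) (0≤c* 18 (0≤* (0≤* h2 h3) 0≤t))))
    where
    identity : ∀ x y z t → + 2 * ((+ 24 * (t * t) - + 20 * (t * (x + y))) * (+ 3 * z - t) + (+ 24 * (t * t) -
        + 20 * (t * (x + z))) * (+ 3 * y - t) + (+ 17 * (t * t) - + 7 * (t * (y + z))) * (+ 3 * x - t) -
        + 4 * (t * t * t)) ≡
      + 3 * ((z - y) * t * t) + + 12 * (x * (t - z) * t) + + 120 * ((+ 2 * y - t) * (t - (x + z)) * t) +
          + 14 * (x * t * t) + + 75 * ((z - y) * (t - + 2 * x) * t) + + 18 * ((t - + 2 * x) * (+ 2 * y - t) * t)
    identity = solve-∀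

  cert-sbb₂ : ∀ x y z t → 0ℤ ≤ t → 0ℤ ≤ x → 0ℤ ≤ (y - x) → 0ℤ ≤ (z - y) → 0ℤ ≤ (t - + 2 * x) → 0ℤ ≤ (+ 2 * y - t)
      → 0ℤ ≤ (x + z - t) → 0ℤ ≤ (t - (x + y)) → 0ℤ ≤ (t - z) →
    0ℤ ≤ ΞB t x y * (+ 3 * z - t) + ΞC t x z * (+ 3 * y - t) + ΞD t y z * (+ 3 * x - t) - + 8 * (t * t * t)
  cert-sbb₂ x y z t 0≤t h0 h1 h2 h3 h4 h5 h6 h7 = 0≤-cancel 4 (subst (0ℤ ≤_) (sym (identity x y z t)) (0≤+ (0≤+ (0≤+
      (0≤+ (0≤+ (0≤+ (0≤+ (0≤+ (0≤+ (0≤c* 72 (0≤* (0≤* h5 0≤t) 0≤t)) (0≤c* 12 (0≤* (0≤* h5 h6) 0≤t))) (0≤c* 97 (0≤*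
      (0≤* h2 h3) 0≤t))) (0≤c* 20 (0≤* (0≤* h0 h0) 0≤t))) (0≤c* 31 (0≤* (0≤* h3 h5) 0≤t))) (0≤c* 13 (0≤* (0≤* h1 h3)
      0≤t))) (0≤c* 7 (0≤* (0≤* h3 h3) h3))) (0≤c* 14 (0≤* (0≤* h3 h3) h5))) (0≤c* 42 (0≤* (0≤* h4 h7) 0≤t))) (0≤c* 56
      (0≤* (0≤* h0 h0) h7))))
    where
    identity : ∀ x y z t → + 4 * ((+ 24 * (t * t) - + 20 * (t * (x + y))) * (+ 3 * z - t) + (+ 20 * (t * x) +
        + 12 * (t * z) - + 8 * (t * t)) * (+ 3 * y - t) + (+ 17 * (t * t) - + 7 * (t * (y + z))) * (+ 3 * x - t) -
        + 8 * (t * t * t)) ≡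
      + 72 * ((x + z - t) * t * t) + + 12 * ((x + z - t) * (t - (x + y)) * t) + + 97 * ((z - y) * (t -
          + 2 * x) * t) + + 20 * (x * x * t) + + 31 * ((t - + 2 * x) * (x + z - t) * t) + + 13 * ((y - x) * (t -
          + 2 * x) * t) + + 7 * ((t - + 2 * x) * (t - + 2 * x) * (t - + 2 * x)) + + 14 * ((t - + 2 * x) * (t -
          + 2 * x) * (x + z - t)) + + 42 * ((+ 2 * y - t) * (t - z) * t) + + 56 * (x * x * (t - z))
    identity = solve-∀

  cert-sbb₃ : ∀ x y z t → 0ℤ ≤ t → 0ℤ ≤ x → 0ℤ ≤ (z - y) → 0ℤ ≤ (+ 2 * y - t) → 0ℤ ≤ (x + y - t) →
    0ℤ ≤ ΞC t x y * (+ 3 * z - t) + ΞC t x z * (+ 3 * y - t) + ΞD t y z * (+ 3 * x - t) - + 12 * (t * t * t)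
  cert-sbb₃ x y z t 0≤t h0 h1 h2 h3 = 0≤-cancel 1 (subst (0ℤ ≤_) (sym (identity x y z t)) (0≤+ (0≤+ (0≤+ (0≤+ (0≤+
      (0≤+ (0≤c* 36 (0≤* (0≤* h1 h2) 0≤t)) (0≤c* 7 (0≤* (0≤* h1 0≤t) 0≤t))) (0≤c* 50 (0≤* (0≤* h3 0≤t) 0≤t))) (0≤c*
      36 (0≤* (0≤* h2 h3) 0≤t))) (0≤c* 39 (0≤* (0≤* h0 h1) 0≤t))) (0≤c* 1 (0≤* (0≤* 0≤t 0≤t) 0≤t))) (0≤c* 3 (0≤* (0≤*
      h0 h2) 0≤t))))
    where
    identity : ∀ x y z t → + 1 * ((+ 20 * (t * x) + + 12 * (t * y) - + 8 * (t * t)) * (+ 3 * z - t)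
        + (+ 20 * (t * x) + + 12 * (t * z) - + 8 * (t * t)) * (+ 3 * y - t) + (+ 17 * (t * t) - + 7 * (t * (y
        + z))) * (+ 3 * x - t) - + 12 * (t * t * t)) ≡
      + 36 * ((z - y) * (+ 2 * y - t) * t) + + 7 * ((z - y) * t * t) + + 50 * ((x + y - t) * t * t) +
          + 36 * ((+ 2 * y - t) * (x + y - t) * t) + + 39 * (x * (z - y) * t) + + 1 * (t * t * t) +
          + 3 * (x * (+ 2 * y - t) * t)
    identity = solve-∀

  cert-bbb : ∀ x y z t → 0ℤ ≤ t → 0ℤ ≤ (y - x) → 0ℤ ≤ (z - y) → 0ℤ ≤ (+ 2 * x - t) → 0ℤ ≤ (t - z) →
    0ℤ ≤ ΞD t x y * (+ 3 * z - t) + ΞD t x z * (+ 3 * y - t) + ΞD t y z * (+ 3 * x - t) - + 12 * (t * t * t)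
  cert-bbb x y z t 0≤t h0 h1 h2 h3 = 0≤-cancel 1 (subst (0ℤ ≤_) (sym (identity x y z t)) (0≤+ (0≤+ (0≤+ (0≤+ (0≤+
      (0≤+ (0≤c* 23 (0≤* (0≤* h1 0≤t) 0≤t)) (0≤c* 3 (0≤* (0≤* h2 0≤t) 0≤t))) (0≤c* 25 (0≤* (0≤* h0 0≤t) 0≤t))) (0≤c*
      42 (0≤* (0≤* h0 h3) 0≤t))) (0≤c* 21 (0≤* (0≤* h1 h2) 0≤t))) (0≤c* 63 (0≤* (0≤* h2 h3) 0≤t))) (0≤c* 3 (0≤* (0≤*
      0≤t 0≤t) 0≤t))))
    where
    identity : ∀ x y z t → + 1 * ((+ 17 * (t * t) - + 7 * (t * (x + y))) * (+ 3 * z - t) + (+ 17 * (t * t) -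
        + 7 * (t * (x + z))) * (+ 3 * y - t) + (+ 17 * (t * t) - + 7 * (t * (y + z))) * (+ 3 * x - t) -
        + 12 * (t * t * t)) ≡
      + 23 * ((z - y) * t * t) + + 3 * ((+ 2 * x - t) * t * t) + + 25 * ((y - x) * t * t) +
          + 42 * ((y - x) * (t - z) * t) + + 21 * ((z - y) * (+ 2 * x - t) * t) +
          + 63 * ((+ 2 * x - t) * (t - z) * t) + + 3 * (t * t * t)
    identity = solve-∀

-- The pointwise inequality behind the factor 1/2.

module Pointwise where

  open Certificates
  open import Data.Integer hiding (suc; _<_)
  open import Data.Integer.Properties hiding (≤-total; ≤-trans; <-≤-trans; ≤-refl; ≤-reflexive)
  open import Data.Integer.Tactic.RingSolver using (solve-∀)
  import Data.Nat as ℕ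
  open import Data.Nat using (ℕ; _<_; z≤n)
  import Data.Nat.Properties as ℕₚ
  open import Data.Sum using (_⊎_; inj₁; inj₂)
  open import Data.Empty using (⊥; ⊥-elim)
  open import Relation.Binary.PropositionalEquality using (_≡_; refl; sym; trans; cong; cong₂; subst)

  Cmp : ℕ → ℕ → Set
  Cmp a b = a < b ⊎ b ℕ.≤ a

  abstract
    -- Opaque, so that `Ξ`, `κ` and `ι` stay stuck on literal `cmp` terms and a single `with`
    -- resolves all of them together.
    cmp : ∀ a b → Cmp a b
    cmp = ℕₚ.<-≤-connex

  [_] : ∀ {a b} → Cmp a b → ℕ
  [ inj₁ _ ] = 1
  [ inj₂ _ ] = 0

  [_]ᶜ : ∀ {a b} → Cmp a b → ℕ
  [ inj₁ _ ]ᶜ = 0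
  [ inj₂ _ ]ᶜ = 1

  -- `ΞC` is the one asymmetric piece: its first argument is the small one, whence the exchange of
  -- `x` and `y` in the fifth clause.
  Ξ′ : ∀ {s} t x y → Cmp (2 ℕ.* x) t → Cmp (2 ℕ.* y) t → Cmp s t → ℤ
  Ξ′ t x y (inj₁ _) (inj₁ _) _        = ΞA (+ t) (+ x) (+ y)
  Ξ′ t x y (inj₁ _) (inj₂ _) (inj₁ _) = ΞB (+ t) (+ x) (+ y)
  Ξ′ t x y (inj₁ _) (inj₂ _) (inj₂ _) = ΞC (+ t) (+ x) (+ y)
  Ξ′ t x y (inj₂ _) (inj₁ _) (inj₁ _) = ΞB (+ t) (+ x) (+ y)
  Ξ′ t x y (inj₂ _) (inj₁ _) (inj₂ _) = ΞC (+ t) (+ y) (+ x)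
  Ξ′ t x y (inj₂ _) (inj₂ _) _        = ΞD (+ t) (+ x) (+ y)

  Ξ : ℕ → ℕ → ℕ → ℤ
  Ξ t x y = Ξ′ t x y (cmp (2 ℕ.* x) t) (cmp (2 ℕ.* y) t) (cmp (x ℕ.+ y) t)

  κ : ℕ → ℕ → ℕ → ℕ
  κ t x y = [ cmp (x ℕ.+ y) t ]ᶜ

  ι : ℕ → ℕ → ℕ → ℕ → ℕ
  ι t x y z = [ cmp (x ℕ.+ y ℕ.+ z) t ]

  t³ : ℕ → ℤ
  t³ t = + t * + t * + t

  term : ℕ → ℕ → ℕ → ℕ → ℤ
  term t x y z = Ξ t x y * (+ 3 * + z - + t) - + 4 * t³ t * + κ t x y

  -- When the mean of the weights is t/3, the Ξ-part of Φ averages to zero over independent x, y, z, so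
  -- Φ ≥ 0 gives P(x + y + z < t) ≥ P(x + y ≥ t) / 2.
  Φ : ℕ → ℕ → ℕ → ℕ → ℤ
  Φ t x y z = + 24 * t³ t * + ι t x y z + (term t x y z + term t x z y + term t y z x)

  ΞA-comm : ∀ t x y → ΞA t x y ≡ ΞA t y x
  ΞA-comm = lem where
    lem : ∀ t x y → + 8 * (t * t) + + 10 * (t * (x + y)) - + 52 * (x * y) ≡ + 8 * (t * t) + + 10 * (t * (y + x)) - + 52 * (y * x)
    lem = solve-∀

  ΞB-comm : ∀ t x y → ΞB t x y ≡ ΞB t y x
  ΞB-comm t x y = cong (λ s → + 24 * (t * t) - + 20 * (t * s)) (+-comm x y)

  ΞD-comm : ∀ t x y → ΞD t x y ≡ ΞD t y x
  ΞD-comm t x y = cong (λ s → + 17 * (t * t) - + 7 * (t * s)) (+-comm x y)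

  Ξ′-comm : ∀ {s} t x y a b (c : Cmp s t) → Ξ′ t x y a b c ≡ Ξ′ t y x b a c
  Ξ′-comm t x y (inj₁ _) (inj₁ _) _        = ΞA-comm (+ t) (+ x) (+ y)
  Ξ′-comm t x y (inj₁ _) (inj₂ _) (inj₁ _) = ΞB-comm (+ t) (+ x) (+ y)
  Ξ′-comm t x y (inj₁ _) (inj₂ _) (inj₂ _) = refl
  Ξ′-comm t x y (inj₂ _) (inj₁ _) (inj₁ _) = ΞB-comm (+ t) (+ x) (+ y)
  Ξ′-comm t x y (inj₂ _) (inj₁ _) (inj₂ _) = refl
  Ξ′-comm t x y (inj₂ _) (inj₂ _) _        = ΞD-comm (+ t) (+ x) (+ y)

  Ξ-comm : ∀ t x y → Ξ t x y ≡ Ξ t y x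
  Ξ-comm t x y = trans (Ξ′-comm t x y (cmp (2 ℕ.* x) t) (cmp (2 ℕ.* y) t) (cmp (x ℕ.+ y) t))
    (cong (λ s → Ξ′ t y x (cmp (2 ℕ.* y) t) (cmp (2 ℕ.* x) t) (cmp s t)) (ℕₚ.+-comm x y))

  κ-comm : ∀ t x y → κ t x y ≡ κ t y x
  κ-comm t x y = cong (λ s → [ cmp s t ]ᶜ) (ℕₚ.+-comm x y)

  term-comm : ∀ t x y z → term t x y z ≡ term t y x z
  term-comm t x y z = cong₂ (λ a b → a * (+ 3 * + z - + t) - + 4 * t³ t * + b) (Ξ-comm t x y) (κ-comm t x y)

  0≤∸ : ∀ {a b} → a ℕ.≤ b → 0ℤ ≤ + b - + a
  0≤∸ a≤b = i≤j⇒0≤j-i (+≤+ a≤b)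

  small : ∀ {a t} → 2 ℕ.* a < t → 0ℤ ≤ + t - + 2 * + a
  small {a} {t} h = subst (λ u → 0ℤ ≤ + t - u) (pos-* 2 a) (0≤∸ (ℕₚ.<⇒≤ h))

  big : ∀ {a t} → t ℕ.≤ 2 ℕ.* a → 0ℤ ≤ + 2 * + a - + t
  big {a} {t} h = subst (λ u → 0ℤ ≤ u - + t) (pos-* 2 a) (0≤∸ h)

  third< : ∀ {a t} → 3 ℕ.* a < t → 0ℤ ≤ + t - + 3 * + a
  third< {a} {t} h = subst (λ u → 0ℤ ≤ + t - u) (pos-* 3 a) (0≤∸ (ℕₚ.<⇒≤ h))

  third≥ : ∀ {a t} → t ℕ.≤ 3 ℕ.* a → 0ℤ ≤ + 3 * + a - + t
  third≥ {a} {t} h = subst (λ u → 0ℤ ≤ u - + t) (pos-* 3 a) (0≤∸ h)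

  collect : ∀ T p q r (i j k l : ℕ) {m n} → + 24 * T * + i ≡ m → + 4 * T * (+ j + + k + + l) ≡ n →
    p + q + r + m - n ≡ + 24 * T * + i + ((p - + 4 * T * + j) + (q - + 4 * T * + k) + (r - + 4 * T * + l))
  collect T p q r i j k l refl refl = lem T p q r (+ i) (+ j) (+ k) (+ l)
    where
    lem : ∀ T p q r i j k l → p + q + r + + 24 * T * i - + 4 * T * (j + k + l) ≡
      + 24 * T * i + ((p - + 4 * T * j) + (q - + 4 * T * k) + (r - + 4 * T * l))
    lem = solve-∀

  finish : ∀ T p q r i j k l {s} → 0ℤ ≤ s → s ≡ p + q + r + + 24 * T * + i - + 4 * T * (+ j + + k + + l) →
    0ℤ ≤ + 24 * T * + i + ((p - + 4 * T * + j) + (q - + 4 * T * + k) + (r - + 4 * T * + l))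
  finish T p q r i j k l h refl = subst (0ℤ ≤_) (collect T p q r i j k l refl refl) h

  -- The certificates leave out the terms that vanish, and these identities restore them. The first
  -- index is the value of `ι`, the second the number of pairs with `κ` equal to 1.
  n₀₀ : ∀ T s → s ≡ s + + 24 * T * + 0 - + 4 * T * (+ 0 + + 0 + + 0)
  n₀₀ = solve-∀
  n₁₀ : ∀ T s → s + + 24 * T ≡ s + + 24 * T * + 1 - + 4 * T * (+ 0 + + 0 + + 0)
  n₁₀ = solve-∀
  n₀₁ : ∀ T s → s - + 4 * T ≡ s + + 24 * T * + 0 - + 4 * T * (+ 0 + + 0 + + 1)
  n₀₁ = solve-∀
  n₀₂ : ∀ T s → s - + 8 * T ≡ s + + 24 * T * + 0 - + 4 * T * (+ 0 + + 1 + + 1)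
  n₀₂ = solve-∀
  n₀₃ : ∀ T s → s - + 12 * T ≡ s + + 24 * T * + 0 - + 4 * T * (+ 1 + + 1 + + 1)
  n₀₃ = solve-∀

  module Ξ³ (t x y z : ℕ) (f g h : ℤ → ℤ → ℤ → ℤ) where
    p q r : ℤ
    p = f (+ t) (+ x) (+ y) * (+ 3 * + z - + t)
    q = g (+ t) (+ x) (+ z) * (+ 3 * + y - + t)
    r = h (+ t) (+ y) (+ z) * (+ 3 * + x - + t)

    done : ∀ i j k l {s} → 0ℤ ≤ s → s ≡ p + q + r + + 24 * t³ t * + i - + 4 * t³ t * (+ j + + k + + l) →
      0ℤ ≤ + 24 * t³ t * + i + ((p - + 4 * t³ t * + j) + (q - + 4 * t³ t * + k) + (r - + 4 * t³ t * + l))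
    done = finish (t³ t) p q r

  half+half : ∀ {a b t} → 2 ℕ.* a < t → 2 ℕ.* b < t → t ℕ.≤ a ℕ.+ b → ⊥
  half+half {a} {b} {t} p q r = ℕₚ.<-irrefl refl (ℕₚ.<-≤-trans (ℕₚ.+-mono-< p q)
    (ℕₚ.≤-trans (ℕₚ.+-mono-≤ r r) (ℕₚ.≤-reflexive (lem a b))))
    where
    open import Data.Nat.Tactic.RingSolver using () renaming (solve-∀ to solveℕ)
    lem : ∀ a b → (a ℕ.+ b) ℕ.+ (a ℕ.+ b) ≡ 2 ℕ.* a ℕ.+ 2 ℕ.* b
    lem = solveℕ

  half+half′ : ∀ {a b t} → t ℕ.≤ 2 ℕ.* a → t ℕ.≤ 2 ℕ.* b → a ℕ.+ b < t → ⊥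
  half+half′ {a} {b} {t} p q r = ℕₚ.<-irrefl refl (ℕₚ.<-≤-trans (ℕₚ.+-mono-< r r)
    (ℕₚ.≤-trans (ℕₚ.+-mono-≤ p q) (ℕₚ.≤-reflexive (lem a b))))
    where
    open import Data.Nat.Tactic.RingSolver using () renaming (solve-∀ to solveℕ)
    lem : ∀ a b → 2 ℕ.* a ℕ.+ 2 ℕ.* b ≡ (a ℕ.+ b) ℕ.+ (a ℕ.+ b)
    lem = solveℕ

  sum-contra : ∀ {a b t} → t ℕ.≤ a → a ℕ.≤ b → b < t → ⊥
  sum-contra p q r = ℕₚ.<-irrefl refl (ℕₚ.≤-<-trans (ℕₚ.≤-trans p q) r)

  -- Sorting forces κ x y ≤ κ x z ≤ κ y z, and a pair that reaches `t` makes the triple reach it.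
  -- Once the contradictory combinations are gone, each remaining one is covered by one certificate,
  -- or by two according to `3 * y` against `t`.
  Φ-sorted : ∀ t x y z → x ℕ.≤ y → y ℕ.≤ z → z ℕ.≤ t → 0ℤ ≤ Φ t x y z
  Φ-sorted t x y z x≤y y≤z z≤t
    with cmp (2 ℕ.* x) t | cmp (2 ℕ.* y) t | cmp (2 ℕ.* z) t
       | cmp (x ℕ.+ y) t | cmp (x ℕ.+ z) t | cmp (y ℕ.+ z) t | cmp (x ℕ.+ y ℕ.+ z) t | cmp (3 ℕ.* y) t
  ... | inj₁ X | inj₁ Y | inj₁ Z | inj₂ a  | _       | _       | _      | _ = ⊥-elim (half+half {x} X Y a)
  ... | inj₁ X | inj₁ Y | inj₁ Z | inj₁ _  | inj₂ a  | _       | _      | _ = ⊥-elim (half+half {x} X Z a)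
  ... | inj₁ X | inj₁ Y | inj₁ Z | inj₁ _  | inj₁ _  | inj₂ a  | _      | _ = ⊥-elim (half+half {y} Y Z a)
  ... | inj₁ X | inj₁ Y | inj₁ Z | inj₁ _  | inj₁ _  | inj₁ _  | inj₁ s | _ =
    let open Ξ³ t x y z ΞA ΞA ΞA in done 1 0 0 0
      (cert-sss< (+ x) (+ y) (+ z) (+ t) (+≤+ z≤n) (+≤+ z≤n) (0≤∸ x≤y) (0≤∸ y≤z) (small {z} Z)) (n₁₀ (t³ t) (p + q + r))
  ... | inj₁ X | inj₁ Y | inj₁ Z | inj₁ _  | inj₁ _  | inj₁ _  | inj₂ s | _ =
    let open Ξ³ t x y z ΞA ΞA ΞA in done 0 0 0 0
      (cert-sss≥ (+ x) (+ y) (+ z) (+ t) (+≤+ z≤n) (+≤+ z≤n) (0≤∸ x≤y) (0≤∸ y≤z) (small {z} Z) (0≤∸ s)) (n₀₀ (t³ t) (p + q + r))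
  ... | inj₁ X | inj₁ Y | inj₂ Z | inj₂ a  | _       | _       | _      | _ = ⊥-elim (half+half {x} X Y a)
  ... | inj₁ X | inj₁ Y | inj₂ Z | inj₁ _  | inj₁ xz | inj₁ yz | inj₁ s | _ =
    let open Ξ³ t x y z ΞA ΞB ΞB in done 1 0 0 0
      (cert-ssb< (+ x) (+ y) (+ z) (+ t) (+≤+ z≤n) (+≤+ z≤n) (0≤∸ x≤y) (small {y} Y) (big {z} Z) (0≤∸ (ℕₚ.<⇒≤ s)))
          (n₁₀ (t³ t) (p + q + r))
  ... | inj₁ X | inj₁ Y | inj₂ Z | inj₁ _  | inj₁ xz | inj₁ yz | inj₂ s | _ =
    let open Ξ³ t x y z ΞA ΞB ΞB in done 0 0 0 0
      (cert-ssb₀ (+ x) (+ y) (+ z) (+ t) (+≤+ z≤n) (+≤+ z≤n) (0≤∸ x≤y) (small {y} Y) (big {z} Z) (0≤∸ s) (0≤∸ (ℕₚ.<⇒≤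
          xz))) (n₀₀ (t³ t) (p + q + r))
  ... | inj₁ X | inj₁ Y | inj₂ Z | inj₁ _  | _       | inj₂ yz | inj₁ s | _ =
    ⊥-elim (sum-contra yz (ℕₚ.≤-trans (ℕₚ.m≤n+m (y ℕ.+ z) x) (ℕₚ.≤-reflexive (sym (ℕₚ.+-assoc x y z)))) s)
  ... | inj₁ X | inj₁ Y | inj₂ Z | inj₁ _  | inj₁ xz | inj₂ yz | inj₂ s | inj₁ w =
    let open Ξ³ t x y z ΞA ΞB ΞC in done 0 0 0 1
      (cert-ssb₁ˡ (+ x) (+ y) (+ z) (+ t) (+≤+ z≤n) (+≤+ z≤n) (0≤∸ x≤y) (big {z} Z) (0≤∸ yz) (0≤∸ z≤t) (third< {y}
          w)) (n₀₁ (t³ t) (p + q + r))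
  ... | inj₁ X | inj₁ Y | inj₂ Z | inj₁ _  | inj₁ xz | inj₂ yz | inj₂ s | inj₂ w =
    let open Ξ³ t x y z ΞA ΞB ΞC in done 0 0 0 1
      (cert-ssb₁ʰ (+ x) (+ y) (+ z) (+ t) (+≤+ z≤n) (+≤+ z≤n) (small {y} Y) (big {z} Z) (0≤∸ yz) (0≤∸ (ℕₚ.<⇒≤ xz))
          (third≥ {y} w)) (n₀₁ (t³ t) (p + q + r))
  ... | inj₁ X | inj₁ Y | inj₂ Z | inj₁ _  | inj₂ xz | inj₁ yz | _      | _ =
    ⊥-elim (sum-contra xz (ℕₚ.+-monoˡ-≤ z x≤y) yz)
  ... | inj₁ X | inj₁ Y | inj₂ Z | inj₁ _  | inj₂ xz | inj₂ yz | inj₂ s | inj₁ w =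
    let open Ξ³ t x y z ΞA ΞC ΞC in done 0 0 1 1
      (cert-ssb₂ˡ (+ x) (+ y) (+ z) (+ t) (+≤+ z≤n) (+≤+ z≤n) (0≤∸ x≤y) (big {z} Z) (0≤∸ xz) (0≤∸ z≤t) (third< {y}
          w)) (n₀₂ (t³ t) (p + q + r))
  ... | inj₁ X | inj₁ Y | inj₂ Z | inj₁ _  | inj₂ xz | inj₂ yz | inj₂ s | inj₂ w =
    let open Ξ³ t x y z ΞA ΞC ΞC in done 0 0 1 1
      (cert-ssb₂ʰ (+ x) (+ y) (+ z) (+ t) (+≤+ z≤n) (+≤+ z≤n) (0≤∸ x≤y) (small {y} Y) (big {z} Z) (0≤∸ xz) (0≤∸ z≤t)
          (third≥ {y} w)) (n₀₂ (t³ t) (p + q + r))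
  ... | inj₁ X | inj₂ Y | inj₁ Z | _       | _       | _       | _      | _ =
    ⊥-elim (sum-contra Y (ℕₚ.*-monoʳ-≤ 2 y≤z) Z)
  ... | inj₁ X | inj₂ Y | inj₂ Z | _       | _       | inj₁ yz | _      | _ = ⊥-elim (half+half′ {y} Y Z yz)
  ... | inj₁ X | inj₂ Y | inj₂ Z | _       | _       | inj₂ yz | inj₁ s | _ =
    ⊥-elim (sum-contra yz (ℕₚ.≤-trans (ℕₚ.m≤n+m (y ℕ.+ z) x) (ℕₚ.≤-reflexive (sym (ℕₚ.+-assoc x y z)))) s)
  ... | inj₁ X | inj₂ Y | inj₂ Z | inj₁ xy | inj₁ xz | inj₂ yz | inj₂ s | _ =
    let open Ξ³ t x y z ΞB ΞB ΞD in done 0 0 0 1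
      (cert-sbb₁ (+ x) (+ y) (+ z) (+ t) (+≤+ z≤n) (+≤+ z≤n) (0≤∸ y≤z) (small {x} X) (big {y} Y) (0≤∸ (ℕₚ.<⇒≤ xz))
          (0≤∸ z≤t)) (n₀₁ (t³ t) (p + q + r))
  ... | inj₁ X | inj₂ Y | inj₂ Z | inj₁ xy | inj₂ xz | inj₂ yz | inj₂ s | _ =
    let open Ξ³ t x y z ΞB ΞC ΞD in done 0 0 1 1
      (cert-sbb₂ (+ x) (+ y) (+ z) (+ t) (+≤+ z≤n) (+≤+ z≤n) (0≤∸ x≤y) (0≤∸ y≤z) (small {x} X) (big {y} Y) (0≤∸ xz)
          (0≤∸ (ℕₚ.<⇒≤ xy)) (0≤∸ z≤t)) (n₀₂ (t³ t) (p + q + r))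
  ... | inj₁ X | inj₂ Y | inj₂ Z | inj₂ xy | inj₁ xz | inj₂ yz | inj₂ s | _ =
    ⊥-elim (sum-contra xy (ℕₚ.+-monoʳ-≤ x y≤z) xz)
  ... | inj₁ X | inj₂ Y | inj₂ Z | inj₂ xy | inj₂ xz | inj₂ yz | inj₂ s | _ =
    let open Ξ³ t x y z ΞC ΞC ΞD in done 0 1 1 1
      (cert-sbb₃ (+ x) (+ y) (+ z) (+ t) (+≤+ z≤n) (+≤+ z≤n) (0≤∸ y≤z) (big {y} Y) (0≤∸ xy)) (n₀₃ (t³ t) (p + q + r))
  ... | inj₂ X | inj₁ Y | _      | _       | _       | _       | _      | _ =
    ⊥-elim (sum-contra X (ℕₚ.*-monoʳ-≤ 2 x≤y) Y)
  ... | inj₂ X | inj₂ Y | inj₁ Z | _       | _       | _       | _      | _ =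
    ⊥-elim (sum-contra Y (ℕₚ.*-monoʳ-≤ 2 y≤z) Z)
  ... | inj₂ X | inj₂ Y | inj₂ Z | inj₁ xy | _       | _       | _      | _ = ⊥-elim (half+half′ {x} X Y xy)
  ... | inj₂ X | inj₂ Y | inj₂ Z | inj₂ _  | inj₁ xz | _       | _      | _ = ⊥-elim (half+half′ {x} X Z xz)
  ... | inj₂ X | inj₂ Y | inj₂ Z | inj₂ _  | inj₂ _  | inj₁ yz | _      | _ = ⊥-elim (half+half′ {y} Y Z yz)
  ... | inj₂ X | inj₂ Y | inj₂ Z | inj₂ _  | inj₂ _  | inj₂ yz | inj₁ s | _ =
    ⊥-elim (sum-contra yz (ℕₚ.≤-trans (ℕₚ.m≤n+m (y ℕ.+ z) x) (ℕₚ.≤-reflexive (sym (ℕₚ.+-assoc x y z)))) s)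
  ... | inj₂ X | inj₂ Y | inj₂ Z | inj₂ _  | inj₂ _  | inj₂ _  | inj₂ s | _ =
    let open Ξ³ t x y z ΞD ΞD ΞD in done 0 1 1 1
      (cert-bbb (+ x) (+ y) (+ z) (+ t) (+≤+ z≤n) (0≤∸ x≤y) (0≤∸ y≤z) (big {x} X) (0≤∸ z≤t)) (n₀₃ (t³ t) (p + q + r))

  Φ-swap₁₂ : ∀ t x y z → Φ t x y z ≡ Φ t y x z
  Φ-swap₁₂ t x y z = cong₂ (λ s u → + 24 * t³ t * + [ cmp s t ] + u)
    (cong (ℕ._+ z) (ℕₚ.+-comm x y))
    (trans (lem (term t x y z) (term t x z y) (term t y z x))
           (cong (λ u → u + term t y z x + term t x z y) (term-comm t x y z)))
    where
    lem : ∀ a b c → a + b + c ≡ a + c + b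
    lem = solve-∀

  Φ-swap₂₃ : ∀ t x y z → Φ t x y z ≡ Φ t x z y
  Φ-swap₂₃ t x y z = cong₂ (λ s u → + 24 * t³ t * + [ cmp s t ] + u)
    (trans (ℕₚ.+-assoc x y z) (trans (cong (x ℕ.+_) (ℕₚ.+-comm y z)) (sym (ℕₚ.+-assoc x z y))))
    (trans (lem (term t x y z) (term t x z y) (term t y z x))
           (cong (λ u → term t x z y + term t x y z + u) (term-comm t y z x)))
    where
    lem : ∀ a b c → a + b + c ≡ b + a + c
    lem = solve-∀

  Φ-nonneg : ∀ t x y z → x ℕ.≤ t → y ℕ.≤ t → z ℕ.≤ t → 0ℤ ≤ Φ t x y z
  Φ-nonneg t x y z X Y Z with ℕₚ.≤-total x y | ℕₚ.≤-total y z | ℕₚ.≤-total x z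
  ... | inj₁ a | inj₁ b | _      = Φ-sorted t x y z a b Z
  ... | inj₁ a | inj₂ b | inj₁ c = subst (0ℤ ≤_) (Φ-swap₂₃ t x z y) (Φ-sorted t x z y c b Y)
  ... | inj₁ a | inj₂ b | inj₂ c = subst (0ℤ ≤_) (trans (Φ-swap₁₂ t z x y) (Φ-swap₂₃ t x z y)) (Φ-sorted t z x y c a Y)
  ... | inj₂ a | inj₁ b | inj₁ c = subst (0ℤ ≤_) (Φ-swap₁₂ t y x z) (Φ-sorted t y x z a c Z)
  ... | inj₂ a | inj₁ b | inj₂ c = subst (0ℤ ≤_) (trans (Φ-swap₂₃ t y z x) (Φ-swap₁₂ t y x z)) (Φ-sorted t y z x b c X)
  ... | inj₂ a | inj₂ b | _      = subst (0ℤ ≤_) (trans (Φ-swap₁₂ t z y x) (trans (Φ-swap₂₃ t y z x) (Φ-swap₁₂ t y x z)))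
                                     (Φ-sorted t z y x b a X)

-- Uniform bounds on the multiplier.

module Bounds where

  open Certificates
  open Pointwise
  open import Data.Integer hiding (suc)
  open import Data.Integer.Tactic.RingSolver using (solve-∀)
  import Data.Nat as ℕ
  open import Data.Nat using (ℕ; z≤n)
  import Data.Nat.Properties as ℕₚ
  open import Data.Product using (_×_; _,_)
  open import Data.Sum using (inj₁; inj₂)
  open import Relation.Binary.PropositionalEquality using (_≡_; sym; subst)

  -- The upper bound limits the loss when the mean of the weights slightly exceeds t/3 (`heavy`);
  -- the lower bound yields the gain when the mean is smaller (`light`).
  bounds : ℤ → ℤ → Set
  bounds t v = 0ℤ ≤ v - + 3 * (t * t) × 0ℤ ≤ + 14 * (t * t) - v

  -- The bilinear form ΞA is determined by its values at the corners of the square [0 , t/2]².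
  A-bounds : ∀ t x y → 0ℤ ≤ x → 0ℤ ≤ y → 0ℤ ≤ t - + 2 * x → 0ℤ ≤ t - + 2 * y → bounds t (ΞA t x y)
  A-bounds t x y 0≤x 0≤y p q =
    subst (0ℤ ≤_) (sym (lo t x y)) (0≤+ (0≤+ (0≤+ (0≤c* 5 (0≤* p q)) (0≤c* 20 (0≤* 0≤x q))) (0≤c* 20 (0≤* 0≤y p)))
        (0≤c* 8 (0≤* 0≤x 0≤y))) ,
    subst (0ℤ ≤_) (sym (hi t x y)) (0≤+ (0≤+ (0≤+ (0≤c* 6 (0≤* p q)) (0≤c* 2 (0≤* 0≤x q))) (0≤c* 2 (0≤* 0≤y p)))
        (0≤c* 36 (0≤* 0≤x 0≤y)))
    where
    lo : ∀ t x y → + 8 * (t * t) + + 10 * (t * (x + y)) - + 52 * (x * y) - + 3 * (t * t) ≡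
      + 5 * ((t - + 2 * x) * (t - + 2 * y)) + + 20 * (x * (t - + 2 * y)) + + 20 * (y * (t - + 2 * x)) + + 8 * (x * y)
    lo = solve-∀
    hi : ∀ t x y → + 14 * (t * t) - (+ 8 * (t * t) + + 10 * (t * (x + y)) - + 52 * (x * y)) ≡
      + 6 * ((t - + 2 * x) * (t - + 2 * y)) + + 2 * (x * (t - + 2 * y)) + + 2 * (y * (t - + 2 * x)) + + 36 * (x * y)
    hi = solve-∀

  B-bounds : ∀ t x y → 0ℤ ≤ t → 0ℤ ≤ x → 0ℤ ≤ t - (x + y) → 0ℤ ≤ + 2 * y - t → bounds t (ΞB t x y)
  B-bounds t x y 0≤t 0≤x p q =
    subst (0ℤ ≤_) (sym (lo t x y)) (0≤+ (0≤c* 20 (0≤* 0≤t p)) (0≤* 0≤t 0≤t)) ,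
    subst (0ℤ ≤_) (sym (hi t x y)) (0≤+ (0≤c* 20 (0≤* 0≤t 0≤x)) (0≤c* 10 (0≤* 0≤t q)))
    where
    lo : ∀ t x y → + 24 * (t * t) - + 20 * (t * (x + y)) - + 3 * (t * t) ≡ + 20 * (t * (t - (x + y))) + t * t
    lo = solve-∀
    hi : ∀ t x y → + 14 * (t * t) - (+ 24 * (t * t) - + 20 * (t * (x + y))) ≡ + 20 * (t * x) + + 10 * (t * (+ 2 * y - t))
    hi = solve-∀

  C-bounds : ∀ t x y → 0ℤ ≤ t → 0ℤ ≤ x → 0ℤ ≤ x + y - t → 0ℤ ≤ t - + 2 * x → 0ℤ ≤ t - y → bounds t (ΞC t x y)
  C-bounds t x y 0≤t 0≤x p q r =
    subst (0ℤ ≤_) (sym (lo t x y)) (0≤+ (0≤+ (0≤c* 12 (0≤* 0≤t p)) (0≤c* 8 (0≤* 0≤t 0≤x))) (0≤* 0≤t 0≤t)) ,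
    subst (0ℤ ≤_) (sym (hi t x y)) (0≤+ (0≤c* 10 (0≤* 0≤t q)) (0≤c* 12 (0≤* 0≤t r)))
    where
    lo : ∀ t x y → + 20 * (t * x) + + 12 * (t * y) - + 8 * (t * t) - + 3 * (t * t) ≡
      + 12 * (t * (x + y - t)) + + 8 * (t * x) + t * t
    lo = solve-∀
    hi : ∀ t x y → + 14 * (t * t) - (+ 20 * (t * x) + + 12 * (t * y) - + 8 * (t * t)) ≡
      + 10 * (t * (t - + 2 * x)) + + 12 * (t * (t - y))
    hi = solve-∀

  D-bounds : ∀ t x y → 0ℤ ≤ t → 0ℤ ≤ x → 0ℤ ≤ y → 0ℤ ≤ t - x → 0ℤ ≤ t - y → 0ℤ ≤ + 2 * x - t → bounds t (ΞD t x y)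
  D-bounds t x y 0≤t 0≤x 0≤y p q r =
    subst (0ℤ ≤_) (sym (lo t x y)) (0≤+ (0≤c* 7 (0≤* 0≤t p)) (0≤c* 7 (0≤* 0≤t q))) ,
    subst (0ℤ ≤_) (sym (hi t x y)) (0≤+ (0≤+ (0≤c* 3 (0≤* 0≤t r)) (0≤* 0≤t 0≤x)) (0≤c* 7 (0≤* 0≤t 0≤y)))
    where
    lo : ∀ t x y → + 17 * (t * t) - + 7 * (t * (x + y)) - + 3 * (t * t) ≡ + 7 * (t * (t - x)) + + 7 * (t * (t - y))
    lo = solve-∀
    hi : ∀ t x y → + 14 * (t * t) - (+ 17 * (t * t) - + 7 * (t * (x + y))) ≡
      + 3 * (t * (+ 2 * x - t)) + t * x + + 7 * (t * y)
    hi = solve-∀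

  Ξ-bounds : ∀ t x y → x ℕ.≤ t → y ℕ.≤ t → bounds (+ t) (Ξ t x y)
  Ξ-bounds t x y x≤t y≤t with cmp (2 ℕ.* x) t | cmp (2 ℕ.* y) t | cmp (x ℕ.+ y) t
  ... | inj₁ X | inj₁ Y | _      = A-bounds (+ t) (+ x) (+ y) 0≤ 0≤ (small {x} X) (small {y} Y)
    where
    0≤ : ∀ {n} → 0ℤ ≤ + n
    0≤ = +≤+ z≤n
  ... | inj₁ X | inj₂ Y | inj₁ s = B-bounds (+ t) (+ x) (+ y) (+≤+ z≤n) (+≤+ z≤n) (0≤∸ (ℕₚ.<⇒≤ s)) (big {y} Y)
  ... | inj₁ X | inj₂ Y | inj₂ s = C-bounds (+ t) (+ x) (+ y) (+≤+ z≤n) (+≤+ z≤n) (0≤∸ s) (small {x} X) (0≤∸ y≤t)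
  ... | inj₂ X | inj₁ Y | inj₁ s = subst (bounds (+ t)) (ΞB-comm (+ t) (+ y) (+ x))
    (B-bounds (+ t) (+ y) (+ x) (+≤+ z≤n) (+≤+ z≤n) (0≤∸ (ℕₚ.<⇒≤ (subst (ℕ._< t) (ℕₚ.+-comm x y) s))) (big {x} X))
  ... | inj₂ X | inj₁ Y | inj₂ s = C-bounds (+ t) (+ y) (+ x) (+≤+ z≤n) (+≤+ z≤n) (0≤∸ (subst (t ℕ.≤_) (ℕₚ.+-comm x
      y) s)) (small {y} Y) (0≤∸ x≤t)
  ... | inj₂ X | inj₂ Y | _      = D-bounds (+ t) (+ x) (+ y) (+≤+ z≤n) (+≤+ z≤n) (+≤+ z≤n) (0≤∸ x≤t) (0≤∸ y≤t) (big {x} X)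

-- Ordered triples with repetitions against increasing triples.

module Cubes where

  open Sums
  open Bounds
  open Pointwise
  import Data.Integer as I
  import Data.Integer.Properties as ℤₚ
  import Data.Integer.Tactic.RingSolver as ℤ-Ring
  open import Data.Integer using (ℤ; 0ℤ; ∣_∣) renaming (+_ to pos)
  open import Data.Nat
  open import Data.Nat.Properties
  open import Data.Nat.Tactic.RingSolver using (solve-∀)
  open import Data.Product using (_,_; proj₁; proj₂)
  open import Data.Sum using (inj₁; inj₂)
  open import Relation.Binary.PropositionalEquality using (_≡_; sym; trans; cong; cong₂; subst; module ≡-Reasoning)

  sq : ℕ → (ℕ → ℕ → ℕ) → ℕ
  sq n g = sum n λ x → sum n (g x)

  cube : ℕ → (ℕ → ℕ → ℕ → ℕ) → ℕ
  cube n h = sum n λ x → sq n (h x)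

  sq-suc : ∀ n g → sq (suc n) g ≡
    (g 0 0 + sum n (λ y → g 0 (suc y))) + (sum n (λ x → g (suc x) 0) + sq n (λ x y → g (suc x) (suc y)))
  sq-suc n g = cong (g 0 0 + sum n (λ y → g 0 (suc y)) +_) (sum-+ n _ _)

  2tri₂≤sq : ∀ n g → (∀ x y → g x y ≡ g y x) → 2 * tri₂ n g ≤ sq n g
  2tri₂≤sq zero    g gs = z≤n
  2tri₂≤sq (suc n) g gs = begin
    2 * tri₂ (suc n) g                   ≡⟨ cong (2 *_) (tri₂-suc n g) ⟩
    2 * (L + tri₂ n g′)                  ≡⟨ lem L (tri₂ n g′) ⟩
    L + (L + 2 * tri₂ n g′)              ≤⟨ +-mono-≤ (m≤n+m L (g 0 0)) (+-mono-≤ (≤-reflexive (sum-cong n λ i _ → gs 0 (suc i)))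
                                              (2tri₂≤sq n g′ λ x y → gs (suc x) (suc y))) ⟩
    (g 0 0 + L) + (sum n (λ x → g (suc x) 0) + sq n g′) ≡⟨ sq-suc n g ⟨
    sq (suc n) g                         ∎
    where
    open ≤-Reasoning
    g′ = λ x y → g (suc x) (suc y)
    L  = sum n (λ y → g 0 (suc y))
    lem : ∀ L t → 2 * (L + t) ≡ L + (L + 2 * t)
    lem = solve-∀

  sq≤2tri₂ : ∀ n g → (∀ x y → g x y ≡ g y x) → (∀ x y → g x y ≤ 1) → sq n g ≤ 2 * tri₂ n g + n
  sq≤2tri₂ zero    g gs g≤1 = z≤n
  sq≤2tri₂ (suc n) g gs g≤1 = begin
    sq (suc n) g                                ≡⟨ sq-suc n g ⟩
    (g 0 0 + L) + (sum n (λ x → g (suc x) 0) + sq n g′)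
      ≤⟨ +-mono-≤ (+-monoˡ-≤ L (g≤1 0 0)) (+-mono-≤ (≤-reflexive (sum-cong n λ i _ → gs (suc i) 0))
           (sq≤2tri₂ n g′ (λ x y → gs (suc x) (suc y)) λ x y → g≤1 (suc x) (suc y))) ⟩
    (1 + L) + (L + (2 * tri₂ n g′ + n))         ≡⟨ lem L (tri₂ n g′) n ⟩
    2 * (L + tri₂ n g′) + suc n                 ≡⟨ cong (λ u → 2 * u + suc n) (tri₂-suc n g) ⟨
    2 * tri₂ (suc n) g + suc n                  ∎
    where
    open ≤-Reasoning
    g′ = λ x y → g (suc x) (suc y)
    L  = sum n (λ y → g 0 (suc y))
    lem : ∀ L t n → (1 + L) + (L + (2 * t + n)) ≡ 2 * (L + t) + suc n
    lem = solve-∀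

  -- Every increasing triple has six orderings, and at most 3n² ordered triples have a repeated
  -- entry.
  cube≤6tri₃ : ∀ n h → (∀ x y z → h x y z ≡ h y x z) → (∀ x y z → h x y z ≡ h x z y) → (∀ x y z → h x y z ≤ 1) →
    cube n h ≤ 6 * tri₃ n h + 3 * (n * n)
  cube≤6tri₃ zero    h h₁₂ h₂₃ h≤1 = z≤n
  cube≤6tri₃ (suc n) h h₁₂ h₂₃ h≤1 = begin
    cube (suc n) h
      ≡⟨ cong₂ _+_ (sq-suc n (h 0)) (sum-cong n λ x _ → sq-suc n (h (suc x))) ⟩
    (h 0 0 0 + L₁ + (L₂ + S)) + sum n (λ x → (h (suc x) 0 0 + sum n (λ z → h (suc x) 0 (suc z))) +
        (sum n (λ y → h (suc x) (suc y) 0) + sq n (h′ x)))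
      ≡⟨ cong ((h 0 0 0 + L₁ + (L₂ + S)) +_) (trans (sum-+ n _ _) (cong₂ _+_ (sum-+ n _ _) (sum-+ n _ _))) ⟩
    (h 0 0 0 + L₁ + (L₂ + S)) + ((L₃ + S₂) + (S₃ + cube n h′))
      ≤⟨ +-mono-≤ (+-mono-≤ (+-mono-≤ (h≤1 0 0 0) (sumn≤ λ i → h≤1 0 0 (suc i))) (+-mono-≤ (sumn≤ λ i → h≤1 0 (suc i) 0) S≤))
           (+-mono-≤ (+-mono-≤ (sumn≤ λ i → h≤1 (suc i) 0 0)
              (≤-trans (≤-reflexive (sum-cong n λ x _ → sum-cong n λ z _ → h₁₂ (suc x) 0 (suc z))) S≤))
            (+-mono-≤ (≤-trans (≤-reflexive (sum-cong n λ x _ → sum-cong n λ y _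
                → trans (h₂₃ (suc x) (suc y) 0) (h₁₂ (suc x) 0 (suc y)))) S≤)
              (cube≤6tri₃ n h′ (λ x y z → h₁₂ (suc x) (suc y) (suc z)) (λ x y z → h₂₃ (suc x) (suc y) (suc z))
                 (λ x y z → h≤1 (suc x) (suc y) (suc z))))) ⟩
    (1 + n + (n + (2 * t₂ + n))) + ((n + (2 * t₂ + n)) + ((2 * t₂ + n) + (6 * t₃ + 3 * (n * n))))
      ≡⟨ lem n t₂ t₃ ⟩
    6 * (t₂ + t₃) + (3 * (n * n) + 6 * n + 1)
      ≤⟨ +-monoʳ-≤ (6 * (t₂ + t₃)) (m≤m+n _ 2) ⟩
    6 * (t₂ + t₃) + (3 * (n * n) + 6 * n + 1 + 2)
      ≡⟨ cong₂ _+_ (cong (6 *_) (sym (tri₃-suc n h))) (lem₂ n) ⟩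
    6 * tri₃ (suc n) h + 3 * (suc n * suc n) ∎
    where
    open ≤-Reasoning
    h′ = λ x y z → h (suc x) (suc y) (suc z)
    L₁ = sum n (λ z → h 0 0 (suc z))
    L₂ = sum n (λ y → h 0 (suc y) 0)
    L₃ = sum n (λ x → h (suc x) 0 0)
    S  = sq n (λ y z → h 0 (suc y) (suc z))
    S₂ = sum n (λ x → sum n (λ z → h (suc x) 0 (suc z)))
    S₃ = sum n (λ x → sum n (λ y → h (suc x) (suc y) 0))
    t₂ = tri₂ n (λ y z → h 0 (suc y) (suc z))
    t₃ = tri₃ n h′
    sumn≤ : ∀ {f} → (∀ i → f i ≤ 1) → sum n f ≤ n
    sumn≤ p = ≤-trans (sum-≤const n 1 λ i _ → p i) (≤-reflexive (*-identityʳ n))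
    S≤ : S ≤ 2 * t₂ + n
    S≤ = sq≤2tri₂ n _ (λ y z → h₂₃ 0 (suc y) (suc z)) (λ y z → h≤1 0 (suc y) (suc z))
    lem : ∀ n t₂ t₃ → (1 + n + (n + (2 * t₂ + n))) + ((n + (2 * t₂ + n)) + ((2 * t₂ + n) + (6 * t₃ + 3 * (n * n)))) ≡
      6 * (t₂ + t₃) + (3 * (n * n) + 6 * n + 1)
    lem = solve-∀
    lem₂ : ∀ n → 3 * (n * n) + 6 * n + 1 + 2 ≡ 3 * (suc n * suc n)
    lem₂ = solve-∀

  -- For arguments up to `t` the multiplier is nonnegative by `Ξ-bounds`, so taking the absolute
  -- value only moves it to ℕ (`+ξ`).
  ξ : ℕ → ℕ → ℕ → ℕ
  ξ t x y = ∣ Ξ t x y ∣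

  module _ (t x y : ℕ) (x≤t : x ≤ t) (y≤t : y ≤ t) where
    private
      tt : pos t I.* pos t ≡ pos (t * t)
      tt = sym (ℤₚ.pos-* t t)

      3tt≤Ξ : pos (3 * (t * t)) I.≤ Ξ t x y
      3tt≤Ξ = subst (I._≤ Ξ t x y) (trans (cong (pos 3 I.*_) tt) (sym (ℤₚ.pos-* 3 (t * t))))
        (ℤₚ.0≤i-j⇒j≤i (proj₁ (Ξ-bounds t x y x≤t y≤t)))

    +ξ : pos (ξ t x y) ≡ Ξ t x y
    +ξ = ℤₚ.0≤i⇒+∣i∣≡i (ℤₚ.≤-trans (I.+≤+ z≤n) 3tt≤Ξ)

    ξ≥ : 3 * (t * t) ≤ ξ t x y
    ξ≥ = ℤₚ.drop‿+≤+ (subst (pos (3 * (t * t)) I.≤_) (sym +ξ) 3tt≤Ξ)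

    ξ≤ : ξ t x y ≤ 14 * (t * t)
    ξ≤ = ℤₚ.drop‿+≤+ (subst (I._≤ pos (14 * (t * t))) (sym +ξ)
      (subst (Ξ t x y I.≤_) (trans (cong (pos 14 I.*_) tt) (sym (ℤₚ.pos-* 14 (t * t))))
        (ℤₚ.0≤i-j⇒j≤i (proj₂ (Ξ-bounds t x y x≤t y≤t)))))

    κ≤ : κ t x y * t ≤ x + y
    κ≤ with cmp (x + y) t
    ... | inj₁ _ = z≤n
    ... | inj₂ p = ≤-trans (≤-reflexive (*-identityˡ t)) p

  -- This is `Φ-nonneg` with the subtracted terms carried to the other side, so that the averaging
  -- can take place in ℕ.
  pointwise : ∀ t x y z → x ≤ t → y ≤ t → z ≤ t →
    4 * (t * t * t) * (κ t x y + κ t x z + κ t y z) + t * (ξ t x y + ξ t x z + ξ t y z) ≤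
    24 * (t * t * t) * ι t x y z + 3 * (ξ t x y * z + ξ t x z * y + ξ t y z * x)
  pointwise t x y z X Y Z = ℤₚ.drop‿+≤+ (ℤₚ.0≤i-j⇒j≤i (subst (0ℤ I.≤_) eq (Φ-nonneg t x y z X Y Z)))
    where
    open ≡-Reasoning
    p = ξ t x y
    q = ξ t x z
    r = ξ t y z
    K = κ t x y + κ t x z + κ t y z
    form : ℤ → ℤ → ℤ → ℤ
    form p q r = pos 24 I.* t³ t I.* pos (ι t x y z) I.+
      ((p I.* (pos 3 I.* pos z I.- pos t) I.- pos 4 I.* t³ t I.* pos (κ t x y)) I.+
       (q I.* (pos 3 I.* pos y I.- pos t) I.- pos 4 I.* t³ t I.* pos (κ t x z)) I.+
       (r I.* (pos 3 I.* pos x I.- pos t) I.- pos 4 I.* t³ t I.* pos (κ t y z)))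
    lem : ∀ T t x y z p q r i j k l → pos 24 I.* T I.* i I.+
      ((p I.* (pos 3 I.* z I.- t) I.- pos 4 I.* T I.* j) I.+
       (q I.* (pos 3 I.* y I.- t) I.- pos 4 I.* T I.* k) I.+
       (r I.* (pos 3 I.* x I.- t) I.- pos 4 I.* T I.* l)) ≡
      (pos 24 I.* T I.* i I.+ pos 3 I.* (p I.* z I.+ q I.* y I.+ r I.* x)) I.-
      (pos 4 I.* T I.* (j I.+ k I.+ l) I.+ t I.* (p I.+ q I.+ r))
    lem = ℤ-Ring.solve-∀
    T≡ : t³ t ≡ pos (t * t * t)
    T≡ = sym (trans (ℤₚ.pos-* (t * t) t) (cong (I._* pos t) (ℤₚ.pos-* t t)))
    cT : ∀ c n → pos c I.* t³ t I.* pos n ≡ pos (c * (t * t * t) * n)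
    cT c n = sym (trans (ℤₚ.pos-* (c * (t * t * t)) n) (cong (I._* pos n) (trans (ℤₚ.pos-* c (t * t * t)) (cong (pos
        c I.*_) (sym T≡)))))
    eq : Φ t x y z ≡ pos (24 * (t * t * t) * ι t x y z + 3 * (p * z + q * y + r * x)) I.- pos (4 * (t * t * t) * K
        + t * (p + q + r))
    eq = begin
      Φ t x y z                           ≡⟨ cong₂ (λ a b → form a (proj₁ b) (proj₂ b)) (sym (+ξ t x y X Y)) (cong₂
          _,_ (sym (+ξ t x z X Z)) (sym (+ξ t y z Y Z))) ⟩
      form (pos p) (pos q) (pos r)        ≡⟨ lem (t³ t) (pos t) (pos x) (pos y) (pos z) (pos p) (pos q) (pos r) (pos
          (ι t x y z)) (pos (κ t x y)) (pos (κ t x z)) (pos (κ t y z)) ⟩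
      (pos 24 I.* t³ t I.* pos (ι t x y z) I.+ pos 3 I.* (pos p I.* pos z I.+ pos q I.* pos y I.+ pos r I.* pos x)) I.-
        (pos 4 I.* t³ t I.* pos K I.+ pos t I.* pos (p + q + r))
        ≡⟨ cong₂ I._-_ (cong₂ I._+_ (cT 24 (ι t x y z))
             (trans (cong (pos 3 I.*_) (cong₂ I._+_ (cong₂ I._+_ (sym (ℤₚ.pos-* p z)) (sym (ℤₚ.pos-* q y))) (sym (ℤₚ.pos-* r x))))
                    (sym (ℤₚ.pos-* 3 (p * z + q * y + r * x)))))
           (cong₂ I._+_ (cT 4 K) (sym (ℤₚ.pos-* t (p + q + r)))) ⟩
      pos (24 * (t * t * t) * ι t x y z + 3 * (p * z + q * y + r * x)) I.- pos (4 * (t * t * t) * K + t * (p + q + r)) ∎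

-- Averages over three independent uniform blocks.

module Densities where

  open Sums
  open Pointwise using (ι; κ)
  open Cubes
  open import Data.Nat
  open import Data.Nat.Properties
  open import Data.Nat.Tactic.RingSolver using (solve-∀)
  open import Relation.Binary.PropositionalEquality

  cube-mono : ∀ n {f g} → (∀ x y z → f x y z ≤ g x y z) → cube n f ≤ cube n g
  cube-mono n h = sum-mono n λ x _ → sum-mono n λ y _ → sum-mono n λ z _ → h x y z

  cube-+ : ∀ n f g → cube n (λ x y z → f x y z + g x y z) ≡ cube n f + cube n g
  cube-+ n f g = trans (sum-cong n λ x _ → trans (sum-cong n λ y _ → sum-+ n _ _) (sum-+ n _ _)) (sum-+ n _ _)

  cube-*ˡ : ∀ n c f → cube n (λ x y z → c * f x y z) ≡ c * cube n f
  cube-*ˡ n c f = trans (sum-cong n λ x _ → trans (sum-cong n λ y _ → sum-*ˡ n c _) (sum-*ˡ n c _)) (sum-*ˡ n c _)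

  sq-*ˡ : ∀ n c f → sq n (λ x y → c * f x y) ≡ c * sq n f
  sq-*ˡ n c f = trans (sum-cong n λ x _ → sum-*ˡ n c _) (sum-*ˡ n c _)

  cube-xyw : ∀ n u w → cube n (λ x y z → w z * u x y) ≡ sum n w * sq n u
  cube-xyw n u w = trans (sum-cong n λ x _ → sum-cong n λ y _ →
      trans (sum-cong n λ z _ → *-comm (w z) (u x y)) (trans (sum-*ˡ n (u x y) w) (*-comm (u x y) _)))
    (sq-*ˡ n (sum n w) u)

  cube-xwz : ∀ n u w → cube n (λ x y z → w y * u x z) ≡ sum n w * sq n u
  cube-xwz n u w = trans (sum-cong n λ x _ → sum-swap n n λ y z → w y * u x z) (cube-xyw n u w)

  cube-wyz : ∀ n u w → cube n (λ x y z → w x * u y z) ≡ sum n w * sq n u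
  cube-wyz n u w = trans (sum-swap n n λ x y → sum n λ z → w x * u y z) (cube-xwz n u w)

  -- Independence enters here: a function of two coordinates times a function of the third sums to a
  -- product.
  cube-cyc : ∀ n u w → cube n (λ x y z → w z * u x y + w y * u x z + w x * u y z) ≡ 3 * (sum n w * sq n u)
  cube-cyc n u w = begin
    cube n (λ x y z → w z * u x y + w y * u x z + w x * u y z)
      ≡⟨ trans (cube-+ n _ _) (cong (_+ cube n (λ x y z → w x * u y z)) (cube-+ n _ _)) ⟩
    cube n (λ x y z → w z * u x y) + cube n (λ x y z → w y * u x z) + cube n (λ x y z → w x * u y z)
      ≡⟨ cong₂ _+_ (cong₂ _+_ (cube-xyw n u w) (cube-xwz n u w)) (cube-wyz n u w) ⟩
    S + S + S
      ≡⟨ lem S ⟩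
    3 * S ∎
    where
    open ≡-Reasoning
    S = sum n w * sq n u
    lem : ∀ S → S + S + S ≡ 3 * S
    lem = solve-∀

  module Weights (c t′ : ℕ) (x : ℕ → ℕ) (x≤t : ∀ α → x α ≤ suc t′) where

    t = suc t′

    ξ′ κ′ : ℕ → ℕ → ℕ
    ξ′ α β = ξ t (x α) (x β)
    κ′ α β = κ t (x α) (x β)

    ι′ : ℕ → ℕ → ℕ → ℕ
    ι′ α β γ = ι t (x α) (x β) (x γ)

    X Y Q I : ℕ
    X = sum c x
    Y = sq c ξ′
    Q = sq c κ′
    I = cube c ι′

    -- If 3X = ct, the two terms with `Y` cancel and cQ ≤ 2I remains, which is the probability
    -- inequality. `heavy` and `light` treat means slightly above and below t/3.
    averaged : 12 * (t * t * t) * (c * Q) + 3 * (c * (t * Y)) ≤ 24 * (t * t * t) * I + 9 * (X * Y)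
    averaged = begin
      12 * T * (c * Q) + 3 * (c * (t * Y))
        ≡⟨ lem₁ T c Q t Y ⟩
      4 * T * (3 * (c * 1 * Q)) + t * (3 * (c * 1 * Y))
        ≡⟨ cong₂ (λ a b → 4 * T * (3 * (a * Q)) + t * (3 * (b * Y))) (sym (sum-const c 1)) (sym (sum-const c 1)) ⟩
      4 * T * (3 * (sum c (λ _ → 1) * Q)) + t * (3 * (sum c (λ _ → 1) * Y))
        ≡⟨ cong₂ (λ a b → 4 * T * a + t * b) (sym (cube-cyc c κ′ (λ _ → 1))) (sym (cube-cyc c ξ′ (λ _ → 1))) ⟩
      4 * T * cube c Kᶜ + t * cube c Ξᶜ
        ≡⟨ cong₂ _+_ (sym (cube-*ˡ c (4 * T) _)) (sym (cube-*ˡ c t _)) ⟩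
      cube c (λ α β γ → 4 * T * Kᶜ α β γ) + cube c (λ α β γ → t * Ξᶜ α β γ)
        ≡⟨ cube-+ c _ _ ⟨
      cube c (λ α β γ → 4 * T * Kᶜ α β γ + t * Ξᶜ α β γ)
        ≤⟨ cube-mono c step ⟩
      cube c (λ α β γ → 24 * T * ι′ α β γ + 3 * Xᶜ α β γ)
        ≡⟨ cube-+ c _ _ ⟩
      cube c (λ α β γ → 24 * T * ι′ α β γ) + cube c (λ α β γ → 3 * Xᶜ α β γ)
        ≡⟨ cong₂ _+_ (cube-*ˡ c (24 * T) _) (cube-*ˡ c 3 _) ⟩
      24 * T * I + 3 * cube c Xᶜ
        ≡⟨ cong (λ a → 24 * T * I + 3 * a) (cube-cyc c ξ′ x) ⟩
      24 * T * I + 3 * (3 * (X * Y))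
        ≡⟨ cong (24 * T * I +_) (sym (*-assoc 3 3 (X * Y))) ⟩
      24 * T * I + 9 * (X * Y) ∎
      where
      open ≤-Reasoning
      T = t * t * t
      Kᶜ Ξᶜ Xᶜ : ℕ → ℕ → ℕ → ℕ
      Kᶜ α β γ = 1 * κ′ α β + 1 * κ′ α γ + 1 * κ′ β γ
      Ξᶜ α β γ = 1 * ξ′ α β + 1 * ξ′ α γ + 1 * ξ′ β γ
      Xᶜ α β γ = x γ * ξ′ α β + x β * ξ′ α γ + x α * ξ′ β γ
      lem₁ : ∀ T c Q t Y → 12 * T * (c * Q) + 3 * (c * (t * Y)) ≡ 4 * T * (3 * (c * 1 * Q)) + t * (3 * (c * 1 * Y))
      lem₁ = solve-∀
      ones : ∀ a b d → 1 * a + 1 * b + 1 * d ≡ a + b + d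
      ones = solve-∀
      flip : ∀ a b d p q r → p * a + q * b + r * d ≡ a * p + b * q + d * r
      flip = solve-∀
      step : ∀ α β γ → 4 * T * Kᶜ α β γ + t * Ξᶜ α β γ ≤ 24 * T * ι′ α β γ + 3 * Xᶜ α β γ
      step α β γ = begin
        4 * T * Kᶜ α β γ + t * Ξᶜ α β γ
          ≡⟨ cong₂ (λ a b → 4 * T * a + t * b) (ones (κ′ α β) (κ′ α γ) (κ′ β γ)) (ones (ξ′ α β) (ξ′ α γ) (ξ′ β γ)) ⟩
        4 * T * (κ′ α β + κ′ α γ + κ′ β γ) + t * (ξ′ α β + ξ′ α γ + ξ′ β γ)
          ≤⟨ pointwise t (x α) (x β) (x γ) (x≤t α) (x≤t β) (x≤t γ) ⟩
        24 * T * ι′ α β γ + 3 * (ξ′ α β * x γ + ξ′ α γ * x β + ξ′ β γ * x α)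
          ≡⟨ cong (λ a → 24 * T * ι′ α β γ + 3 * a) (sym (flip (ξ′ α β) (ξ′ α γ) (ξ′ β γ) (x γ) (x β) (x α))) ⟩
        24 * T * ι′ α β γ + 3 * Xᶜ α β γ ∎

    Y≤ : Y ≤ c * (c * (14 * (t * t)))
    Y≤ = sum-≤const c _ λ α _ → sum-≤const c _ λ β _ → ξ≤ t (x α) (x β) (x≤t α) (x≤t β)

    Y≥ : c * (c * (3 * (t * t))) ≤ Y
    Y≥ = begin
      c * (c * (3 * (t * t)))       ≡⟨ trans (sum-cong c λ _ _ → sum-const c _) (sum-const c _) ⟨
      sq c (λ _ _ → 3 * (t * t))    ≤⟨ sum-mono c (λ α _ → sum-mono c λ β _ → ξ≥ t (x α) (x β) (x≤t α) (x≤t β)) ⟩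
      Y                             ∎
      where open ≤-Reasoning

    -- A relative excess k/a of the mean leaves 3kct·Y uncancelled. The bound `ξ≤` makes this at
    -- most 42k·c³t³, and division by 6t³ leaves the 7.
    heavy : ∀ a k → 3 * a * X ≤ (a + k) * (c * t) → 2 * a * (c * Q) ≤ 4 * a * I + 7 * k * (c * c * c)
    heavy a k h = *-cancelˡ-≤ (6 * (t * t * t)) (+-cancelʳ-≤ (3 * a * (c * (t * Y))) _ _ (begin
      6 * T * (2 * a * (c * Q)) + 3 * a * (c * (t * Y))       ≡⟨ e₁ T a c Q t Y ⟩
      a * (12 * T * (c * Q) + 3 * (c * (t * Y)))              ≤⟨ *-monoʳ-≤ a averaged ⟩
      a * (24 * T * I + 9 * (X * Y))                          ≡⟨ e₂ T a I X Y ⟩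
      24 * a * T * I + 3 * (3 * a * X) * Y                    ≤⟨ +-monoʳ-≤ (24 * a * T * I) (*-monoˡ-≤ Y (*-monoʳ-≤ 3 h)) ⟩
      24 * a * T * I + 3 * ((a + k) * (c * t)) * Y            ≡⟨ e₃ T a I k c t Y ⟩
      24 * a * T * I + 3 * k * c * t * Y + 3 * a * (c * (t * Y)) ≤⟨ +-monoˡ-≤ (3 * a * (c * (t * Y))) (+-monoʳ-≤ (24
          * a * T * I) (*-monoʳ-≤ (3 * k * c * t) Y≤)) ⟩
      24 * a * T * I + 3 * k * c * t * (c * (c * (14 * (t * t))))
          + 3 * a * (c * (t * Y)) ≡⟨ cong (_+ 3 * a * (c * (t * Y))) (e₄ a I k c t) ⟩
      6 * T * (4 * a * I + 7 * k * (c * c * c)) + 3 * a * (c * (t * Y)) ∎))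
      where
      open ≤-Reasoning
      T = t * t * t
      e₁ : ∀ T a c Q t Y → 6 * T * (2 * a * (c * Q)) + 3 * a * (c * (t * Y)) ≡ a * (12 * T * (c * Q) + 3 * (c * (t * Y)))
      e₁ = solve-∀
      e₂ : ∀ T a I X Y → a * (24 * T * I + 9 * (X * Y)) ≡ 24 * a * T * I + 3 * (3 * a * X) * Y
      e₂ = solve-∀
      e₃ : ∀ T a I k c t Y → 24 * a * T * I + 3 * ((a + k) * (c * t)) * Y ≡ 24 * a * T * I + 3 * k * c * t * Y
          + 3 * a * (c * (t * Y))
      e₃ = solve-∀
      e₄ : ∀ a I k c t → 24 * a * (t * t * t) * I + 3 * k * c * t * (c * (c * (14 * (t * t))))
          ≡ 6 * (t * t * t) * (4 * a * I + 7 * k * (c * c * c))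
      e₄ = solve-∀

    -- The deficit ct leaves 3ct·Y on the favourable side, and `ξ≥` turns it into a gain of 9c³t³.
    light : ∀ a → 3 * a * X + c * t ≤ a * (c * t) → 4 * a * (c * Q) + 3 * (c * c * c) ≤ 8 * a * I
    light a h = *-cancelˡ-≤ (3 * (t * t * t)) (+-cancelʳ-≤ (3 * a * (c * (t * Y))) _ _ (begin
      3 * T * (4 * a * (c * Q) + 3 * (c * c * c)) + 3 * a * (c * (t * Y))       ≡⟨ e₁ a c Q t Y ⟩
      a * (12 * T * (c * Q) + 3 * (c * (t * Y))) + 3 * c * t * (c * (c * (3 * (t * t)))) ≤⟨ +-mono-≤ (*-monoʳ-≤ a
          averaged) (*-monoʳ-≤ (3 * c * t) Y≥) ⟩
      a * (24 * T * I + 9 * (X * Y)) + 3 * c * t * Y              ≡⟨ e₂ T a I X Y c t ⟩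
      24 * a * T * I + 3 * (3 * a * X + c * t) * Y                ≤⟨ +-monoʳ-≤ (24 * a * T * I) (*-monoˡ-≤ Y (*-monoʳ-≤ 3 h)) ⟩
      24 * a * T * I + 3 * (a * (c * t)) * Y                      ≡⟨ e₃ T a I c t Y ⟩
      3 * T * (8 * a * I) + 3 * a * (c * (t * Y)) ∎))
      where
      open ≤-Reasoning
      T = t * t * t
      e₁ : ∀ a c Q t Y → 3 * (t * t * t) * (4 * a * (c * Q) + 3 * (c * c * c)) + 3 * a * (c * (t * Y)) ≡
        a * (12 * (t * t * t) * (c * Q) + 3 * (c * (t * Y))) + 3 * c * t * (c * (c * (3 * (t * t))))
      e₁ = solve-∀
      e₂ : ∀ T a I X Y c t → a * (24 * T * I + 9 * (X * Y)) + 3 * c * t * Y ≡ 24 * a * T * I + 3 * (3 * a * X + c * t) * Y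
      e₂ = solve-∀
      e₃ : ∀ T a I c t Y → 24 * a * T * I + 3 * (a * (c * t)) * Y ≡ 3 * T * (8 * a * I) + 3 * a * (c * (t * Y))
      e₃ = solve-∀

    -- Markov's inequality for the sum of two independent weights.
    markov : Q * t ≤ 2 * (c * X)
    markov = begin
      Q * t                               ≡⟨ *-comm Q t ⟩
      t * Q                               ≡⟨ sq-*ˡ c t κ′ ⟨
      sq c (λ α β → t * κ′ α β)           ≤⟨ sum-mono c (λ α _ → sum-mono c λ β _ →
                                               ≤-trans (≤-reflexive (*-comm t (κ′ α β))) (κ≤ t (x α) (x β) (x≤t α) (x≤t β))) ⟩
      sq c (λ α β → x α + x β)            ≡⟨ trans (sum-cong c λ α _
          → trans (sum-+ c _ _) (cong (_+ X) (sum-const c (x α)))) (sum-+ c _ _) ⟩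
      sum c (λ α → c * x α) + sum c (λ _ → X) ≡⟨ cong₂ _+_ (sum-*ˡ c c x) (sum-const c X) ⟩
      c * X + c * X                       ≡⟨ cong (c * X +_) (sym (+-identityʳ (c * X))) ⟩
      2 * (c * X)                         ∎
      where open ≤-Reasoning

-- Downward closed families and their coarsening to blocks.

module Families where

  open Sums
  open import Data.Bool using (Bool; true; false; not; T)
  open import Data.Nat
  open import Data.Nat.Properties
  open import Relation.Binary.PropositionalEquality

  Fam : Set
  Fam = ℕ → ℕ → ℕ → Bool

  Down : Fam → Set
  Down F = ∀ {x y z x′ y′ z′} → x < y → y < z → x′ ≤ x → y′ ≤ y → z′ ≤ z → x′ < y′ → y′ < z′ →
    T (F x y z) → T (F x′ y′ z′)

  -- Here z may lie beyond M: only its being above some vertex of [0 , M) matters.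
  Dom : ℕ → Fam → ℕ → ℕ → ℕ → Set
  Dom M F x y z = ∀ {x′ y′ z′} → x′ ≤ x → y′ ≤ y → z′ ≤ z → x′ < y′ → y′ < z′ → z′ < M → T (F x′ y′ z′)

  cnt : ℕ → Fam → ℕ
  cnt n F = tri₃ n λ x y z → 𝟙 (F x y z)

  miss : ℕ → Fam → ℕ
  miss n F = tri₃ n λ x y z → 𝟙 (not (F x y z))

  deg : ℕ → Fam → ℕ
  deg M F = tri₂ (M ∸ 1) λ x y → 𝟙 (F x y (M ∸ 1))

  sum-blocks-≥ : ∀ n b {f g} → (∀ α j → α < n → j < b → g α ≤ f (α * b + j)) → b * sum n g ≤ sum (n * b) f
  sum-blocks-≥ n b {f} {g} h = begin
    b * sum n g                              ≡⟨ sum-*ˡ n b g ⟨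
    sum n (λ α → b * g α)                    ≤⟨ sum-mono n (λ α α<n
        → ≤-trans (≤-reflexive (sym (sum-const b (g α)))) (sum-mono b λ j → h α j α<n)) ⟩
    sum n (λ α → sum b λ j → f (α * b + j))  ≡⟨ sum-blocks n b f ⟨
    sum (n * b) f                            ∎
    where open ≤-Reasoning

  sum-blocks-≤ : ∀ n b {f g} → (∀ α j → α < n → j < b → f (α * b + j) ≤ g α) → sum (n * b) f ≤ b * sum n g
  sum-blocks-≤ n b {f} {g} h = begin
    sum (n * b) f                            ≡⟨ sum-blocks n b f ⟩
    sum n (λ α → sum b λ j → f (α * b + j))  ≤⟨ sum-mono n (λ α α<n → sum-≤const b (g α) λ j → h α j α<n) ⟩
    sum n (λ α → b * g α)                    ≡⟨ sum-*ˡ n b g ⟩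
    b * sum n g                              ∎
    where open ≤-Reasoning

  tri₂-blocks-≥ : ∀ n b {f g} → (∀ α β i j → α < β → β < n → i < b → j < b → g α β ≤ f (α * b + i) (β * b + j)) →
    b * (b * tri₂ n g) ≤ tri₂ (n * b) f
  tri₂-blocks-≥ n b {f} {g} h = ≤-trans (≤-reflexive (cong (b *_) (sym (sum-*ˡ n b _))))
    (sum-blocks-≥ n b λ β j β<n j<b → ≤-trans
      (sum-blocks-≥ β b λ α i α<β i<b → h α β i j α<β β<n i<b j<b)
      (sum-range-mono (λ x → f x (β * b + j)) (m≤m+n (β * b) j)))

  tri₃-blocks-≥ : ∀ n b {f g} →
    (∀ α β γ i j k → α < β → β < γ → γ < n → i < b → j < b → k < b → g α β γ ≤ f (α * b + i) (β * b + j) (γ * b + k)) →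
    b * (b * (b * tri₃ n g)) ≤ tri₃ (n * b) f
  tri₃-blocks-≥ n b {f} {g} h = ≤-trans (≤-reflexive (cong (b *_) (trans (cong (b *_) (sym (sum-*ˡ n b _))) (sym
      (sum-*ˡ n b _)))))
    (sum-blocks-≥ n b λ γ k γ<n k<b → ≤-trans
      (tri₂-blocks-≥ γ b λ α β i j α<β β<γ i<b j<b → h α β γ i j k α<β β<γ γ<n i<b j<b k<b)
      (sum-range-mono (λ y → sum y λ x → f x y (γ * b + k)) (m≤m+n (γ * b) k)))

  tri₂-blocks-≤ : ∀ n b {f g} → (∀ x y → f x y ≤ 1) →
    (∀ α β i j → α < β → β < n → i < b → j < b → f (α * b + i) (β * b + j) ≤ g α β) →
    tri₂ (n * b) f ≤ b * (b * tri₂ n g + n * b)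
  tri₂-blocks-≤ n b {f} {g} f≤1 h = ≤-trans
    (sum-blocks-≤ n b λ β j β<n j<b → begin
      sum (β * b + j) (λ x → f x (β * b + j))
        ≡⟨ sum-split (β * b) j _ ⟩
      sum (β * b) (λ x → f x (β * b + j)) + sum j (λ i → f (β * b + i) (β * b + j))
        ≤⟨ +-mono-≤ (sum-blocks-≤ β b λ α i α<β i<b → h α β i j α<β β<n i<b j<b)
                    (≤-trans (sum-≤const j 1 λ i _ → f≤1 _ _) (≤-trans (≤-reflexive (*-identityʳ j)) (<⇒≤ j<b))) ⟩
      b * sum β (λ α → g α β) + b ∎)
    (≤-reflexive (cong (b *_) (trans (sum-+ n _ _) (cong₂ _+_ (sum-*ˡ n b _) (sum-const n b)))))
    where open ≤-Reasoning

  T-mono : ∀ {b c} → (T b → T c) → 𝟙 (not c) ≤ 𝟙 (not b)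
  T-mono {false} {true}  _ = z≤n
  T-mono {false} {false} _ = ≤-refl
  T-mono {true}  {true}  _ = ≤-refl
  T-mono {true}  {false} h with () ← h _

  module Blocks (F : Fam) (down : Down F) (M c b : ℕ) (0<b : 0 < b) (fits : suc c * b < M) (M≤ : M ≤ suc c * b + suc c) where

    -- The test is at the first vertices of the next blocks. If it succeeds, downward closure gives
    -- every increasing triple whose vertices lie below the ends of the blocks `α`, `β`, `γ`; if it
    -- fails, all triples of the three next blocks are missing. Both directions thus lose only one
    -- block.
    inT : ℕ → ℕ → ℕ → Bool
    inT α β γ = F (suc α * b) (suc β * b) (suc γ * b)

    inP : ℕ → ℕ → Bool
    inP α β = F (suc α * b) (suc β * b) (M ∸ 1)

    in-block-< : ∀ {α β i j} → α < β → i < b → α * b + i < β * b + j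
    in-block-< {α} {β} {i} {j} α<β i<b = begin-strict
      α * b + i <⟨ +-monoʳ-< (α * b) i<b ⟩
      α * b + b ≡⟨ +-comm (α * b) b ⟩
      suc α * b ≤⟨ *-monoˡ-≤ b α<β ⟩
      β * b     ≤⟨ m≤m+n (β * b) j ⟩
      β * b + j ∎
      where open ≤-Reasoning

    missing : b * (b * (b * tri₃ c λ α β γ → 𝟙 (not (inT α β γ)))) ≤ miss M F
    missing = begin
      b * (b * (b * tri₃ c λ α β γ → 𝟙 (not (inT α β γ))))
        ≤⟨ *-monoʳ-≤ b (*-monoʳ-≤ b (*-monoʳ-≤ b (≤-trans (m≤n+m _ _) (≤-reflexive (sym (tri₃-suc c λ α β γ
            → 𝟙 (not (F (α * b) (β * b) (γ * b))))))))) ⟩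
      b * (b * (b * tri₃ (suc c) λ α β γ → 𝟙 (not (F (α * b) (β * b) (γ * b)))))
        ≤⟨ tri₃-blocks-≥ (suc c) b (λ α β γ i j k α<β β<γ γ<c i<b j<b k<b → T-mono
             (down (in-block-< α<β i<b) (in-block-< β<γ j<b) (m≤m+n (α * b) i) (m≤m+n (β * b) j) (m≤m+n (γ * b) k)
               (*-monoˡ-< b ⦃ >-nonZero 0<b ⦄ α<β) (*-monoˡ-< b ⦃ >-nonZero 0<b ⦄ β<γ))) ⟩
      tri₃ (suc c * b) (λ x y z → 𝟙 (not (F x y z)))
        ≤⟨ sum-range-mono _ (<⇒≤ fits) ⟩
      miss M F ∎
      where open ≤-Reasoning

    P : ℕ
    P = tri₂ c λ α β → 𝟙 (inP α β)

    -- A completed pair in two different blocks forces the corner pair to be completed. The corner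
    -- pairs with block 0 (at most `c`), the pairs inside one block and those whose larger vertex
    -- lies beyond all blocks are bounded trivially.
    degree : deg M F ≤ b * (b * (c + P) + suc c * b) + suc c * M
    degree = begin
      deg M F
        ≤⟨ sum-range-mono _ M-1≤ ⟩
      tri₂ (suc c * b + s) G
        ≡⟨ sum-split (suc c * b) s _ ⟩
      tri₂ (suc c * b) G + sum s (λ i → sum (suc c * b + i) λ x → G x (suc c * b + i))
        ≤⟨ +-mono-≤ (tri₂-blocks-≤ (suc c) b (λ x y → 𝟙≤1 (F x y (M ∸ 1))) λ α β i j α<β β<c i<b j<b
            → G-block α β i j α<β β<c i<b j<b)
                    (≤-trans (sum-≤const s M λ i i<s → ≤-trans (sum-≤const (suc c * b + i) 1 λ x _
                        → 𝟙≤1 (F x (suc c * b + i) (M ∸ 1))) (≤-trans (≤-reflexive (*-identityʳ _)) (tail i i<s)))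
                             (*-monoˡ-≤ M s≤)) ⟩
      b * (b * tri₂ (suc c) G′ + suc c * b) + suc c * M
        ≤⟨ +-monoˡ-≤ (suc c * M) (*-monoʳ-≤ b (+-monoˡ-≤ (suc c * b) (*-monoʳ-≤ b G′≤))) ⟩
      b * (b * (c + P) + suc c * b) + suc c * M ∎
      where
      open ≤-Reasoning
      s = M ∸ 1 ∸ suc c * b
      G G′ : ℕ → ℕ → ℕ
      G x y = 𝟙 (F x y (M ∸ 1))
      G′ α β = 𝟙 (F (α * b) (β * b) (M ∸ 1))
      sc≤ : suc c * b ≤ M ∸ 1
      sc≤ = <⇒≤pred fits
      M-1≤ : M ∸ 1 ≤ suc c * b + s
      M-1≤ = ≤-reflexive (sym (m+[n∸m]≡n sc≤))
      s≤ : s ≤ suc c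
      s≤ = m≤n+o⇒m∸n≤o (M ∸ 1) (suc c * b) (≤-trans (m∸n≤m M 1) M≤)
      tail : ∀ i → i < s → suc c * b + i ≤ M
      tail i i<s = ≤-trans (+-monoʳ-≤ (suc c * b) (<⇒≤ i<s)) (≤-trans (≤-reflexive (m+[n∸m]≡n sc≤)) (m∸n≤m M 1))
      G-block : ∀ α β i j → α < β → β < suc c → i < b → j < b → G (α * b + i) (β * b + j) ≤ G′ α β
      G-block α β i j α<β β<c i<b j<b = 𝟙-mono (down (in-block-< α<β i<b) lt (m≤m+n (α * b) i) (m≤m+n (β * b) j) ≤-refl
          (*-monoˡ-< b ⦃ >-nonZero 0<b ⦄ α<β) (≤-<-trans (m≤m+n (β * b) j) lt))
        where
        lt : β * b + j < M ∸ 1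
        lt = <-≤-trans (in-block-< {β} {suc c} {j} {0} β<c j<b) (≤-trans (≤-reflexive (+-identityʳ (suc c * b))) sc≤)
      G′≤ : tri₂ (suc c) G′ ≤ c + P
      G′≤ = ≤-trans (≤-reflexive (tri₂-suc c G′)) (+-monoˡ-≤ P (≤-trans (sum-≤const c 1 λ β _
          → 𝟙≤1 (F 0 (suc β * b) (M ∸ 1))) (≤-reflexive (*-identityʳ c))))

-- Arithmetic of the block estimates.

module BlockInequalities where

  open import Data.Nat
  open import Data.Nat.Properties
  open import Data.Nat.Tactic.RingSolver using (solve-∀)
  open import Relation.Binary.PropositionalEquality

  -- Here `A ≤ B` is a combination of the hypotheses with multipliers from ℕ and `rest` is the
  -- surplus. Every nonlinear estimate becomes one identity for the ring solver.
  certify : ∀ {L R A B rest} → A ≤ B → R + A ≡ L + B + rest → L ≤ R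
  certify {L} {R} {A} {B} {rest} A≤B eq = +-cancelʳ-≤ B L R (begin
    L + B        ≤⟨ m≤m+n (L + B) rest ⟩
    L + B + rest ≡⟨ eq ⟨
    R + A        ≤⟨ +-monoʳ-≤ R A≤B ⟩
    R + B        ∎)
    where open ≤-Reasoning

  degree-bound : ∀ b c P M g → g ≤ b * (b * (c + P) + suc c * b) + suc c * M → M ≤ suc c * b + suc c
      → suc c * suc (suc c) ≤ b → g ≤ b * b * (P + 2 * c + 2)
  degree-bound b c P M g h0 h1 h2 = certify (+-mono-≤ (+-mono-≤ (*-monoʳ-≤ 1 h0) (*-monoʳ-≤ (suc c) h1)) (*-monoʳ-≤
      (b + suc c) h2)) (identity b c P M g)
    where
    identity : ∀ b c P M g → b * b * (P + 2 * c + 2) + (1 * g + suc c * M + (b + suc c) * (suc c * suc (suc c)))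
        ≡ g + (1 * (b * (b * (c + P) + suc c * b) + suc c * M) + suc c * (suc c * b + suc c) + (b + suc c) * b)
        + (1 + 3 * c + 3 * c * c + c * c * c)
    identity = solve-∀

  M-bound : ∀ b c M → M ≤ suc c * b + suc c → suc c * suc (suc c) ≤ b → M ≤ suc (suc c) * b
  M-bound b c M h0 h1 = certify (+-mono-≤ (*-monoʳ-≤ 1 h0) (*-monoʳ-≤ 1 h1)) (identity b c M)
    where
    identity : ∀ b c M → suc (suc c) * b + (1 * M + 1 * (suc c * suc (suc c))) ≡ M + (1 * (suc c * b + suc c)
        + 1 * b) + (1 + 2 * c + c * c)
    identity = solve-∀

  -- In the limit this is Mg ≤ 6·ms, so with M = 3m a completed pair costs m/2 triples. The
  -- parameter `q` is the precision: rounding to blocks and the excess `k` together cost at most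
  -- M³/(2q).
  heavy-missing : ∀ q a b c k P M g ms → 4 * a * (c * b * (b * (b * P))) ≤ 4 * a * (6 * ms
      + 3 * (c * c) * (b * (b * b))) + 7 * k * (c * c * c) * (b * (b * b)) → g ≤ b * b * (P + 2 * c + 2) → M
      ≤ suc (suc c) * b → c * b * (c * b) * (c * b) ≤ M * M * M → P ≤ c * c → 7 * q * k ≤ a → 44 * q ≤ c → 2 ≤ c
      → 2 * a * (2 * q * (M * g)) ≤ 2 * a * (12 * q * ms + M * M * M)
  heavy-missing q a b c k P M g ms h0 h1 h2 h3 h4 h5 h6 h7 = certify (+-mono-≤ (+-mono-≤ (+-mono-≤ (+-mono-≤
      (+-mono-≤ (+-mono-≤ (+-mono-≤ (*-monoʳ-≤ q h0) (*-monoʳ-≤ (4 * q * a * c * b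
      + 8 * q * a * b) h1)) (*-monoʳ-≤ (4 * q * a * g) h2)) (*-monoʳ-≤ (2 * a) h3)) (*-monoʳ-≤ (8 * q * a * (b * (b *
      b))) h4)) (*-monoʳ-≤ (c * c * c * (b * (b * b))) h5)) (*-monoʳ-≤ (a * c * c * (b * (b * b))) h6)) (*-monoʳ-≤
      ((16 * q * c + 8 * q) * (a * (b * (b * b)))) h7)) (identity q a b c k P M g ms)
    where
    identity : ∀ q a b c k P M g ms → 2 * a * (12 * q * ms + M * M * M) + (q * (4 * a * (c * b * (b * (b * P))))
        + (4 * q * a * c * b + 8 * q * a * b) * g + 4 * q * a * g * M + 2 * a * (c * b * (c * b) * (c * b))
        + 8 * q * a * (b * (b * b)) * P + c * c * c * (b * (b * b)) * (7 * q * k)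
        + a * c * c * (b * (b * b)) * (44 * q) + (16 * q * c + 8 * q) * (a * (b * (b * b))) * 2)
        ≡ 2 * a * (2 * q * (M * g)) + (q * (4 * a * (6 * ms + 3 * (c * c) * (b * (b * b)))
        + 7 * k * (c * c * c) * (b * (b * b))) + (4 * q * a * c * b + 8 * q * a * b) * (b * b * (P + 2 * c + 2))
        + 4 * q * a * g * (suc (suc c) * b) + 2 * a * (M * M * M) + 8 * q * a * (b * (b * b)) * (c * c)
        + c * c * c * (b * (b * b)) * a + a * c * c * (b * (b * b)) * c + (16 * q * c
        + 8 * q) * (a * (b * (b * b))) * c) + 0
    identity = solve-∀

  -- The pair bound P ≤ (D/a)c² with D/a close to 1/3 becomes g ≤ M²/3, up to a relative error 1/q.
  heavy-degree : ∀ q a b c k D P M g → g ≤ b * b * (P + 2 * c + 2) → a * P ≤ D * (c * c) → 3 * D ≤ a + k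
      → c * b * (c * b) ≤ M * M → 2 * q * k ≤ a → 33 * q ≤ c → 2 ≤ c → 2 * a * (3 * q * g) ≤ 2 * a * (suc q * (M * M))
  heavy-degree q a b c k D P M g h0 h1 h2 h3 h4 h5 h6 = certify (+-mono-≤ (+-mono-≤ (+-mono-≤ (+-mono-≤ (+-mono-≤
      (+-mono-≤ (*-monoʳ-≤ (6 * q * a) h0) (*-monoʳ-≤ (6 * q * (b * b)) h1)) (*-monoʳ-≤ (2 * q * (b * b) * (c * c))
      h2)) (*-monoʳ-≤ (2 * a * suc q) h3)) (*-monoʳ-≤ (b * b * c * c) h4)) (*-monoʳ-≤ (a * b * b * c) h5)) (*-monoʳ-≤
      (12 * q * a * b * b) h6)) (identity q a b c k D P M g)
    where
    identity : ∀ q a b c k D P M g → 2 * a * (suc q * (M * M)) + (6 * q * a * g + 6 * q * (b * b) * (a * P)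
        + 2 * q * (b * b) * (c * c) * (3 * D) + 2 * a * suc q * (c * b * (c * b)) + b * b * c * c * (2 * q * k)
        + a * b * b * c * (33 * q) + 12 * q * a * b * b * 2) ≡ 2 * a * (3 * q * g) + (6 * q * a * (b * b * (P
        + 2 * c + 2)) + 6 * q * (b * b) * (D * (c * c)) + 2 * q * (b * b) * (c * c) * (a + k)
        + 2 * a * suc q * (M * M) + b * b * c * c * a + a * b * b * c * c + 12 * q * a * b * b * c)
        + (12 * a * b * b * q + 9 * a * b * b * c * q)
    identity = solve-∀

  -- The gain 3c³ is cubic in `c`, whereas all rounding errors together are of order a·c². Hence a
  -- stuck family would force c ≤ 27a.
  light-blocks : ∀ a b c P M g ms → 8 * a * (c * b * (b * (b * P))) + 3 * (c * c * c) * (b * (b * b))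
      ≤ 8 * a * (6 * ms + 3 * (c * c) * (b * (b * b))) → 6 * ms ≤ M * g + 3 * (M * M) → g ≤ b * b * (P + 2 * c + 2)
      → M ≤ suc (suc c) * b → P ≤ c * c → suc c * suc (suc c) ≤ b → 4 ≤ c → 3 * (c * c * (b * (b * b))) * c
      ≤ 3 * (c * c * (b * (b * b))) * (27 * a)
  light-blocks a b c P M g ms h0 h1 h2 h3 h4 h5 h6 = certify (+-mono-≤ (+-mono-≤ (+-mono-≤ (+-mono-≤ (+-mono-≤
      (+-mono-≤ (*-monoʳ-≤ 1 h0) (*-monoʳ-≤ (8 * a) h1)) (*-monoʳ-≤ (8 * a * c * b
      + 16 * a * b) h2)) (*-monoʳ-≤ (8 * a * g + 24 * a * M + 24 * a * suc (suc c) * b) h3)) (*-monoʳ-≤ (16 * a * (b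
      * (b * b))) h4)) (*-monoʳ-≤ (48 * a * b * b) h5)) (*-monoʳ-≤ (12 * a * c * (b * (b * b))
      + 20 * a * (b * (b * b)) + 5 * a * c * (b * (b * b))) h6)) (identity a b c P M g ms)
    where
    identity : ∀ a b c P M g ms → 3 * (c * c * (b * (b * b))) * (27 * a) + (1 * (8 * a * (c * b * (b * (b * P)))
        + 3 * (c * c * c) * (b * (b * b))) + 8 * a * (6 * ms) + (8 * a * c * b + 16 * a * b) * g + (8 * a * g
        + 24 * a * M + 24 * a * suc (suc c) * b) * M + 16 * a * (b * (b * b)) * P
        + 48 * a * b * b * (suc c * suc (suc c)) + (12 * a * c * (b * (b * b)) + 20 * a * (b * (b * b))
        + 5 * a * c * (b * (b * b))) * 4) ≡ 3 * (c * c * (b * (b * b))) * c + (1 * (8 * a * (6 * ms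
        + 3 * (c * c) * (b * (b * b)))) + 8 * a * (M * g + 3 * (M * M)) + (8 * a * c * b
        + 16 * a * b) * (b * b * (P + 2 * c + 2)) + (8 * a * g + 24 * a * M
        + 24 * a * suc (suc c) * b) * (suc (suc c) * b) + 16 * a * (b * (b * b)) * (c * c) + 48 * a * b * b * b
        + (12 * a * c * (b * (b * b)) + 20 * a * (b * (b * b)) + 5 * a * c * (b * (b * b))) * c)
        + (48 * a * b * b * c + 24 * a * b * b * c * c + 8 * a * b * b * b * c * c)
    identity = solve-∀

-- Cheap edges on the level of blocks.

module Selection where

  open Sums
  open Pointwise using (κ; cmp; [_]; [_]ᶜ)
  open Cubes
  open Densities
  open Families
  open import Data.Bool using (Bool; true; false; not; T)
  open import Data.Bool.Properties using (T?)
  open import Data.Nat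
  open import Data.Nat.Properties
  open import Data.Nat.Tactic.RingSolver using (solve-∀)
  open import Data.Product using (_×_; _,_)
  open import Data.Sum using (_⊎_; inj₁; inj₂)
  open import Data.Empty using (⊥-elim)
  open import Relation.Nullary using (yes; no; ¬_)
  open import Relation.Nullary.Decidable using (_×-dec_)
  open import Relation.Binary.PropositionalEquality hiding ([_])

  -- With `a` near 3D, `cheap` bounds the three weights together by about three times the average
  -- weight. The index γ = c stands for a virtual block: the pair is completed by M ∸ 1, so the last
  -- vertex is unrestricted and costs nothing.
  record Choice (F : Fam) (M c b D a : ℕ) (r : ℕ → ℕ) : Set where
    field
      α β γ : ℕ
      α<β   : α < β
      β<γ   : β < γ
      γ≤c   : γ ≤ c
      valid : ∀ z → (γ < c → z ≤ γ * b + b) → Dom M F (α * b + b) (β * b + b) z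
      cheap : c * D * (r α + r β + r γ) ≤ a * sum c r

  -- Every weighting of the blocks (the virtual block c having weight 0) leaves an affordable choice.
  Selects : Fam → (M c b D a : ℕ) → Set
  Selects F M c b D a = ∀ r → r c ≡ 0 → Choice F M c b D a r

  module _ (F : Fam) (down : Down F) (M c b : ℕ) (0<b : 0 < b) (fits : suc c * b < M) (M≤ : M ≤ suc c * b + suc c) where
    open Blocks F down M c b 0<b fits M≤

    record Stuck (D a : ℕ) (r : ℕ → ℕ) : Set where
      field
        triples : ∀ {α β γ} → α < β → β < γ → γ < c → T (inT α β γ) → a * sum c r < c * D * (r α + r β + r γ)
        pairs   : ∀ {α β} → α < β → β < c → T (inP α β) → a * sum c r < c * D * (r α + r β)

    private
      +b : ∀ α {u} → u ≤ α * b + b → u ≤ suc α * b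
      +b α p = ≤-trans p (≤-reflexive (+-comm (α * b) b))

      block-b : ∀ {α β} → α < β → suc α * b < suc β * b
      block-b α<β = *-monoˡ-< b ⦃ >-nonZero 0<b ⦄ (s<s α<β)

      choose? : ∀ D a r → r c ≡ 0 → Choice F M c b D a r ⊎ Stuck D a r
      choose? D a r rc≡0 with anyUpTo? (λ γ → anyUpTo? (λ β → anyUpTo? (λ α → T? (inT α β γ) ×-dec (c * D * (r α
          + r β + r γ) ≤? a * sum c r)) β) γ) c
      ... | yes (γ , γ<c , β , β<γ , α , α<β , e , p) = inj₁ record
        { α = α ; β = β ; γ = γ ; α<β = α<β ; β<γ = β<γ ; γ≤c = <⇒≤ γ<c ; cheap = p
        ; valid = λ z z≤ x′≤ y′≤ z′≤ x′<y′ y′<z′ z′<M → down (block-b α<β) (block-b β<γ)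
            (+b α x′≤) (+b β y′≤) (≤-trans z′≤ (+b γ (z≤ γ<c))) x′<y′ y′<z′ e }
      ... | no ¬t with anyUpTo? (λ β → anyUpTo? (λ α → T? (inP α β) ×-dec (c * D * (r α + r β + r c) ≤? a * sum c r)) β) c
      ... | yes (β , β<c , α , α<β , e , p) = inj₁ record
        { α = α ; β = β ; γ = c ; α<β = α<β ; β<γ = β<c ; γ≤c = ≤-refl ; cheap = p
        ; valid = λ z z≤ x′≤ y′≤ z′≤ x′<y′ y′<z′ z′<M → down (block-b α<β) lt
            (+b α x′≤) (+b β y′≤) (<⇒≤pred z′<M) x′<y′ y′<z′ e }
        where
        lt : suc β * b < M ∸ 1
        lt = <-≤-trans (*-monoˡ-< b ⦃ >-nonZero 0<b ⦄ (s<s β<c)) (<⇒≤pred fits)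
      ... | no ¬p = inj₂ record
        { triples = λ {α} {β} {γ} α<β β<γ γ<c e → ≰⇒> λ le → ¬t (γ , γ<c , β , β<γ , α , α<β , e , le)
        ; pairs   = λ {α} {β} α<β β<c e → ≰⇒> λ le → ¬p (β , β<c , α , α<β , e ,
            ≤-trans (≤-reflexive (cong (c * D *_) (trans (cong (r α + r β +_) rc≡0) (+-identityʳ _)))) le) }

    module Fail (D a : ℕ) (r : ℕ → ℕ) (stuck : Stuck D a r) where
      open Stuck stuck

      private
        R = sum c r

        -- The pointwise inequality requires weights at most t. Cutting off at t leaves sums of two
        -- or three that reach t above it, and the successor in t = aR + 1 turns the strict
        -- inequalities of `Stuck` into sums of at least t.
        x : ℕ → ℕ
        x α = c * D * r α ⊓ suc (a * R)

      open Weights c (a * R) x (λ α → m⊓n≤n (c * D * r α) (suc (a * R)))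

      private
        ⊓-+ : ∀ {t} u v → t ≤ u + v → t ≤ u ⊓ t + v ⊓ t
        ⊓-+ {t} u v h with ≤-total u t | ≤-total v t
        ... | inj₂ p | _      = ≤-trans (≤-reflexive (sym (m≥n⇒m⊓n≡n p))) (m≤m+n _ _)
        ... | _      | inj₂ q = ≤-trans (≤-reflexive (sym (m≥n⇒m⊓n≡n q))) (m≤n+m _ _)
        ... | inj₁ p | inj₁ q = ≤-trans h (≤-reflexive (sym (cong₂ _+_ (m≤n⇒m⊓n≡m p) (m≤n⇒m⊓n≡m q))))

        ⊓-+₃ : ∀ {t} u v w → t ≤ u + v + w → t ≤ u ⊓ t + v ⊓ t + w ⊓ t
        ⊓-+₃ {t} u v w h with ≤-total (u + v) t | ≤-total w t
        ... | inj₂ p | _      = ≤-trans (⊓-+ u v p) (m≤m+n _ _)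
        ... | _      | inj₂ q = ≤-trans (≤-reflexive (sym (m≥n⇒m⊓n≡n q))) (m≤n+m _ _)
        ... | inj₁ p | inj₁ q = ≤-trans h (≤-reflexive (sym (cong₂ _+_ (cong₂ _+_ (m≤n⇒m⊓n≡m (≤-trans (m≤m+n u v) p))
                                                                             (m≤n⇒m⊓n≡m (≤-trans (m≤n+m v u) p))) (m≤n⇒m⊓n≡m q))))

        dist₃ : ∀ k p q s → k * (p + q + s) ≡ k * p + k * q + k * s
        dist₃ = solve-∀

        ι≤ : ∀ α β γ → α < β → β < γ → γ < c → ι′ α β γ ≤ 𝟙 (not (inT α β γ))
        ι≤ α β γ α<β β<γ γ<c with inT α β γ in eq
        ... | false = ι≤1
          where
          ι≤1 : ι′ α β γ ≤ 1
          ι≤1 with cmp (x α + x β + x γ) t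
          ... | inj₁ _ = ≤-refl
          ... | inj₂ _ = z≤n
        ... | true with cmp (x α + x β + x γ) t
        ... | inj₂ _ = z≤n
        ... | inj₁ lt = ⊥-elim (<⇒≱ lt (⊓-+₃ (c * D * r α) (c * D * r β) (c * D * r γ)
                (≤-trans (triples α<β β<γ γ<c (subst T (sym eq) _)) (≤-reflexive (dist₃ (c * D) (r α) (r β) (r γ))))))

        κ≥ : ∀ α β → α < β → β < c → 𝟙 (inP α β) ≤ κ′ α β
        κ≥ α β α<β β<c with inP α β in eq
        ... | false = z≤n
        ... | true with cmp (x α + x β) t
        ... | inj₂ _ = ≤-refl
        ... | inj₁ lt = ⊥-elim (<⇒≱ lt (⊓-+ (c * D * r α) (c * D * r β)
                (≤-trans (pairs α<β β<c (subst T (sym eq) _)) (≤-reflexive (*-distribˡ-+ (c * D) (r α) (r β))))))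

        κ-sym : ∀ u v → κ t u v ≡ κ t v u
        κ-sym u v = cong (λ s → [ cmp s t ]ᶜ) (+-comm u v)

        ι≤1 : ∀ s → [ cmp s t ] ≤ 1
        ι≤1 s with cmp s t
        ... | inj₁ _ = ≤-refl
        ... | inj₂ _ = z≤n

      ms : ℕ
      ms = tri₃ c λ α β γ → 𝟙 (not (inT α β γ))

      I≤ : I ≤ 6 * ms + 3 * (c * c)
      I≤ = ≤-trans (cube≤6tri₃ c ι′
          (λ α β γ → cong (λ s → [ cmp s t ]) (cong (_+ x γ) (+-comm (x α) (x β))))
          (λ α β γ → cong (λ s → [ cmp s t ]) (trans (+-assoc (x α) (x β) (x γ)) (trans (cong (x α +_) (+-comm (x β)
              (x γ))) (sym (+-assoc (x α) (x γ) (x β))))))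
          (λ α β γ → ι≤1 (x α + x β + x γ)))
        (+-monoˡ-≤ (3 * (c * c)) (*-monoʳ-≤ 6 (tri₃-mono c ι≤)))

      Q≥ : 2 * P ≤ Q
      Q≥ = ≤-trans (*-monoʳ-≤ 2 (tri₂-mono c κ≥)) (2tri₂≤sq c κ′ λ α β → κ-sym (x α) (x β))

      aX≤ : a * X ≤ D * (c * t)
      aX≤ = begin
        a * X                          ≤⟨ *-monoʳ-≤ a (sum-mono c λ α _ → m⊓n≤m (c * D * r α) (suc (a * R))) ⟩
        a * sum c (λ α → c * D * r α)  ≡⟨ cong (a *_) (sum-*ˡ c (c * D) r) ⟩
        a * (c * D * R)                ≡⟨ lem a c D R ⟩
        D * (c * (a * R))              ≤⟨ *-monoʳ-≤ D (*-monoʳ-≤ c (n≤1+n (a * R))) ⟩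
        D * (c * t)                    ∎
        where
        open ≤-Reasoning
        lem : ∀ a c D R → a * (c * D * R) ≡ D * (c * (a * R))
        lem = solve-∀

      heavy-fail : ∀ k → 3 * D ≤ a + k → 4 * a * (c * P) ≤ 4 * a * (6 * ms + 3 * (c * c)) + 7 * k * (c * c * c)
      heavy-fail k h = begin
        4 * a * (c * P)                       ≡⟨ lem a c P ⟩
        2 * a * (c * (2 * P))                 ≤⟨ *-monoʳ-≤ (2 * a) (*-monoʳ-≤ c Q≥) ⟩
        2 * a * (c * Q)                       ≤⟨ heavy a k (≤-trans (≤-reflexive (*-assoc 3 a X)) (≤-trans (*-monoʳ-≤ 3 aX≤)
                                                   (≤-trans (≤-reflexive (sym (*-assoc 3 D (c * t)))) (*-monoˡ-≤ (c * t) h)))) ⟩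
        4 * a * I + 7 * k * (c * c * c)       ≤⟨ +-monoˡ-≤ (7 * k * (c * c * c)) (*-monoʳ-≤ (4 * a) I≤) ⟩
        4 * a * (6 * ms + 3 * (c * c)) + 7 * k * (c * c * c) ∎
        where
        open ≤-Reasoning
        lem : ∀ a c P → 4 * a * (c * P) ≡ 2 * a * (c * (2 * P))
        lem = solve-∀

      light-fail : 3 * D + 1 ≤ a → 8 * a * (c * P) + 3 * (c * c * c) ≤ 8 * a * (6 * ms + 3 * (c * c))
      light-fail h = begin
        8 * a * (c * P) + 3 * (c * c * c)       ≡⟨ cong (_+ 3 * (c * c * c)) (lem a c P) ⟩
        4 * a * (c * (2 * P)) + 3 * (c * c * c) ≤⟨ +-monoˡ-≤ (3 * (c * c * c)) (*-monoʳ-≤ (4 * a) (*-monoʳ-≤ c Q≥)) ⟩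
        4 * a * (c * Q) + 3 * (c * c * c)       ≤⟨ light a (begin
            3 * a * X + c * t       ≤⟨ +-monoˡ-≤ (c * t) (≤-trans (≤-reflexive (*-assoc 3 a X)) (*-monoʳ-≤ 3 aX≤)) ⟩
            3 * (D * (c * t)) + c * t ≡⟨ lem₂ D (c * t) ⟩
            (3 * D + 1) * (c * t)   ≤⟨ *-monoˡ-≤ (c * t) h ⟩
            a * (c * t)             ∎) ⟩
        8 * a * I                               ≤⟨ *-monoʳ-≤ (8 * a) I≤ ⟩
        8 * a * (6 * ms + 3 * (c * c))          ∎
        where
        open ≤-Reasoning
        lem : ∀ a c P → 8 * a * (c * P) ≡ 4 * a * (c * (2 * P))
        lem = solve-∀
        lem₂ : ∀ D u → 3 * (D * u) + u ≡ (3 * D + 1) * u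
        lem₂ = solve-∀

      -- Markov's inequality: the pairs that can be completed have weight at least t, while the mean
      -- weight is at most (D/a)t.
      few-pairs : a * P ≤ D * (c * c)
      few-pairs = *-cancelˡ-≤ (2 * t) (begin
        2 * t * (a * P)     ≡⟨ lem₁ t a P ⟩
        a * (2 * P * t)     ≤⟨ *-monoʳ-≤ a (*-monoˡ-≤ t Q≥) ⟩
        a * (Q * t)         ≤⟨ *-monoʳ-≤ a markov ⟩
        a * (2 * (c * X))   ≡⟨ lem₂ a c X ⟩
        2 * c * (a * X)     ≤⟨ *-monoʳ-≤ (2 * c) aX≤ ⟩
        2 * c * (D * (c * t)) ≡⟨ lem₃ c D t ⟩
        2 * t * (D * (c * c)) ∎)
        where
        open ≤-Reasoning
        lem₁ : ∀ t a P → 2 * t * (a * P) ≡ a * (2 * P * t)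
        lem₁ = solve-∀
        lem₂ : ∀ a c X → a * (2 * (c * X)) ≡ 2 * c * (a * X)
        lem₂ = solve-∀
        lem₃ : ∀ c D t → 2 * c * (D * (c * t)) ≡ 2 * t * (D * (c * c))
        lem₃ = solve-∀

    module _ (D a : ℕ) where
      b³ = b * (b * b)

      private
        scaled : ∀ A k ms P W → A * (c * P) ≤ A * (6 * ms + 3 * (c * c)) + W → b * (b * (b * ms)) ≤ k →
          A * (c * b * (b * (b * P))) ≤ A * (6 * k + 3 * (c * c) * b³) + W * b³
        scaled A k ms P W h h′ = begin
          A * (c * b * (b * (b * P)))                    ≡⟨ e₁ A c b P ⟩
          A * (c * P) * b³                               ≤⟨ *-monoˡ-≤ b³ h ⟩
          (A * (6 * ms + 3 * (c * c)) + W) * b³          ≡⟨ e₂ A ms c b W ⟩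
          A * (6 * (b * (b * (b * ms))) + 3 * (c * c) * b³) + W * b³ ≤⟨ +-monoˡ-≤ (W * b³) (*-monoʳ-≤ A (+-monoˡ-≤ (3
              * (c * c) * b³) (*-monoʳ-≤ 6 h′))) ⟩
          A * (6 * k + 3 * (c * c) * b³) + W * b³ ∎
          where
          open ≤-Reasoning
          e₁ : ∀ A c b P → A * (c * b * (b * (b * P))) ≡ A * (c * P) * (b * (b * b))
          e₁ = solve-∀
          e₂ : ∀ A ms c b W → (A * (6 * ms + 3 * (c * c)) + W) * (b * (b * b)) ≡
            A * (6 * (b * (b * (b * ms))) + 3 * (c * c) * (b * (b * b))) + W * (b * (b * b))
          e₂ = solve-∀

      heavy-selects : ∀ k → 3 * D ≤ a + k →
        ¬ (4 * a * (c * b * (b * (b * P))) ≤ 4 * a * (6 * miss M F + 3 * (c * c) * b³)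
            + 7 * k * (c * c * c) * b³ × a * P ≤ D * (c * c)) →
        Selects F M c b D a
      heavy-selects k h ¬fail r rc with choose? D a r rc
      ... | inj₁ ch = ch
      ... | inj₂ st = ⊥-elim (¬fail (scaled (4 * a) (miss M F) ms P (7 * k * (c * c * c)) (heavy-fail k h) missing , few-pairs))
        where open Fail D a r st

      light-selects : 3 * D + 1 ≤ a →
        ¬ (8 * a * (c * b * (b * (b * P))) + 3 * (c * c * c) * b³ ≤ 8 * a * (6 * miss M F + 3 * (c * c) * b³)) →
        Selects F M c b D a
      light-selects h ¬fail r rc with choose? D a r rc
      ... | inj₁ ch = ch
      ... | inj₂ st = ⊥-elim (¬fail (begin
          8 * a * (c * b * (b * (b * P))) + 3 * (c * c * c) * b³  ≡⟨ e₁ a c b P ⟩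
          (8 * a * (c * P) + 3 * (c * c * c)) * b³                ≤⟨ *-monoˡ-≤ b³ (light-fail h) ⟩
          8 * a * (6 * ms + 3 * (c * c)) * b³                     ≡⟨ e₂ a ms c b ⟩
          8 * a * (6 * (b * (b * (b * ms))) + 3 * (c * c) * b³)   ≤⟨ *-monoʳ-≤ (8 * a) (+-monoˡ-≤ (3 * (c * c) * b³)
              (*-monoʳ-≤ 6 missing)) ⟩
          8 * a * (6 * miss M F + 3 * (c * c) * b³) ∎))
        where
        open Fail D a r st
        open ≤-Reasoning
        e₁ : ∀ a c b P → 8 * a * (c * b * (b * (b * P))) + 3 * (c * c * c) * (b * (b * b)) ≡ (8 * a * (c * P)
            + 3 * (c * c * c)) * (b * (b * b))
        e₁ = solve-∀
        e₂ : ∀ a ms c b → 8 * a * (6 * ms + 3 * (c * c)) * (b * (b * b)) ≡ 8 * a * (6 * (b * (b * (b * ms)))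
            + 3 * (c * c) * (b * (b * b)))
        e₂ = solve-∀

-- Conditions on missing triples and degree under which a family has cheap edges.

module Quota where

  open Sums
  open Families
  open Selection
  open BlockInequalities
  open import Data.Nat
  open import Data.Nat.Properties
  open import Data.Nat.Tactic.RingSolver using (solve-∀)
  open import Data.Product using (_×_; _,_)
  open import Relation.Nullary using (¬_)
  open import Relation.Binary.PropositionalEquality

  module Quotas (F : Fam) (down : Down F) (m c b D : ℕ) (wide : suc c * suc (suc c) ≤ b)
    (fits : suc c * b < 3 * m) (M≤ : 3 * m ≤ suc c * b + suc c) (c≥ : 1000000 ≤ c) where

    private
      M = 3 * m

      0<b : 0 < b
      0<b = <-≤-trans z<s wide

      open Blocks F down M c b 0<b fits M≤

      instance
        b≢0 : NonZero b
        b≢0 = >-nonZero 0<b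
        c≢0 : NonZero c
        c≢0 = >-nonZero (<-≤-trans z<s c≥)

      g = deg M F

      cb≤M : c * b ≤ M
      cb≤M = ≤-trans (*-monoˡ-≤ b (n≤1+n c)) (<⇒≤ fits)

      g≤ : g ≤ b * b * (P + 2 * c + 2)
      g≤ = degree-bound b c P M g degree M≤ wide

      M≤′ : M ≤ suc (suc c) * b
      M≤′ = M-bound b c M M≤ wide

      P≤ : P ≤ c * c
      P≤ = sum-≤const c c λ β β<c → ≤-trans (sum-≤const β 1 λ α _
          → 𝟙≤1 (inP α β)) (≤-trans (≤-reflexive (*-identityʳ β)) (<⇒≤ β<c))

      2≤c : 2 ≤ c
      2≤c = ≤-trans (s≤s (s≤s z≤n)) c≥

    -- The refuted conditions say that the family misses at least mg/2 - m³/10000 triples and has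
    -- degree at most 3.01 m². They come from the precisions 22500 and 30000: for instance M³/(2 ·
    -- 22500) with M = 3m. The bound 157500 is 7 · 22500 and exceeds 2 · 30000, and 990000 equals
    -- both 44 · 22500 and 33 · 30000.
    heavy-ok : ∀ a k → a + k ≡ 3 * D → 157500 * k ≤ a → 0 < a →
      ¬ (50 * 100 * (m * g) ≤ 100 * 100 * miss M F + m * m * m × 100 * 100 * g ≤ 301 * 100 * (m * m)) → Selects F M c b D a
    heavy-ok a k a+k k≤a 0<a ¬p = heavy-selects F down M c b 0<b fits M≤ D a k (≤-reflexive (sym a+k))
      λ { (h , h′) → ¬p
        ( *-cancelˡ-≤ 27 (begin
            27 * (50 * 100 * (m * g))                       ≡⟨ e₁ (50 * 100) m g ⟩
            9 * (50 * 100) * (M * g)                        ≡⟨ cong (λ v → v * (M * g)) {9 * (50 * 100)} {2 * 22500} refl ⟩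
            2 * 22500 * (M * g)                             ≤⟨ *-cancelˡ-≤ (2 * a) (heavy-missing 22500 a b c k P M g
                (miss M F) h g≤ M≤′ cb³ P≤ k≤a (≤-trans 990000≤ c≥) 2≤c) ⟩
            12 * 22500 * miss M F + M * M * M               ≡⟨ cong (λ v → v * miss M F
                + M * M * M) {12 * 22500} {27 * (100 * 100)} refl ⟩
            27 * (100 * 100) * miss M F + M * M * M         ≡⟨ e₂ (100 * 100) m (miss M F) ⟩
            27 * (100 * 100 * miss M F + m * m * m)         ∎)
        , *-cancelˡ-≤ 9 (begin
            9 * (100 * 100 * g)                             ≡⟨ e₃ (100 * 100) g ⟩
            9 * (100 * 100) * g                             ≡⟨ cong (λ v → v * g) {9 * (100 * 100)} {3 * 30000} refl ⟩
            3 * 30000 * g                                   ≤⟨ *-cancelˡ-≤ (2 * a) (heavy-degree 30000 a b c k D P M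
                g g≤ h′ (≤-reflexive (sym a+k)) (*-mono-≤ cb≤M cb≤M)
                                                                 (≤-trans (*-monoˡ-≤ k 60000≤) k≤a) (≤-trans 990000≤ c≥) 2≤c) ⟩
            suc 30000 * (M * M)                             ≤⟨ *-monoˡ-≤ (M * M) 30001≤ ⟩
            301 * 100 * (M * M)                             ≡⟨ e₄ (301 * 100) m ⟩
            9 * (301 * 100 * (m * m))                       ∎)) }
      where
      instance
        a≢0 : NonZero (2 * a)
        a≢0 = >-nonZero (≤-trans 0<a (m≤m+n a _))
      990000≤ : 990000 ≤ 1000000
      990000≤ = m≤m+n 990000 10000
      open ≤-Reasoning
      30001≤ : 30001 ≤ 301 * 100
      30001≤ = m≤m+n 30001 99
      60000≤ : 60000 ≤ 157500
      60000≤ = m≤m+n 60000 97500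
      cb³ : c * b * (c * b) * (c * b) ≤ M * M * M
      cb³ = *-mono-≤ (*-mono-≤ cb≤M cb≤M) cb≤M
      e₁ : ∀ q m g → 27 * (q * (m * g)) ≡ 9 * q * (3 * m * g)
      e₁ = solve-∀
      e₂ : ∀ q m x → 27 * q * x + 3 * m * (3 * m) * (3 * m) ≡ 27 * (q * x + m * m * m)
      e₂ = solve-∀
      e₃ : ∀ q g → 9 * (q * g) ≡ 9 * q * g
      e₃ = solve-∀
      e₄ : ∀ q m → q * (3 * m * (3 * m)) ≡ 9 * (q * (m * m))
      e₄ = solve-∀

    -- A rate one above the balanced 3D already suffices for a family that misses at most about m/2
    -- triples per completed pair: being stuck would contradict `light-blocks`.
    light-ok : ∀ a → 3 * D + 1 ≤ a → 27 * a < c → 2 * miss M F ≤ m * g + 9 * (m * m) → Selects F M c b D a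
    light-ok a h 27a<c few = light-selects F down M c b 0<b fits M≤ D a h λ fail →
      <⇒≱ 27a<c (*-cancelˡ-≤ (3 * (c * c * (b * (b * b)))) ⦃ nz ⦄
        (light-blocks a b c P M g (miss M F) fail
          (≤-trans (≤-reflexive (e₁ (miss M F))) (≤-trans (*-monoʳ-≤ 3 few) (≤-reflexive (e₂ m g)))) g≤ M≤′ P≤ wide 4≤c))
      where
      4≤c : 4 ≤ c
      4≤c = ≤-trans (m≤m+n 4 999996) c≥
      nz : NonZero (3 * (c * c * (b * (b * b))))
      nz = m*n≢0 3 _ ⦃ _ ⦄ ⦃ m*n≢0 (c * c) _ ⦃ m*n≢0 c c ⦄ ⦃ m*n≢0 b _ ⦃ b≢0 ⦄ ⦃ m*n≢0 b b ⦄ ⦄ ⦄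
      e₁ : ∀ x → 6 * x ≡ 3 * (2 * x)
      e₁ = solve-∀
      e₂ : ∀ m g → 3 * (m * g + 9 * (m * m)) ≡ 3 * m * g + 3 * (3 * m * (3 * m))
      e₂ = solve-∀

-- Rainbow matchings as lists: relabelling, compression and interleaving.

module Matchings where

  open Sums
  open Families
  open import Data.Bool using (true; false; _∨_; T)
  open import Data.Nat
  open import Data.Nat.Properties
  open import Data.List using (List; []; _∷_; length; map)
  open import Data.List.Relation.Unary.Any using (here; there)
  open import Data.List.Relation.Unary.All using (All; []; _∷_)
  import Data.List.Relation.Unary.All as All
  open import Data.List.Membership.Propositional using (_∈_; _∉_)
  open import Data.List.Membership.Propositional.Properties using (∈-map⁻)
  open import Data.List.Membership.DecPropositional _≟_ using (_∈?_)
  open import Data.Product using (∃; _×_; _,_; ∃₂)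
  open import Data.Sum using (_⊎_; inj₁; inj₂)
  open import Relation.Nullary using (Dec; yes; no; ¬_; does)
  open import Relation.Nullary.Decidable using (dec-true)
  open import Relation.Binary.PropositionalEquality
  open import Relation.Binary.Definitions using (tri<; tri≈; tri>)

  Edges : Set₁
  Edges = Fam → ℕ → ℕ → ℕ → Set

  In : Edges
  In F x y z = T (F x y z)

  -- The second index lists the vertices used.
  data RM (E : Edges) : List Fam → List ℕ → Set where
    []  : RM E [] []
    add : ∀ {F Fs U x y z} → x < y → y < z → E F x y z → x ∉ U → y ∉ U → z ∉ U → RM E Fs U →
          RM E (F ∷ Fs) (x ∷ y ∷ z ∷ U)

  RM-length : ∀ {E Fs U} → RM E Fs U → length U ≡ 3 * length Fs
  RM-length []                              = refl
  RM-length {Fs = F ∷ Fs} (add _ _ _ _ _ _ R) = trans (cong (3 +_) (RM-length R)) (sym (*-suc 3 (length Fs)))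

  relabel : ∀ {E E′ : Edges} (φ : ℕ → ℕ) (V : List ℕ) →
    (∀ {u v} → u ∈ V → v ∈ V → u < v → φ u < φ v) →
    (∀ {F x y z} → x ∈ V → y ∈ V → z ∈ V → E F x y z → E′ F (φ x) (φ y) (φ z)) →
    ∀ {Fs U} → RM E Fs U → (∀ {u} → u ∈ U → u ∈ V) → RM E′ Fs (map φ U)
  relabel φ V mono h []                              sub = []
  relabel φ V mono h (add {U = U} x<y y<z e x∉ y∉ z∉ R) sub =
    add (mono (sub (here refl)) (sub (there (here refl))) x<y) (mono (sub (there (here refl))) (sub (there (there
        (here refl)))) y<z)
        (h (sub (here refl)) (sub (there (here refl))) (sub (there (there (here refl)))) e)
        (fresh (here refl) x∉) (fresh (there (here refl)) y∉) (fresh (there (there (here refl))) z∉)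
        (relabel φ V mono h R (λ p → sub (there (there (there p)))))
    where
    fresh : ∀ {w} → w ∈ _ → w ∉ U → φ w ∉ map φ U
    fresh {w} w∈ w∉ φw∈ with ∈-map⁻ φ φw∈
    ... | u , u∈ , eq with <-cmp w u
    ... | tri< lt _ _ = <⇒≢ (mono (sub w∈) (sub (there (there (there u∈)))) lt) eq
    ... | tri≈ _ refl _ = w∉ u∈
    ... | tri> _ _ gt = <⇒≢ (mono (sub (there (there (there u∈)))) (sub w∈) gt) (sym eq)

  unmap : ∀ {E} (τ : Fam → Fam) Fs {U} → RM E (map τ Fs) U → RM (λ F → E (τ F)) Fs U
  unmap τ []       []                        = []
  unmap τ (F ∷ Fs) (add x<y y<z e x∉ y∉ z∉ R) = add x<y y<z e x∉ y∉ z∉ (unmap τ Fs R)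

  private
    has : List ℕ → ℕ → ℕ
    has V u = 𝟙 (does (u ∈? V))

    𝟙-∨ : ∀ a b → 𝟙 (a ∨ b) ≤ 𝟙 a + 𝟙 b
    𝟙-∨ true  b = s≤s z≤n
    𝟙-∨ false b = ≤-refl

  rank : List ℕ → ℕ → ℕ
  rank V v = sum v (has V)

  sum-eq : ∀ n v → sum n (λ u → 𝟙 (does (u ≟ v))) ≤ 1
  sum-eq zero    v       = z≤n
  sum-eq (suc n) zero    = ≤-reflexive (cong suc (sum-zero n λ _ _ → refl))
  sum-eq (suc n) (suc v) = sum-eq n v

  rank≤length : ∀ V n → rank V n ≤ length V
  rank≤length []      n = ≤-reflexive (sum-zero n λ u _ → refl)
  rank≤length (v ∷ V) n = ≤-trans (sum-mono n λ u _ → 𝟙-∨ (does (u ≟ v)) (does (u ∈? V)))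
    (≤-trans (≤-reflexive (sum-+ n _ _)) (+-mono-≤ (sum-eq n v) (rank≤length V n)))

  rank≤ : ∀ V v → rank V v ≤ v
  rank≤ V v = ≤-trans (sum-≤const v 1 λ u _ → 𝟙≤1 (does (u ∈? V))) (≤-reflexive (*-identityʳ v))

  rank-suc : ∀ V {v} → v ∈ V → rank V (suc v) ≡ suc (rank V v)
  rank-suc V {v} v∈ = begin
    sum (suc v) (has V)                 ≡⟨ cong (λ n → sum n (has V)) (+-comm 1 v) ⟩
    sum (v + 1) (has V)                 ≡⟨ sum-split v 1 (has V) ⟩
    rank V v + (has V (v + 0) + 0)      ≡⟨ cong (λ n → rank V v
        + n) (trans (+-identityʳ _) (trans (cong (has V) (+-identityʳ v)) (cong 𝟙 (dec-true (v ∈? V) v∈)))) ⟩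
    rank V v + 1                        ≡⟨ +-comm (rank V v) 1 ⟩
    suc (rank V v)                      ∎
    where open ≡-Reasoning

  rank-mono : ∀ V {u v} → u ∈ V → u < v → rank V u < rank V v
  rank-mono V u∈ u<v = ≤-trans (≤-reflexive (sym (rank-suc V u∈))) (sum-range-mono (has V) u<v)

  rank<length : ∀ V {v} → v ∈ V → rank V v < length V
  rank<length V {v} v∈ = ≤-trans (≤-reflexive (sym (rank-suc V v∈))) (rank≤length V (suc v))

  -- The rank of a used vertex never exceeds it, is strictly increasing on the used vertices and
  -- stays below their number 3 * length Fs. These are exactly the premises under which `Dom` yields
  -- an edge.
  compress : ∀ {Fs U} → RM (Dom (3 * length Fs)) Fs U → ∃ λ V → RM In Fs V × All (_< 3 * length Fs) V
  compress {Fs} {U} R₀ = map (rank U) U ,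
    relabel (rank U) U (λ u∈ _ → rank-mono U u∈)
      (λ {F} x∈ y∈ z∈ e → e)
      R′ (λ p → p) , All.tabulate below
    where
    below : ∀ {v} → v ∈ map (rank U) U → v < 3 * length Fs
    below v∈ with ∈-map⁻ (rank U) v∈
    ... | u , u∈ , refl = ≤-trans (rank<length U u∈) (≤-reflexive (RM-length R₀))
    relax : ∀ {Gs W} → (∀ {u} → u ∈ W → u ∈ U) → RM (Dom (3 * length Fs)) Gs W →
      RM (λ F x y z → T (F (rank U x) (rank U y) (rank U z))) Gs W
    relax sub []                         = []
    relax sub (add x<y y<z e x∉ y∉ z∉ R) = add x<y y<z
      (e (rank≤ U _) (rank≤ U _) (rank≤ U _) (rank-mono U (sub (here refl)) x<y) (rank-mono U (sub (there (here refl))) y<z)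
         (≤-trans (rank<length U (sub (there (there (here refl))))) (≤-reflexive (RM-length R₀))))
      x∉ y∉ z∉ (relax (λ p → sub (there (there (there p)))) R)
    R′ = relax (λ p → p) R₀

  -- Interleavings instead of concatenations, since the edges of a matching must come in the order
  -- of the given list of families.
  data Split : List Fam → List Fam → List Fam → Set where
    []   : Split [] [] []
    _∷ˡ_ : ∀ F {As Bs Cs} → Split As Bs Cs → Split (F ∷ As) Bs (F ∷ Cs)
    _∷ʳ_ : ∀ F {As Bs Cs} → Split As Bs Cs → Split As (F ∷ Bs) (F ∷ Cs)

  split-length : ∀ {As Bs Cs} → Split As Bs Cs → length As + length Bs ≡ length Cs
  split-length []                         = refl
  split-length (F ∷ˡ s)                   = cong suc (split-length s)
  split-length {As} {_ ∷ Bs} (F ∷ʳ s) = trans (+-suc (length As) (length Bs)) (cong suc (split-length s))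

  split-All : ∀ {ℓ} {P : Fam → Set ℓ} {As Bs Cs} → Split As Bs Cs → All P Cs → All P As × All P Bs
  split-All []       []       = [] , []
  split-All (F ∷ˡ s) (p ∷ ps) = let as , bs = split-All s ps in p ∷ as , bs
  split-All (F ∷ʳ s) (p ∷ ps) = let as , bs = split-All s ps in as , p ∷ bs

  separate : ∀ {P : Fam → Set} → (∀ F → Dec (P F)) → ∀ Cs → ∃₂ λ As Bs → Split As Bs Cs × All P As × All (λ F → ¬ P F) Bs
  separate P? []       = [] , [] , [] , [] , []
  separate P? (F ∷ Cs) with P? F | separate P? Cs
  ... | yes p | As , Bs , s , as , bs = F ∷ As , Bs , F ∷ˡ s , p ∷ as , bs
  ... | no ¬p | As , Bs , s , as , bs = As , F ∷ Bs , F ∷ʳ s , as , ¬p ∷ bs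

  allʳ : ∀ Cs → Split [] Cs Cs
  allʳ []       = []
  allʳ (F ∷ Cs) = F ∷ʳ allʳ Cs

  merge : ∀ {E As Bs Cs U V} → Split As Bs Cs → RM E As U → RM E Bs V → (∀ {u} → u ∈ U → u ∉ V) →
    ∃ λ W → RM E Cs W × (∀ {w} → w ∈ W → w ∈ U ⊎ w ∈ V)
  merge []        []                            []                            dis = [] , [] , λ ()
  merge (F ∷ˡ s) (add {U = U} x<y y<z e x∉ y∉ z∉ R) S                             dis with merge s R S (λ u∈
      → dis (there (there (there u∈))))
  ... | W , RW , sub = _ , add x<y y<z e (fresh x∉ (dis (here refl))) (fresh y∉ (dis (there (here refl)))) (fresh z∉
      (dis (there (there (here refl))))) RW , sub′
    where
    fresh : ∀ {x} → x ∉ U → x ∉ _ → x ∉ W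
    fresh x∉U x∉V x∈ with sub x∈
    ... | inj₁ p = x∉U p
    ... | inj₂ p = x∉V p
    sub′ : ∀ {w} → w ∈ _ → w ∈ _ ⊎ w ∈ _
    sub′ (here p)                 = inj₁ (here p)
    sub′ (there (here p))         = inj₁ (there (here p))
    sub′ (there (there (here p))) = inj₁ (there (there (here p)))
    sub′ (there (there (there p))) with sub p
    ... | inj₁ q = inj₁ (there (there (there q)))
    ... | inj₂ q = inj₂ q
  merge (F ∷ʳ s) R (add {U = V} x<y y<z e x∉ y∉ z∉ S) dis with merge s R S (λ u∈ v∈ → dis u∈ (there (there (there v∈))))
  ... | W , RW , sub = _ , add x<y y<z e (fresh (here refl) x∉) (fresh (there (here refl)) y∉) (fresh (there (there
      (here refl))) z∉) RW , sub′
    where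
    fresh : ∀ {x} → x ∈ _ → x ∉ V → x ∉ W
    fresh x∈S x∉V x∈ with sub x∈
    ... | inj₁ p = dis p x∈S
    ... | inj₂ p = x∉V p
    sub′ : ∀ {w} → w ∈ _ → w ∈ _ ⊎ w ∈ _
    sub′ (here p)                 = inj₂ (here p)
    sub′ (there (here p))         = inj₂ (there (here p))
    sub′ (there (there (here p))) = inj₂ (there (there (here p)))
    sub′ (there (there (there p))) with sub p
    ... | inj₁ q = inj₁ q
    ... | inj₂ q = inj₂ (there (there (there q)))

-- The greedy choice of edges and the placement of their vertices.

module Nibble where

  open Sums
  open Families
  open Selection using (Choice; Selects)
  open Matchings
  open import Data.Nat
  open import Data.Nat.Properties
  open import Data.Nat.Tactic.RingSolver using (solve-∀)
  open import Data.List using (List; []; _∷_; length)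
  open import Data.List.Relation.Unary.Any using (here; there)
  open import Data.List.Membership.Propositional using (_∈_; _∉_)
  open import Data.Product using (∃; _×_; _,_; ∃₂)
  open import Data.Empty using (⊥-elim)
  open import Data.Sum using (inj₁; inj₂)
  open import Relation.Nullary using (yes; no; does)
  open import Relation.Nullary.Decidable using (dec-true; dec-false)
  open import Relation.Binary.PropositionalEquality
  open import Relation.Binary.Definitions using (tri<; tri≈; tri>)

  δ : ℕ → ℕ → ℕ
  δ α i = 𝟙 (does (i ≟ α))

  δ-refl : ∀ α → δ α α ≡ 1
  δ-refl α = cong 𝟙 (dec-true (α ≟ α) refl)

  sum-δ : ∀ n α (f : ℕ → ℕ) → sum n (λ i → f i * δ α i) ≤ f α
  sum-δ n α f = ≤-trans (≤-reflexive (sum-cong n λ i _ → eq i)) (≤-trans (≤-reflexive (sum-*ˡ n (f α) (δ α)))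
    (≤-trans (*-monoʳ-≤ (f α) (sum-eq n α)) (≤-reflexive (*-identityʳ (f α)))))
    where
    eq : ∀ i → f i * δ α i ≡ f α * δ α i
    eq i with i ≟ α
    ... | yes refl = refl
    ... | no  i≢α  = trans (cong (λ b → f i * 𝟙 b) (dec-false (i ≟ α) i≢α))
      (trans (*-zeroʳ (f i)) (sym (trans (cong (λ b → f α * 𝟙 b) (dec-false (i ≟ α) i≢α)) (*-zeroʳ (f α)))))

  -- Expand the square of r + u - a and drop 2au; where the subtraction is truncated, 2ar ≤ r² + a²
  -- is all that is needed. After summation over the blocks a cheap choice cancels the term 2ru
  -- against 2ar.
  excess-step : ∀ r u a → ((r + u) ∸ a) * ((r + u) ∸ a) + 2 * (a * r) ≤ r * r + 2 * (r * u) + (u * u + a * a)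
  excess-step r u a with ≤-total (r + u) a
  ... | inj₁ le = ≤-trans (≤-reflexive (cong (λ s → s * s + 2 * (a * r)) (m≤n⇒m∸n≡0 le))) (begin
      2 * (a * r)                          ≤⟨ sq≥ r a ⟩
      r * r + a * a                        ≤⟨ +-mono-≤ (m≤m+n (r * r) (2 * (r * u))) (m≤n+m (a * a) (u * u)) ⟩
      r * r + 2 * (r * u) + (u * u + a * a) ∎)
    where
    open ≤-Reasoning
    sq≥ : ∀ r a → 2 * (a * r) ≤ r * r + a * a
    sq≥ r a with ≤-total r a
    ... | inj₁ p with m≤n⇒∃[o]m+o≡n p
    ... | o , refl = ≤-trans (m≤m+n _ (o * o)) (≤-reflexive (lem r o))
      where
      lem : ∀ r o → 2 * ((r + o) * r) + o * o ≡ r * r + (r + o) * (r + o)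
      lem = solve-∀
    sq≥ r a | inj₂ p with m≤n⇒∃[o]m+o≡n p
    ... | o , refl = ≤-trans (m≤m+n _ (o * o)) (≤-reflexive (lem a o))
      where
      lem : ∀ a o → 2 * (a * (a + o)) + o * o ≡ (a + o) * (a + o) + a * a
      lem = solve-∀
  ... | inj₂ ge = begin
      s * s + 2 * (a * r)                   ≤⟨ +-monoʳ-≤ (s * s) (*-monoʳ-≤ 2 (*-monoʳ-≤ a (≤-trans (m≤m+n r u)
          (≤-reflexive (sym s+a))))) ⟩
      s * s + 2 * (a * (s + a))             ≡⟨ lem₁ s a ⟩
      (s + a) * (s + a) + a * a             ≡⟨ cong (λ v → v * v + a * a) s+a ⟩
      (r + u) * (r + u) + a * a             ≡⟨ lem₂ r u a ⟩
      r * r + 2 * (r * u) + (u * u + a * a) ∎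
    where
    open ≤-Reasoning
    s = (r + u) ∸ a
    s+a : s + a ≡ r + u
    s+a = m∸n+n≡m ge
    lem₁ : ∀ s a → s * s + 2 * (a * (s + a)) ≡ (s + a) * (s + a) + a * a
    lem₁ = solve-∀
    lem₂ : ∀ r u a → (r + u) * (r + u) + a * a ≡ r * r + 2 * (r * u) + (u * u + a * a)
    lem₂ = solve-∀

  module Process (M c b D A : ℕ) where

    bump : ℕ → ℕ → ℕ → ℕ → ℕ
    bump α β γ i = δ α i + δ β i + δ γ i

    data Run : List Fam → (ℕ → ℕ) → Set where
      []  : Run [] (λ _ → 0)
      add : ∀ {F Fs ℓ α β γ} → α < β → β < γ → γ ≤ c → (∀ z → (γ < c → z ≤ γ * b + b) → Dom M F (α * b + b) (β * b + b) z) →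
            Run Fs ℓ → Run (F ∷ Fs) (λ i → ℓ i + bump α β γ i)

    data Rates : List Fam → ℕ → Set where
      []  : Rates [] 0
      _∷_ : ∀ {F Fs a s} → a ≤ A × Selects F M c b D a → Rates Fs s → Rates (F ∷ Fs) (a + s)

    -- The three chosen blocks contribute at most 9(cD)² to the squares, and the raised target at
    -- most A² for each of the `c` blocks.
    W : ℕ
    W = 9 * (c * D * (c * D)) + c * (A * A)

    -- r dominates the excess of the scaled load c * D * ℓ over the target s reached so far; the sum of
    -- its squares grows by at most W per family, because each choice is cheap for the current r.
    record State (Fs : List Fam) (s : ℕ) : Set where
      field
        ℓ r   : ℕ → ℕ
        run   : Run Fs ℓ
        rc≡0  : r c ≡ 0
        load  : ∀ α → α < c → c * D * ℓ α ≤ r α + s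
        small : sum c (λ α → r α * r α) ≤ length Fs * W

    process : ∀ {Fs s} → Rates Fs s → State Fs s
    process [] = record
      { ℓ = λ _ → 0 ; r = λ _ → 0 ; run = [] ; rc≡0 = refl
      ; load = λ α _ → ≤-reflexive (*-zeroʳ (c * D)) ; small = ≤-reflexive (sum-zero c λ _ _ → refl) }
    process {F ∷ Fs} {.(a + s)} (_∷_ {a = a} {s = s} (a≤A , sel) rates) = record
      { ℓ = λ i → ℓ i + bump α β γ i ; r = r′ ; run = add α<β β<γ γ≤c valid run
      ; rc≡0 = r′c ; load = load′ ; small = small′ }
      where
      open State (process rates)
      open Choice (sel r rc≡0)
      E = c * D

      u : ℕ → ℕ
      u i = E * bump α β γ i

      -- The excess is reset to 0 outside the real blocks, because `Selects` needs weight 0 on the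
      -- virtual block.
      r′ : ℕ → ℕ
      r′ i with i <? c
      ... | yes _ = (r i + u i) ∸ a
      ... | no  _ = 0

      r′c : r′ c ≡ 0
      r′c with c <? c
      ... | yes lt = ⊥-elim (<-irrefl refl lt)
      ... | no  _  = refl

      r′≡ : ∀ i → i < c → r′ i ≡ (r i + u i) ∸ a
      r′≡ i i<c with i <? c
      ... | yes _ = refl
      ... | no  p = ⊥-elim (p i<c)

      load′ : ∀ i → i < c → E * (ℓ i + bump α β γ i) ≤ r′ i + (a + s)
      load′ i i<c = begin
        E * (ℓ i + bump α β γ i)     ≡⟨ *-distribˡ-+ E (ℓ i) _ ⟩
        E * ℓ i + u i                ≤⟨ +-monoˡ-≤ (u i) (load i i<c) ⟩
        r i + s + u i                ≡⟨ e₁ (r i) s (u i) ⟩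
        r i + u i + s                ≤⟨ +-monoˡ-≤ s (m≤n+m∸n (r i + u i) a) ⟩
        a + (r i + u i ∸ a) + s      ≡⟨ e₂ a (r i + u i ∸ a) s ⟩
        (r i + u i ∸ a) + (a + s)    ≡⟨ cong (_+ (a + s)) (sym (r′≡ i i<c)) ⟩
        r′ i + (a + s)               ∎
        where
        open ≤-Reasoning
        e₁ : ∀ x y z → x + y + z ≡ x + z + y
        e₁ = solve-∀
        e₂ : ∀ x y z → x + y + z ≡ y + (x + z)
        e₂ = solve-∀

      ru≤ : sum c (λ i → r i * u i) ≤ E * (r α + r β + r γ)
      ru≤ = begin
        sum c (λ i → r i * u i)                  ≡⟨ sum-cong c (λ i _ → e₁ (r i) E (δ α i) (δ β i) (δ γ i)) ⟩
        sum c (λ i → E * (r i * δ α i + r i * δ β i + r i * δ γ i)) ≡⟨ sum-*ˡ c E _ ⟩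
        E * sum c (λ i → r i * δ α i + r i * δ β i + r i * δ γ i)   ≡⟨ cong (E *_) (trans (sum-+ c _ _) (cong (_+ sum
            c (λ i → r i * δ γ i)) (sum-+ c _ _))) ⟩
        E * (sum c (λ i → r i * δ α i) + sum c (λ i → r i * δ β i) + sum c (λ i → r i * δ γ i))
          ≤⟨ *-monoʳ-≤ E (+-mono-≤ (+-mono-≤ (sum-δ c α r) (sum-δ c β r)) (sum-δ c γ r)) ⟩
        E * (r α + r β + r γ)                    ∎
        where
        open ≤-Reasoning
        e₁ : ∀ r E x y z → r * (E * (x + y + z)) ≡ E * (r * x + r * y + r * z)
        e₁ = solve-∀

      uu≤ : sum c (λ i → u i * u i) ≤ 9 * (E * E)
      uu≤ = begin
        sum c (λ i → u i * u i)                                         ≤⟨ sum-mono c (λ i _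
            → sqr (δ α i) (δ β i) (δ γ i) (𝟙≤1 _) (𝟙≤1 _) (𝟙≤1 _)) ⟩
        sum c (λ i → 3 * (E * E) * (δ α i + δ β i + δ γ i))             ≡⟨ sum-*ˡ c (3 * (E * E)) _ ⟩
        3 * (E * E) * sum c (λ i → δ α i + δ β i + δ γ i)               ≡⟨ cong (3 * (E * E) *_) (trans (sum-+ c _ _)
            (cong (_+ sum c (δ γ)) (sum-+ c _ _))) ⟩
        3 * (E * E) * (sum c (δ α) + sum c (δ β) + sum c (δ γ))         ≤⟨ *-monoʳ-≤ (3 * (E * E)) (+-mono-≤
            (+-mono-≤ (sum-eq c α) (sum-eq c β)) (sum-eq c γ)) ⟩
        3 * (E * E) * 3                                                 ≡⟨ e₁ (E * E) ⟩
        9 * (E * E)                                                     ∎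
        where
        open ≤-Reasoning
        e₁ : ∀ x → 3 * x * 3 ≡ 9 * x
        e₁ = solve-∀
        e₂ : ∀ E s → E * s * (E * s) ≡ E * E * s * s
        e₂ = solve-∀
        e₃ : ∀ E s → E * E * s * 3 ≡ 3 * (E * E) * s
        e₃ = solve-∀
        sqr : ∀ x y z → x ≤ 1 → y ≤ 1 → z ≤ 1 → E * (x + y + z) * (E * (x + y + z)) ≤ 3 * (E * E) * (x + y + z)
        sqr x y z p q t = ≤-trans (≤-reflexive (e₂ E (x + y + z))) (≤-trans (*-monoʳ-≤ (E * E * (x + y
            + z)) (+-mono-≤ (+-mono-≤ p q) t)) (≤-reflexive (e₃ E (x + y + z))))

      small′ : sum c (λ i → r′ i * r′ i) ≤ W + length Fs * W
      small′ = +-cancelʳ-≤ (2 * (a * sum c r)) _ _ (begin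
        sum c (λ i → r′ i * r′ i) + 2 * (a * sum c r)
          ≡⟨ cong₂ _+_ (sum-cong c λ i i<c → cong (λ v → v * v) (r′≡ i i<c)) (trans (cong (2 *_) (sym (sum-*ˡ c a
              r))) (sym (sum-*ˡ c 2 _))) ⟩
        sum c (λ i → (r i + u i ∸ a) * (r i + u i ∸ a)) + sum c (λ i → 2 * (a * r i))
          ≡⟨ sum-+ c _ _ ⟨
        sum c (λ i → (r i + u i ∸ a) * (r i + u i ∸ a) + 2 * (a * r i))
          ≤⟨ sum-mono c (λ i _ → excess-step (r i) (u i) a) ⟩
        sum c (λ i → r i * r i + 2 * (r i * u i) + (u i * u i + a * a))
          ≡⟨ trans (sum-+ c _ _) (cong₂ _+_ (sum-+ c _ _) (sum-+ c _ _)) ⟩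
        sum c (λ i → r i * r i) + sum c (λ i → 2 * (r i * u i)) + (sum c (λ i → u i * u i) + sum c (λ _ → a * a))
          ≤⟨ +-mono-≤ (+-mono-≤ small (≤-trans (≤-reflexive (sum-*ˡ c 2 _)) (*-monoʳ-≤ 2 (≤-trans ru≤ cheap))))
               (+-mono-≤ uu≤ (≤-trans (≤-reflexive (sum-const c (a * a))) (*-monoʳ-≤ c (*-mono-≤ a≤A a≤A)))) ⟩
        length Fs * W + 2 * (a * sum c r) + W
          ≡⟨ e₁ (length Fs * W) (2 * (a * sum c r)) W ⟩
        W + length Fs * W + 2 * (a * sum c r) ∎)
        where
        open ≤-Reasoning
        e₁ : ∀ x y z → x + y + z ≡ z + x + y
        e₁ = solve-∀

    block-sep : ∀ {α β i j} → α < β → i < b → α * b + i < β * b + j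
    block-sep {α} {β} {i} {j} α<β i<b = begin-strict
      α * b + i <⟨ +-monoʳ-< (α * b) i<b ⟩
      α * b + b ≡⟨ +-comm (α * b) b ⟩
      suc α * b ≤⟨ *-monoˡ-≤ b α<β ⟩
      β * b     ≤⟨ m≤m+n (β * b) j ⟩
      β * b + j ∎
      where open ≤-Reasoning

    -- Each block hands out its vertices in increasing order, so its load is the offset of the next
    -- free one. The virtual block comes last and may overflow: its vertices can exceed `M`, which
    -- `Dom` tolerates until the matching is compressed.
    place : ∀ {Fs ℓ} → Run Fs ℓ → (∀ α → α < c → ℓ α ≤ b) →
      ∃ λ U → RM (Dom M) Fs U × (∀ {u} → u ∈ U → ∃₂ λ α j → α ≤ c × j < ℓ α × u ≡ α * b + j)
    place []  fits = [] , [] , λ ()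
    place (add {F} {Fs} {ℓ} {α} {β} {γ} α<β β<γ γ≤c valid run) fits
      with place run (λ i i<c → ≤-trans (m≤m+n (ℓ i) (bump α β γ i)) (fits i i<c))
    ... | U , R , slots = _ , add (block-sep α<β (room α α<c (hitα))) (block-sep β<γ (room β β<c hitβ))
          (λ x′≤ y′≤ z′≤ → valid (γ * b + ℓ γ) (λ γ<c → +-monoʳ-≤ (γ * b) (<⇒≤ (room γ γ<c hitγ)))
             (≤-trans x′≤ (+-monoʳ-≤ (α * b) (<⇒≤ (room α α<c hitα)))) (≤-trans y′≤ (+-monoʳ-≤ (β * b) (<⇒≤ (room β
                 β<c hitβ)))) z′≤)
          (fresh α (<⇒≤ α<c) hitα) (fresh β (<⇒≤ β<c) hitβ) (fresh γ γ≤c hitγ) R , slots′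
      where
      β<c = <-≤-trans β<γ γ≤c
      α<c = <-trans α<β β<c
      hitα : 0 < bump α β γ α
      hitα = ≤-trans (≤-reflexive (sym (δ-refl α))) (≤-trans (m≤m+n (δ α α) (δ β α)) (m≤m+n _ (δ γ α)))
      hitβ : 0 < bump α β γ β
      hitβ = ≤-trans (≤-reflexive (sym (δ-refl β))) (≤-trans (m≤n+m (δ β β) (δ α β)) (m≤m+n _ (δ γ β)))
      hitγ : 0 < bump α β γ γ
      hitγ = ≤-trans (≤-reflexive (sym (δ-refl γ))) (m≤n+m (δ γ γ) (δ α γ + δ β γ))
      above : ∀ i → 0 < bump α β γ i → ℓ i < ℓ i + bump α β γ i
      above i p = m<m+n (ℓ i) p
      room : ∀ i → i < c → 0 < bump α β γ i → ℓ i < b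
      room i i<c p = <-≤-trans (above i p) (fits i i<c)
      load≤b : ∀ i → i < c → ℓ i ≤ b
      load≤b i i<c = ≤-trans (m≤m+n (ℓ i) (bump α β γ i)) (fits i i<c)
      fresh : ∀ i → i ≤ c → 0 < bump α β γ i → i * b + ℓ i ∉ U
      fresh i i≤c hit p with slots p
      ... | i′ , j , i′≤c , j< , eq with <-cmp i′ i
      ... | tri< lt _ _ = <⇒≢ (block-sep lt (<-≤-trans j< (load≤b i′ (<-≤-trans lt i≤c)))) (sym eq)
      ... | tri≈ _ refl _ = <⇒≢ j< (sym (+-cancelˡ-≡ (i * b) _ _ eq))
      ... | tri> _ _ gt = <⇒≢ (block-sep gt (room i (<-≤-trans gt i′≤c) hit)) eq
      slots′ : ∀ {u} → u ∈ _ → ∃₂ λ i j → i ≤ c × j < ℓ i + bump α β γ i × u ≡ i * b + j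
      slots′ (here refl)                 = α , ℓ α , <⇒≤ α<c , above α hitα , refl
      slots′ (there (here refl))         = β , ℓ β , <⇒≤ β<c , above β hitβ , refl
      slots′ (there (there (here refl))) = γ , ℓ γ , γ≤c , above γ hitγ , refl
      slots′ (there (there (there p))) with slots p
      ... | i , j , i≤c , j< , eq = i , j , i≤c , <-≤-trans j< (m≤m+n (ℓ i) _) , eq

    -- A block with more than `b` vertices would have scaled load at least cD(b+1), hence an excess
    -- whose square is too large for a single term of the bounded sum of squares.
    nibble : ∀ {Fs s} → Rates Fs s → (∀ r → r * r ≤ length Fs * W → r + s < c * D * suc b) → ∃ λ U → RM (Dom M) Fs U
    nibble {Fs} {s} rates roomy = let U , R , _ = place run fits in U , R
      where
      open State (process rates)
      fits : ∀ α → α < c → ℓ α ≤ b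
      fits α α<c = ≮⇒≥ λ b<ℓ → <⇒≱ (roomy (r α) (≤-trans (term≤sum c (λ i → r i * r i) α α<c) small))
        (≤-trans (*-monoʳ-≤ (c * D) b<ℓ) (load α α<c))

-- Removing vertices: edge counts and assembly of matchings.

module Moves where

  open Sums
  open Families
  open Matchings
  open import Data.Bool using (Bool; true; false; not; T)
  open import Data.Nat
  open import Data.Nat.Properties
  open import Data.Nat.Combinatorics using (_C_)
  open import Data.Nat.Tactic.RingSolver using (solve-∀)
  open import Data.List using (List; []; _∷_; length; map)
  open import Data.List.Properties using (length-map)
  open import Data.List.Relation.Unary.Any using (here; there)
  open import Data.List.Relation.Unary.All using (All; []; _∷_)
  import Data.List.Relation.Unary.All as All
  import Data.List.Relation.Unary.All.Properties as Allₚ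
  open import Data.List.Membership.Propositional using (_∈_; _∉_)
  open import Data.List.Membership.Propositional.Properties using (∈-map⁻)
  open import Data.Product using (∃; _×_; _,_)
  open import Data.Sum using (_⊎_; inj₁; inj₂)
  open import Data.Empty using (⊥-elim)
  open import Relation.Nullary using (¬_)
  open import Relation.Binary.PropositionalEquality

  shift : ℕ → Fam → Fam
  shift s F x y z = F (s + x) (s + y) (s + z)

  shift-Down : ∀ s {F} → Down F → Down (shift s F)
  shift-Down s down x<y y<z p q r x′<y′ y′<z′ = down (+-monoʳ-< s x<y) (+-monoʳ-< s y<z)
    (+-monoʳ-≤ s p) (+-monoʳ-≤ s q) (+-monoʳ-≤ s r) (+-monoʳ-< s x′<y′) (+-monoʳ-< s y′<z′)

  Solvable : List Fam → Set
  Solvable Fs = ∃ λ U → RM In Fs U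

  RM-weaken : ∀ {E E′ : Edges} {P : Fam → Set} → (∀ {F x y z} → P F → x < y → y < z → E F x y z → E′ F x y z) →
    ∀ {Fs U} → All P Fs → RM E Fs U → RM E′ Fs U
  RM-weaken h []       []                            = []
  RM-weaken h (p ∷ ps) (add x<y y<z e x∉ y∉ z∉ R) = add x<y y<z (h p x<y y<z e) x∉ y∉ z∉ (RM-weaken h ps R)

  In⇒Dom : ∀ {M F x y z} → Down F → x < y → y < z → In F x y z → Dom M F x y z
  In⇒Dom down x<y y<z e p q r x′<y′ y′<z′ _ = down x<y y<z p q r x′<y′ y′<z′ e

  tighten : ∀ {Fs} → All Down Fs → Solvable Fs → ∃ λ V → RM In Fs V × All (_< 3 * length Fs) V
  tighten downs (_ , R) = compress (RM-weaken In⇒Dom downs R)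

  -- Compression confines the matching of `Bs` to [s , s + 3 * length Bs), which the edges of `As`
  -- avoid.
  assemble : ∀ s {As Bs Cs U} → Split As Bs Cs → All Down Bs → Solvable (map (shift s) Bs) →
    RM In As U → (∀ {u} → u ∈ U → u < s ⊎ s + 3 * length Bs ≤ u) → Solvable Cs
  assemble s {Bs = Bs} sp downs sol R outside
    with tighten (Allₚ.map⁺ (All.map (λ {F} → shift-Down s {F}) downs)) sol
  ... | V , RV , V< with merge sp R (relabel (s +_) V (λ _ _ → +-monoʳ-< s) (λ _ _ _ e → e) (unmap (shift s) Bs RV) (λ p → p)) dis
    where
    dis : ∀ {u} → u ∈ _ → u ∉ map (s +_) V
    dis u∈ u∈′ with ∈-map⁻ (s +_) u∈′
    ... | v , v∈ , refl with outside u∈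
    ... | inj₁ lt = <⇒≱ lt (m≤m+n s v)
    ... | inj₂ ge = <⇒≱ (All.lookup V< v∈) (≤-trans (≤-reflexive (cong (3 *_) (length-map (shift s) Bs))) (+-cancelˡ-≤ s _ _ ge))
  ... | W , RW , _ = W , RW

  pairs-below : ∀ n h (G : ℕ → ℕ → Bool) → (∀ y z → h ≤ y → y < z → G y z ≡ false) →
    tri₂ n (λ y z → 𝟙 (G y z)) + (n ∸ h) C 2 ≤ n C 2
  pairs-below zero    h       G none = ≤-reflexive (cong (_C 2) (0∸n≡0 h))
  pairs-below (suc n) zero    G none = ≤-reflexive (cong (_+ suc n C 2)
    (sum-zero (suc n) λ z _ → sum-zero z λ y y<z → cong 𝟙 (none y z z≤n y<z)))
  pairs-below (suc n) (suc h) G none = begin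
    tri₂ (suc n) (λ y z → 𝟙 (G y z)) + (n ∸ h) C 2
      ≡⟨ cong (_+ (n ∸ h) C 2) (tri₂-suc n λ y z → 𝟙 (G y z)) ⟩
    sum n (λ z → 𝟙 (G 0 (suc z))) + tri₂ n (λ y z → 𝟙 (G (suc y) (suc z))) + (n ∸ h) C 2
      ≡⟨ +-assoc (sum n (λ z → 𝟙 (G 0 (suc z)))) _ _ ⟩
    sum n (λ z → 𝟙 (G 0 (suc z))) + (tri₂ n (λ y z → 𝟙 (G (suc y) (suc z))) + (n ∸ h) C 2)
      ≤⟨ +-mono-≤ (≤-trans (sum-≤const n 1 λ z _ → 𝟙≤1 (G 0 (suc z))) (≤-reflexive (*-identityʳ n)))
                  (pairs-below n h (λ y z → G (suc y) (suc z)) λ y z h≤y y<z → none (suc y) (suc z) (s≤s h≤y) (s<s y<z)) ⟩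
    n + n C 2
      ≡⟨ Pascal₂ n ⟨
    suc n C 2 ∎
    where open ≤-Reasoning

  cnt-suc : ∀ n F → cnt (suc n) F ≡ tri₂ n (λ y z → 𝟙 (F 0 (suc y) (suc z))) + cnt n (shift 1 F)
  cnt-suc n F = tri₃-suc n λ x y z → 𝟙 (F x y z)

  cnt-first : ∀ n F → cnt (suc n) F ≤ n C 2 + cnt n (shift 1 F)
  cnt-first n F = ≤-trans (≤-reflexive (cnt-suc n F)) (+-monoˡ-≤ _
    (≤-trans (tri₂-mono n λ y z _ _ → 𝟙≤1 (F 0 (suc y) (suc z))) (≤-reflexive (tri₂-total n))))

  C₂-suc : ∀ n → n C 2 ≤ suc n C 2
  C₂-suc n = ≤-trans (m≤n+m _ n) (≤-reflexive (sym (Pascal₂ n)))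

  C₂-mono : ∀ {m n} → m ≤ n → m C 2 ≤ n C 2
  C₂-mono {m} {n} m≤n = subst (λ k → m C 2 ≤ k C 2) (m+[n∸m]≡n m≤n) (go (n ∸ m))
    where
    go : ∀ d → m C 2 ≤ (m + d) C 2
    go zero    = ≤-reflexive (cong (_C 2) (sym (+-identityʳ m)))
    go (suc d) = ≤-trans (go d) (≤-trans (C₂-suc (m + d)) (≤-reflexive (cong (_C 2) (sym (+-suc m d)))))

  -- The edges that meet the first `s` vertices are counted by their least vertex. Each of these is
  -- charged all pairs above it, less the pairs among the top `d` vertices, which are known to be
  -- absent.
  cnt-prefix : ∀ s k d F → d ≤ k → (∀ x y z → x < s → s + k ≤ y + d → y < z → F x y z ≡ false) →
    cnt (s + k) F + s * (d C 2) ≤ s * ((s + k ∸ 1) C 2) + cnt k (shift s F)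
  cnt-prefix zero    k d F d≤k none = ≤-reflexive (+-identityʳ _)
  cnt-prefix (suc s) k d F d≤k none = begin
    cnt (suc (s + k)) F + (d C 2 + s * (d C 2))
      ≡⟨ cong (_+ (d C 2 + s * (d C 2))) (cnt-suc (s + k) F) ⟩
    t + cnt (s + k) F′ + (d C 2 + s * (d C 2))
      ≡⟨ e₁ t (cnt (s + k) F′) (d C 2) (s * (d C 2)) ⟩
    (t + d C 2) + (cnt (s + k) F′ + s * (d C 2))
      ≤⟨ +-mono-≤ first (cnt-prefix s k d F′ d≤k λ x y z x<s h y<z → none (suc x) (suc y) (suc z) (s<s x<s) (s≤s h) (s<s y<z)) ⟩
    (s + k) C 2 + (s * ((s + k ∸ 1) C 2) + cnt k (shift (suc s) F))
      ≤⟨ +-monoʳ-≤ ((s + k) C 2) (+-monoˡ-≤ _ (*-monoʳ-≤ s (C₂-mono (m∸n≤m (s + k) 1)))) ⟩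
    (s + k) C 2 + (s * ((s + k) C 2) + cnt k (shift (suc s) F))
      ≡⟨ +-assoc ((s + k) C 2) _ _ ⟨
    (s + k) C 2 + s * ((s + k) C 2) + cnt k (shift (suc s) F) ∎
    where
    open ≤-Reasoning
    F′ = shift 1 F
    d≤s+k = ≤-trans d≤k (m≤n+m k s)
    t = tri₂ (s + k) (λ y z → 𝟙 (F 0 (suc y) (suc z)))
    e₁ : ∀ t u v w → t + u + (v + w) ≡ (t + v) + (u + w)
    e₁ = solve-∀
    first : t + d C 2 ≤ (s + k) C 2
    first = ≤-trans (≤-reflexive (cong (λ v → t + v C 2) (sym (m∸[m∸n]≡n d≤s+k))))
      (pairs-below (s + k) (s + k ∸ d) (λ y z → F 0 (suc y) (suc z)) λ y z h y<z →
        none 0 (suc y) (suc z) z<s (s≤s (≤-trans (m≤n+m∸n (s + k) d) (≤-trans (≤-reflexive (+-comm d _)) (+-monoˡ-≤ d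
            h)))) (s<s y<z))

  -- In a shifted family without this edge every edge has y < M ∸ 2 or z < M ∸ 1.
  NoTop : ℕ → Fam → Set
  NoTop M F = ¬ T (F 0 (M ∸ 2) (M ∸ 1))

  ¬T⇒false : ∀ {b} → ¬ T b → b ≡ false
  ¬T⇒false {false} _ = refl
  ¬T⇒false {true}  h = ⊥-elim (h _)

  module _ (μ : ℕ) {F : Fam} (down : Down F) (noTop : NoTop (3 * suc μ) F) where
    private
      M = 3 * suc μ

    top-false : ∀ x y z → x < y → M ∸ 2 ≤ y → y < z → F x y z ≡ false
    top-false x y z x<y h y<z = ¬T⇒false λ e → noTop (down x<y y<z z≤n h
        (≤-trans (≤-reflexive M∸1) (≤-trans (s≤s h) y<z)) M∸2>0 (≤-reflexive (sym M∸1)) e)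
      where
      M≡ : M ≡ suc (suc (suc (3 * μ)))
      M≡ = *-suc 3 μ
      M∸1 : M ∸ 1 ≡ suc (M ∸ 2)
      M∸1 = trans (cong (_∸ 1) M≡) (cong suc (sym (cong (_∸ 2) M≡)))
      M∸2>0 : 0 < M ∸ 2
      M∸2>0 = ≤-trans (s≤s z≤n) (≤-reflexive (sym (cong (_∸ 2) M≡)))

    -- For a last vertex beyond M ∸ 1, the pairs with y ≥ M ∸ 1 are excluded by `NoTop`, and for all
    -- other pairs the last vertex can be lowered to M ∸ 1.
    high-degree : ∀ t → tri₂ (M ∸ 1 + t) (λ x y → 𝟙 (F x y (M ∸ 1 + t))) ≤ deg M F
    high-degree zero    = ≤-reflexive (cong (λ z → tri₂ z λ x y → 𝟙 (F x y z)) (+-identityʳ (M ∸ 1)))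
    high-degree (suc t) = begin
      tri₂ (M ∸ 1 + suc t) G
        ≡⟨ sum-split (M ∸ 1) (suc t) _ ⟩
      tri₂ (M ∸ 1) G + sum (suc t) (λ i → sum (M ∸ 1 + i) λ x → G x (M ∸ 1 + i))
        ≡⟨ cong (tri₂ (M ∸ 1) G +_) (sum-zero (suc t) λ i i<t → sum-zero (M ∸ 1 + i) λ x x<y →
             cong 𝟙 (top-false x (M ∸ 1 + i) z x<y (≤-trans (∸-monoʳ-≤ {1} {2} M (s≤s z≤n)) (m≤m+n (M ∸ 1) i))
                 (+-monoʳ-< (M ∸ 1) i<t))) ⟩
      tri₂ (M ∸ 1) G + 0
        ≡⟨ +-identityʳ _ ⟩
      tri₂ (M ∸ 1) G
        ≤⟨ tri₂-mono (M ∸ 1) (λ x y x<y y<M → 𝟙-mono (down x<y (<-≤-trans y<M (m≤m+n (M ∸ 1) (suc t))) ≤-refl ≤-refl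
            (m≤m+n (M ∸ 1) (suc t)) x<y y<M)) ⟩
      deg M F ∎
      where
      open ≤-Reasoning
      z = M ∸ 1 + suc t
      G : ℕ → ℕ → ℕ
      G x y = 𝟙 (F x y z)

    cnt-suffix : ∀ k q → M ∸ 1 ≤ k → cnt (k + q) F ≤ cnt k F + q * deg M F
    cnt-suffix k q M≤k = ≤-trans (≤-reflexive (sum-split k q _)) (+-monoʳ-≤ (cnt k F)
      (sum-≤const q (deg M F) λ i _ → subst (λ z → tri₂ z (λ x y → 𝟙 (F x y z)) ≤ deg M F)
        (trans (sym (+-assoc (M ∸ 1) _ i)) (cong (_+ i) (m+[n∸m]≡n M≤k))) (high-degree (k ∸ (M ∸ 1) + i))))

  cnt+miss : ∀ n F → cnt n F + miss n F ≡ n C 3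
  cnt+miss n F = trans (sym (tri₃-+ n _ _)) (trans (sum-cong n λ z _ → sum-cong z λ y _ → sum-cong y λ x _
      → 𝟙+𝟙not (F x y z)) (tri₃-total n))

  -- Without the edge (0 , 1 , M ∸ 1) downward closure leaves no edge with last vertex at least M ∸
  -- 1, hence at most (M ∸ 1) C 3 edges altogether.
  has-extra : ∀ n {M F} → Down F → 1 < M ∸ 1 → (M ∸ 1) C 3 < cnt n F → T (F 0 1 (M ∸ 1))
  has-extra n {M} {F} down 1<M big with F 0 1 (M ∸ 1) in eq
  ... | true  = _
  ... | false = <⇒≱ big (bound (≤-total n (M ∸ 1)))
    where
    open ≤-Reasoning
    all : ∀ n → cnt n F ≤ n C 3
    all n = ≤-trans (tri₃-mono n λ x y z _ _ _ → 𝟙≤1 (F x y z)) (≤-reflexive (tri₃-total n))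
    none : ∀ i → sum (M ∸ 1 + i) (λ y → sum y λ x → 𝟙 (F x y (M ∸ 1 + i))) ≡ 0
    none i = sum-zero (M ∸ 1 + i) λ y y<z → sum-zero y λ x x<y → cong 𝟙 (¬T⇒false λ e →
      subst T eq (down x<y y<z z≤n (≤-trans (s≤s z≤n) x<y) (m≤m+n (M ∸ 1) i) z<s 1<M e))
    bound : n ≤ M ∸ 1 ⊎ M ∸ 1 ≤ n → cnt n F ≤ (M ∸ 1) C 3
    bound (inj₁ n≤) = ≤-trans (sum-range-mono _ n≤) (all (M ∸ 1))
    bound (inj₂ ≤n) = begin
      cnt n F                        ≡⟨ cong (λ v → cnt v F) (sym (m+[n∸m]≡n ≤n)) ⟩
      cnt (M ∸ 1 + (n ∸ (M ∸ 1))) F  ≡⟨ sum-split (M ∸ 1) _ _ ⟩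
      cnt (M ∸ 1) F + sum (n ∸ (M ∸ 1)) (λ i → sum (M ∸ 1 + i) (λ y → sum y λ x → 𝟙 (F x y (M ∸ 1 + i))))
                                     ≡⟨ cong (cnt (M ∸ 1) F +_) (sum-zero (n ∸ (M ∸ 1)) λ i _ → none i) ⟩
      cnt (M ∸ 1) F + 0              ≡⟨ +-identityʳ _ ⟩
      cnt (M ∸ 1) F                  ≤⟨ all (M ∸ 1) ⟩
      (M ∸ 1) C 3                    ∎

  -- If the pair (2t , 2t + 1) is not completed by z then every pair completed by z starts below 2t.
  has-pair : ∀ {M F} t → Down F → suc (t + t) < M ∸ 1 → (t + t) * M < deg M F → T (F (t + t) (suc (t + t)) (M ∸ 1))
  has-pair {M} {F} t down lt big with F (t + t) (suc (t + t)) (M ∸ 1) in eq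
  ... | true  = _
  ... | false = <⇒≱ big (≤-trans (sum-≤const (M ∸ 1) (t + t) row) (≤-trans (*-monoˡ-≤ (t
      + t) (m∸n≤m M 1)) (≤-reflexive (*-comm M (t + t)))))
    where
    row : ∀ y → y < M ∸ 1 → sum y (λ x → 𝟙 (F x y (M ∸ 1))) ≤ t + t
    row y y<M with ≤-total y (t + t)
    ... | inj₁ y≤ = ≤-trans (sum-≤const y 1 λ x _ → 𝟙≤1 (F x y (M ∸ 1))) (≤-trans (≤-reflexive (*-identityʳ y)) y≤)
    ... | inj₂ ≤y = begin
      sum y f                                   ≡⟨ cong (λ v → sum v f) (sym (m+[n∸m]≡n ≤y)) ⟩
      sum (t + t + (y ∸ (t + t))) f             ≡⟨ sum-split (t + t) _ f ⟩
      sum (t + t) f + sum (y ∸ (t + t)) (λ i → f (t + t + i)) ≡⟨ cong (sum (t + t) f +_) (sum-zero (y ∸ (t + t)) zero′) ⟩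
      sum (t + t) f + 0                         ≡⟨ +-identityʳ _ ⟩
      sum (t + t) f                             ≤⟨ sum-≤const (t + t) 1 (λ x _ → 𝟙≤1 (F x y (M ∸ 1))) ⟩
      (t + t) * 1                               ≡⟨ *-identityʳ (t + t) ⟩
      t + t                                     ∎
      where
      open ≤-Reasoning
      f : ℕ → ℕ
      f x = 𝟙 (F x y (M ∸ 1))
      zero′ : ∀ i → i < y ∸ (t + t) → f (t + t + i) ≡ 0
      zero′ i i< = cong 𝟙 (¬T⇒false λ e → subst T eq (down x<y y<M (m≤m+n (t + t) i)
        (≤-trans (s≤s (m≤m+n (t + t) i)) x<y) ≤-refl ≤-refl lt e))
        where
        x<y : t + t + i < y
        x<y = ≤-trans (+-monoʳ-< (t + t) i<) (≤-reflexive (m+[n∸m]≡n ≤y))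

  -- The special families take the pairs (2i , 2i + 1), each completed by one of the last vertices below L + q.
  specials : ∀ {M} L q {Fs} → length Fs ≡ q → L + q ≡ M → q + q < L → All Down Fs →
    All (λ F → T (F (q + q ∸ 2) (suc (q + q ∸ 2)) (M ∸ 1))) Fs →
    ∃ λ U → RM In Fs U × (∀ {u} → u ∈ U → u < q + q ⊎ (L ≤ u × u < L + q))
  specials {M} L q {Fs} len LM q< downs es = go q Fs len ≤-refl downs es
    where
    go : ∀ r Gs → length Gs ≡ r → r ≤ q → All Down Gs → All (λ F → T (F (q + q ∸ 2) (suc (q + q ∸ 2)) (M ∸ 1))) Gs →
      ∃ λ U → RM In Gs U × (∀ {u} → u ∈ U → u < r + r ⊎ (L ≤ u × u < L + r))
    go _       []       refl _   _              _        = [] , [] , λ ()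
    go (suc r) (G ∷ Gs) leq  r≤q (down ∷ downs) (e ∷ es) with go r Gs (suc-injective leq) (<⇒≤ r≤q) downs es
    ... | U , R , where′ = _ , add ≤-refl y<z edge
          (fresh ≤-refl (<-trans (n<1+n (r + r)) (<⇒≤ 2r+1<L))) (fresh (n≤1+n (r + r)) (<⇒≤ 2r+1<L)) freshz R , place
      where
      2r+2≤ : suc (suc (r + r)) ≤ q + q
      2r+2≤ = ≤-trans (≤-reflexive (cong suc (sym (+-suc r r)))) (+-mono-≤ r≤q r≤q)
      2r+1<L : suc (suc (r + r)) < L
      2r+1<L = ≤-<-trans 2r+2≤ q<
      y<z : suc (r + r) < L + r
      y<z = <-≤-trans (<-trans (n<1+n _) 2r+1<L) (m≤m+n L r)
      2r≤ : r + r ≤ q + q ∸ 2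
      2r≤ = ∸-monoˡ-≤ 2 2r+2≤
      L+r≤ : L + r ≤ M ∸ 1
      L+r≤ = <⇒≤pred (≤-trans (+-monoʳ-< L r≤q) (≤-reflexive LM))
      edge : T (G (r + r) (suc (r + r)) (L + r))
      edge = down ≤-refl (≤-trans (≤-reflexive (m+[n∸m]≡n (≤-trans (s≤s (s≤s z≤n)) 2r+2≤)))
          (≤-trans (<⇒≤ q<) (≤-trans (m≤m+n L r) L+r≤)))
        2r≤ (s≤s 2r≤) L+r≤ ≤-refl y<z e
      fresh : ∀ {w} → r + r ≤ w → w < L → w ∉ U
      fresh r≤w w<L w∈ with where′ w∈
      ... | inj₁ lt       = <⇒≱ lt r≤w
      ... | inj₂ (ge , _) = <⇒≱ w<L ge
      freshz : L + r ∉ U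
      freshz w∈ with where′ w∈
      ... | inj₁ lt       = <⇒≱ lt (<⇒≤ (<-trans (n<1+n (r + r)) y<z))
      ... | inj₂ (_ , lt) = <-irrefl refl lt
      place : ∀ {u} → u ∈ _ → u < suc r + suc r ⊎ (L ≤ u × u < L + suc r)
      place (here refl)                 = inj₁ (s≤s (+-monoʳ-≤ r (n≤1+n r)))
      place (there (here refl))         = inj₁ (≤-reflexive (cong suc (sym (+-suc r r))))
      place (there (there (here refl))) = inj₂ (m≤m+n L r , +-monoʳ-< L (n<1+n r))
      place (there (there (there p))) with where′ p
      ... | inj₁ lt        = inj₁ (<-≤-trans lt (+-mono-≤ (n≤1+n r) (n≤1+n r)))
      ... | inj₂ (ge , lt) = inj₂ (ge , <-trans lt (+-monoʳ-< L (n<1+n r)))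

-- Polynomial inequalities behind the thresholds.

module Polynomials where

  open BlockInequalities using (certify)
  open import Data.Nat
  open import Data.Nat.Properties
  open import Data.Nat.Tactic.RingSolver using (solve-∀)
  open import Relation.Binary.PropositionalEquality

  cover-clique-poly : ∀ ν e → suc (suc (3 * ν)) * suc (3 * ν) * (3 * ν) + suc (suc (3 * ν + e + 2)) * suc (3 * ν
      + e + 2) * (3 * ν + e + 2) ≤ suc (suc (4 * ν + e + 2)) * suc (4 * ν + e + 2) * (4 * ν + e + 2)
  cover-clique-poly ν e  = certify z≤n (identity ν e)
    where
    identity : ∀ ν e → suc (suc (4 * ν + e + 2)) * suc (4 * ν + e + 2) * (4 * ν + e + 2) + 0
        ≡ suc (suc (3 * ν)) * suc (3 * ν) * (3 * ν) + suc (suc (3 * ν + e + 2)) * suc (3 * ν + e + 2) * (3 * ν + e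
        + 2) + 0 + (20 * ν + 18 * e * ν + 36 * ν * ν + 3 * e * e * ν + 21 * e * ν * ν + 10 * ν * ν * ν)
    identity = solve-∀

  first-poly : ∀ N e → suc (suc (3 * (N + 2 + e))) * suc (3 * (N + 2 + e)) * (3 * (N + 2 + e)) + 3 * (suc (3 * (N
      + 2 + e) + N + 4) * (3 * (N + 2 + e) + N + 4)) ≤ suc (suc (3 * (N + 2 + e) + 3)) * suc (3 * (N + 2 + e)
      + 3) * (3 * (N + 2 + e) + 3)
  first-poly N e  = certify z≤n (identity N e)
    where
    identity : ∀ N e → suc (suc (3 * (N + 2 + e) + 3)) * suc (3 * (N + 2 + e) + 3) * (3 * (N + 2 + e) + 3) + 0
        ≡ suc (suc (3 * (N + 2 + e))) * suc (3 * (N + 2 + e)) * (3 * (N + 2 + e)) + 3 * (suc (3 * (N + 2 + e) + N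
        + 4) * (3 * (N + 2 + e) + N + 4)) + 0 + (324 + 207 * N + 270 * e + 33 * N * N + 90 * N * e + 54 * e * e)
    identity = solve-∀

  two-poly : ∀ μ e → 2 * (3 * μ + (5 * suc μ + e) + 1) + suc (2 * μ + (5 * suc μ + e) + 1) * (2 * μ + (5 * suc μ
      + e) + 1) ≤ 2 * (suc (5 * suc μ + e + 1) * (5 * suc μ + e + 1))
  two-poly μ e  = certify z≤n (identity μ e)
    where
    identity : ∀ μ e → 2 * (suc (5 * suc μ + e + 1) * (5 * suc μ + e + 1)) + 0 ≡ 2 * (3 * μ + (5 * suc μ + e) + 1)
        + suc (2 * μ + (5 * suc μ + e) + 1) * (2 * μ + (5 * suc μ + e) + 1) + 0 + (30 + 11 * e + 23 * μ + e * e
        + 6 * e * μ + μ * μ)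
    identity = solve-∀

  batch-cover-poly : ∀ μ q w g → 40 * g ≤ (μ + q) * (μ + q) → 2 * w ≤ μ → 500 * q ≤ μ → 4 * (μ * w) ≤ μ * μ
      + 4 * (w * w) → 1000 ≤ μ → 40 * ((3 * μ + 3 * q + w) * (3 * μ + 3 * q + w)) + 40 * g + 40 * ((2 * μ + 3 * q
      + w) * (2 * μ + 3 * q + w)) + 60 * (3 * μ + q + w) ≤ 60 * ((3 * μ + q + w) * (3 * μ + q + w)) + 40 * (w * w)
  batch-cover-poly μ q w g h0 h1 h2 h3 h4 = certify (+-mono-≤ (+-mono-≤ (+-mono-≤ (+-mono-≤ (*-monoʳ-≤ 1 h0)
      (*-monoʳ-≤ (10 * μ + 200 * q + 100) h1)) (*-monoʳ-≤ (3 * μ + 2 * q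
      + 1) h2)) (*-monoʳ-≤ 5 h3)) (*-monoʳ-≤ μ h4)) (identity μ q w g)
    where
    identity : ∀ μ q w g → 60 * ((3 * μ + q + w) * (3 * μ + q + w)) + 40 * (w * w) + (1 * (40 * g) + (10 * μ
        + 200 * q + 100) * (2 * w) + (3 * μ + 2 * q + 1) * (500 * q) + 5 * (4 * (μ * w)) + μ * 1000) ≡ 40 * ((3 * μ
        + 3 * q + w) * (3 * μ + 3 * q + w)) + 40 * g + 40 * ((2 * μ + 3 * q + w) * (2 * μ + 3 * q + w))
        + 60 * (3 * μ + q + w) + (1 * ((μ + q) * (μ + q)) + (10 * μ + 200 * q + 100) * μ + (3 * μ + 2 * q + 1) * μ
        + 5 * (μ * μ + 4 * (w * w)) + μ * μ) + (440 * q + 140 * w + 719 * μ + 339 * q * q + 40 * q * w + 456 * q * μ)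
    identity = solve-∀

  batch-clique-poly : ∀ μ q w g → 40 * g ≤ (μ + q) * (μ + q) → 2 * w ≤ μ → 500 * q ≤ μ → 1000 ≤ μ → 40 * ((3 * μ
      + 3 * q + w) * (3 * μ + 3 * q + w)) + 40 * g + 60 * (9 * μ) ≤ 60 * (9 * (μ * μ))
  batch-clique-poly μ q w g h0 h1 h2 h3 = certify (+-mono-≤ (+-mono-≤ (+-mono-≤ (*-monoʳ-≤ 1 h0) (*-monoʳ-≤ (20 * w
      + 130 * μ + 120 * q) h1)) (*-monoʳ-≤ (3 * μ + 2 * q + 1) h2)) (*-monoʳ-≤ μ h3)) (identity μ q w g)
    where
    identity : ∀ μ q w g → 60 * (9 * (μ * μ)) + (1 * (40 * g) + (20 * w + 130 * μ + 120 * q) * (2 * w) + (3 * μ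
        + 2 * q + 1) * (500 * q) + μ * 1000) ≡ 40 * ((3 * μ + 3 * q + w) * (3 * μ + 3 * q + w)) + 40 * g
        + 60 * (9 * μ) + (1 * ((μ + q) * (μ + q)) + (20 * w + 130 * μ + 120 * q) * μ + (3 * μ + 2 * q + 1) * μ
        + μ * μ) + (500 * q + 459 * μ + 639 * q * q + 656 * q * μ + 45 * μ * μ)
    identity = solve-∀

  -- Eliminating `x` from the first two hypotheses leaves hmg ≤ 450hm² + m³, because 0.49 is less
  -- than the cost factor 1/2 per pair. The lower bound on `g` then makes the left side cubic.
  fat-poly : ∀ m N g x h s → 50 * h * (m * g) ≤ 100 * h * x + m * m * m → 2 * x ≤ 9 * (m * m) + 2 * (N * g)
      → 100 * N ≤ 49 * m → m * m ≤ s * g → h * (m * m * m) ≤ 450 * h * s * (m * m) + s * (m * m * m)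
  fat-poly m N g x h s h0 h1 h2 h3 = certify (+-mono-≤ (+-mono-≤ (+-mono-≤ (*-monoʳ-≤ s h0) (*-monoʳ-≤ (50 * h * s)
      h1)) (*-monoʳ-≤ (h * s * g) h2)) (*-monoʳ-≤ (h * m) h3)) (identity m N g x h s)
    where
    identity : ∀ m N g x h s → 450 * h * s * (m * m) + s * (m * m * m) + (s * (50 * h * (m * g))
        + 50 * h * s * (2 * x) + h * s * g * (100 * N) + h * m * (m * m)) ≡ h * (m * m * m) + (s * (100 * h * x
        + m * m * m) + 50 * h * s * (9 * (m * m) + 2 * (N * g)) + h * s * g * (49 * m) + h * m * (s * g)) + 0
    identity = solve-∀

  -- With n = 3m + N, r = 2m + N and ν = N/m, n³ - r³ - 27m³ is (15ν + 3ν² - 8)m³. For 2N ≤ m the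
  -- gain 6Ng is at most 3mg, which the missing triples pay up to 0.06 m³. So 15ν + 3ν² ≤ 8.06 +
  -- O(1/m), and t/u is a lower bound for ν.
  gap-poly-low : ∀ m N g x t u → 50 * (m * g) ≤ 100 * x + m * m * m → (3 * m + N) * (3 * m + N) * (3 * m + N)
      + 6 * x ≤ 27 * (m * m * m) + 6 * (N * g) + (2 * m + N) * (2 * m + N) * (2 * m + N) + 3 * ((3 * m
      + N) * (3 * m + N)) → t * m ≤ u * N → 2 * N ≤ m → 100 * (15 * (t * u) + 3 * (t * t)) * (m * m * m)
      ≤ 806 * (u * u) * (m * m * m) + 300 * (u * u) * ((3 * m + N) * (3 * m + N))
  gap-poly-low m N g x t u h0 h1 h2 h3 = certify (+-mono-≤ (+-mono-≤ (+-mono-≤ (*-monoʳ-≤ (6 * u * u) h0) (*-monoʳ-≤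
      (100 * u * u) h1)) (*-monoʳ-≤ (1500 * u * m * m + 300 * u * m * N
      + 300 * t * m * m) h2)) (*-monoʳ-≤ (300 * u * u * g) h3)) (identity m N g x t u)
    where
    identity : ∀ m N g x t u → 806 * (u * u) * (m * m * m) + 300 * (u * u) * ((3 * m + N) * (3 * m + N))
        + (6 * u * u * (50 * (m * g)) + 100 * u * u * ((3 * m + N) * (3 * m + N) * (3 * m + N) + 6 * x)
        + (1500 * u * m * m + 300 * u * m * N + 300 * t * m * m) * (t * m) + 300 * u * u * g * (2 * N))
        ≡ 100 * (15 * (t * u) + 3 * (t * t)) * (m * m * m) + (6 * u * u * (100 * x + m * m * m)
        + 100 * u * u * (27 * (m * m * m) + 6 * (N * g) + (2 * m + N) * (2 * m + N) * (2 * m + N) + 3 * ((3 * m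
        + N) * (3 * m + N))) + (1500 * u * m * m + 300 * u * m * N + 300 * t * m * m) * (u * N)
        + 300 * u * u * g * m) + 0
    identity = solve-∀

  -- Beyond N = m/2 completed pairs do pay, so their number must be capped. With 2N = m + v the
  -- threshold side grows by 9vm² + 0.75v²m, while g ≤ 3.01 m² limits the gain to 9.03vm². The
  -- remaining 0.03vm² is absorbed through (m - 6v)² ≥ 0, the last hypothesis.
  gap-poly-high : ∀ m N g x v → 50 * (m * g) ≤ 100 * x + m * m * m → (3 * m + N) * (3 * m + N) * (3 * m + N)
      + 6 * x ≤ 27 * (m * m * m) + 6 * (N * g) + (2 * m + N) * (2 * m + N) * (2 * m + N) + 3 * ((3 * m
      + N) * (3 * m + N)) → 2 * N ≤ m + v → 100 * g ≤ 301 * (m * m) → m + v ≤ 2 * N → 12 * (v * m) ≤ m * m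
      + 36 * (v * v) → 75 * (m * m * m) ≤ 1200 * ((3 * m + N) * (3 * m + N))
  gap-poly-high m N g x v h0 h1 h2 h3 h4 h5 = certify (+-mono-≤ (+-mono-≤ (+-mono-≤ (+-mono-≤ (+-mono-≤ (*-monoʳ-≤ 24
      h0) (*-monoʳ-≤ 400 h1)) (*-monoʳ-≤ (1200 * g) h2)) (*-monoʳ-≤ (12 * v) h3)) (*-monoʳ-≤ (3000 * m * m
      + 600 * m * N + 300 * m * (m + v)) h4)) (*-monoʳ-≤ m h5)) (identity m N g x v)
    where
    identity : ∀ m N g x v → 1200 * ((3 * m + N) * (3 * m + N)) + (24 * (50 * (m * g)) + 400 * ((3 * m
        + N) * (3 * m + N) * (3 * m + N) + 6 * x) + 1200 * g * (2 * N) + 12 * v * (100 * g) + (3000 * m * m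
        + 600 * m * N + 300 * m * (m + v)) * (m + v) + m * (12 * (v * m))) ≡ 75 * (m * m * m) + (24 * (100 * x
        + m * m * m) + 400 * (27 * (m * m * m) + 6 * (N * g) + (2 * m + N) * (2 * m + N) * (2 * m + N)
        + 3 * ((3 * m + N) * (3 * m + N))) + 1200 * g * (m + v) + 12 * v * (301 * (m * m)) + (3000 * m * m
        + 600 * m * N + 300 * m * (m + v)) * (2 * N) + m * (m * m + 36 * (v * v))) + 264 * m * v * v
    identity = solve-∀

-- How the edge hypothesis passes to smaller parameters.

module Thresholds where

  open Sums
  open Moves using (C₂-mono)
  open BlockInequalities using (certify)
  open Polynomials
  open import Data.Nat
  open import Data.Nat.Properties
  open import Data.Nat.Combinatorics using (_C_)
  open import Data.Nat.Tactic.RingSolver using (solve-∀)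
  open import Data.Product using (_×_; _,_)
  open import Data.Sum using (inj₁; inj₂)
  open import Relation.Binary.PropositionalEquality

  -- More than f (3m + N) m 3 edges, with the subtraction moved to the other side.
  Big : ℕ → ℕ → ℕ → Set
  Big m N x = (3 * m + N) C 3 < x + (2 * m + N + 1) C 3 × (3 * m ∸ 1) C 3 < x

  sq₂ : ∀ n → 2 * (n C 2) + n ≡ n * n
  sq₂ zero    = refl
  sq₂ (suc n) = trans (cong (_+ suc n) (2C₂ n)) (trans (cong (_+ suc n) (*-comm (suc n) n)) (+-comm (n * suc n) (suc n)))

  2C₂≤sq : ∀ n → 2 * (n C 2) ≤ n * n
  2C₂≤sq n = ≤-trans (m≤m+n _ n) (≤-reflexive (sq₂ n))

  cube₃ : ∀ n → 6 * (n C 3) + 3 * (n * n) ≡ n * n * n + 2 * n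
  cube₃ zero          = refl
  cube₃ (suc zero)    = refl
  cube₃ (suc (suc n)) = trans (cong (_+ 3 * (suc (suc n) * suc (suc n))) (6C₃ n)) (lem n)
    where
    lem : ∀ n → suc (suc n) * suc n * n + 3 * (suc (suc n) * suc (suc n)) ≡ suc (suc n) * suc (suc n) * suc (suc n)
        + 2 * suc (suc n)
    lem = solve-∀

  cube₃′ : ∀ s → 6 * (suc s C 3) + s ≡ s * s * s
  cube₃′ zero    = refl
  cube₃′ (suc s) = trans (cong (_+ suc s) (6C₃ s)) (lem s)
    where
    lem : ∀ s → suc (suc s) * suc s * s + suc s ≡ suc s * suc s * suc s
    lem = solve-∀

  6C : ∀ {n} k → n ≡ suc (suc k) → 6 * (n C 3) ≡ suc (suc k) * suc k * k
  6C k refl = 6C₃ k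

  C₃-grow : ∀ a s → a C 3 + s * (a C 2) ≤ (a + s) C 3
  C₃-grow a zero    = ≤-reflexive (trans (+-identityʳ _) (cong (_C 3) (sym (+-identityʳ a))))
  C₃-grow a (suc s) = begin
    a C 3 + (a C 2 + s * (a C 2))   ≡⟨ lem (a C 3) (a C 2) (s * (a C 2)) ⟩
    a C 2 + (a C 3 + s * (a C 2))   ≤⟨ +-mono-≤ (C₂-mono (m≤m+n a s)) (C₃-grow a s) ⟩
    (a + s) C 2 + (a + s) C 3       ≡⟨ Pascal₃ (a + s) ⟨
    suc (a + s) C 3                 ≡⟨ cong (_C 3) (+-suc a s) ⟨
    (a + suc s) C 3                 ∎
    where
    open ≤-Reasoning
    lem : ∀ x y z → x + (y + z) ≡ y + (x + z)
    lem = solve-∀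

  C₃-grow′ : ∀ a s e → a + s ≤ suc e → (a + s) C 3 ≤ a C 3 + s * (e C 2)
  C₃-grow′ a zero    e le = ≤-reflexive (trans (cong (_C 3) (+-identityʳ a)) (sym (+-identityʳ _)))
  C₃-grow′ a (suc s) e le = begin
    (a + suc s) C 3                 ≡⟨ cong (_C 3) (+-suc a s) ⟩
    suc (a + s) C 3                 ≡⟨ Pascal₃ (a + s) ⟩
    (a + s) C 2 + (a + s) C 3       ≤⟨ +-mono-≤ (C₂-mono as≤e) (C₃-grow′ a s e (≤-trans as≤e (n≤1+n e))) ⟩
    e C 2 + (a C 3 + s * (e C 2))   ≡⟨ lem (a C 3) (e C 2) (s * (e C 2)) ⟩
    a C 3 + (e C 2 + s * (e C 2))   ∎
    where
    open ≤-Reasoning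
    as≤e : a + s ≤ e
    as≤e = s≤s⁻¹ (≤-trans (≤-reflexive (sym (+-suc a s))) le)
    lem : ∀ x y z → y + (x + z) ≡ x + (y + z)
    lem = solve-∀

  -- From N ≥ m on the cover term of `f` is the larger one, so that only the cover hypothesis has to
  -- be carried along.
  cover-clique : ∀ ν N → suc ν ≤ N → (3 * suc ν ∸ 1) C 3 + (2 * suc ν + N + 1) C 3 ≤ (3 * suc ν + N) C 3
  cover-clique ν N h with m≤n⇒∃[o]m+o≡n h
  ... | e , refl = *-cancelˡ-≤ 6 (begin
      6 * ((3 * suc ν ∸ 1) C 3 + (2 * suc ν + (suc ν + e) + 1) C 3)
        ≡⟨ *-distribˡ-+ 6 ((3 * suc ν ∸ 1) C 3) ((2 * suc ν + (suc ν + e) + 1) C 3) ⟩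
      6 * ((3 * suc ν ∸ 1) C 3) + 6 * ((2 * suc ν + (suc ν + e) + 1) C 3)
        ≡⟨ cong₂ _+_ (6C (3 * ν) (cong (_∸ 1) (*-suc 3 ν))) (6C (3 * ν + e + 2) (e₁ ν e)) ⟩
      suc (suc (3 * ν)) * suc (3 * ν) * (3 * ν) + suc (suc (3 * ν + e + 2)) * suc (3 * ν + e + 2) * (3 * ν + e + 2)
        ≤⟨ cover-clique-poly ν e ⟩
      suc (suc (4 * ν + e + 2)) * suc (4 * ν + e + 2) * (4 * ν + e + 2)
        ≡⟨ 6C (4 * ν + e + 2) (e₂ ν e) ⟨
      6 * ((3 * suc ν + (suc ν + e)) C 3) ∎)
    where
    open ≤-Reasoning
    e₁ : ∀ ν e → 2 * suc ν + (suc ν + e) + 1 ≡ suc (suc (3 * ν + e + 2))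
    e₁ = solve-∀
    e₂ : ∀ ν e → 3 * suc ν + (suc ν + e) ≡ suc (suc (4 * ν + e + 2))
    e₂ = solve-∀

  clique-from-cover : ∀ ν N x → suc ν ≤ N → (3 * suc ν + N) C 3 < x + (2 * suc ν + N + 1) C 3 → (3 * suc ν ∸ 1) C 3 < x
  clique-from-cover ν N x h cov = +-cancelʳ-< ((2 * suc ν + N + 1) C 3) _ _ (≤-<-trans (cover-clique ν N h) cov)

  -- With one vertex and one family removed, n - m + 1 is unchanged, so the cover threshold drops by
  -- exactly the number of pairs that may be lost. The clique threshold drops by at least as much
  -- when N + 2 < m - 1; otherwise it follows from the cover hypothesis.
  big-first : ∀ ν N x x′ → Big (suc (suc ν)) N x → x ≤ (3 * suc ν + (N + 2)) C 2 + x′ → Big (suc ν) (N + 2) x′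
  big-first ν N x x′ (cov , clq) x≤ = cov′ , clq′
    where
    open ≤-Reasoning
    n′ = 3 * suc ν + (N + 2)
    e₁ : ∀ ν N → 3 * suc (suc ν) + N ≡ suc (3 * suc ν + (N + 2))
    e₁ = solve-∀
    e₂ : ∀ ν N → 2 * suc (suc ν) + N + 1 ≡ 2 * suc ν + (N + 2) + 1
    e₂ = solve-∀
    cov′ : n′ C 3 < x′ + (2 * suc ν + (N + 2) + 1) C 3
    cov′ = +-cancelˡ-< (n′ C 2) _ _ (begin-strict
      n′ C 2 + n′ C 3                                   ≡⟨ trans (cong (_C 3) (e₁ ν N)) (Pascal₃ n′) ⟨
      (3 * suc (suc ν) + N) C 3                         <⟨ cov ⟩
      x + (2 * suc (suc ν) + N + 1) C 3                 ≤⟨ +-mono-≤ x≤ (≤-reflexive (cong (_C 3) (e₂ ν N))) ⟩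
      n′ C 2 + x′ + (2 * suc ν + (N + 2) + 1) C 3       ≡⟨ +-assoc (n′ C 2) x′ _ ⟩
      n′ C 2 + (x′ + (2 * suc ν + (N + 2) + 1) C 3)     ∎)
    clq′ : (3 * suc ν ∸ 1) C 3 < x′
    clq′ with ≤-<-connex (suc ν) (N + 2)
    ... | inj₁ h = clique-from-cover ν (N + 2) x′ h cov′
    ... | inj₂ h with m≤n⇒∃[o]m+o≡n (s≤s⁻¹ h)
    ...   | e , refl = +-cancelˡ-< (n′ C 2) _ _ (≤-<-trans poly (<-≤-trans clq x≤))
      where
      p = 3 * (N + 2 + e) + N + 4
      e₃ : ∀ N e → 3 * suc (N + 2 + e) + (N + 2) ≡ suc (3 * (N + 2 + e) + N + 4)
      e₃ = solve-∀
      e₄ : ∀ ν → 3 * suc (suc ν) ≡ suc (suc (suc (3 * ν + 3)))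
      e₄ = solve-∀
      poly : n′ C 2 + (3 * suc (N + 2 + e) ∸ 1) C 3 ≤ (3 * suc (suc (N + 2 + e)) ∸ 1) C 3
      poly = *-cancelˡ-≤ 6 (begin
        6 * (n′ C 2 + (3 * suc (N + 2 + e) ∸ 1) C 3)
          ≡⟨ trans (*-distribˡ-+ 6 (n′ C 2) ((3 * suc (N + 2 + e) ∸ 1) C 3)) (+-comm (6 * (n′ C 2)) _) ⟩
        6 * ((3 * suc (N + 2 + e) ∸ 1) C 3) + 6 * (n′ C 2)
          ≡⟨ cong₂ _+_ (6C (3 * (N + 2 + e)) (cong (_∸ 1) (*-suc 3 (N + 2 + e))))
               (trans (*-assoc 3 2 (n′ C 2)) (cong (3 *_) (trans (cong (λ v → 2 * (v C 2)) (e₃ N e)) (2C₂ p)))) ⟩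
        suc (suc (3 * (N + 2 + e))) * suc (3 * (N + 2 + e)) * (3 * (N + 2 + e)) + 3 * (suc p * p)
          ≤⟨ first-poly N e ⟩
        suc (suc (3 * (N + 2 + e) + 3)) * suc (3 * (N + 2 + e) + 3) * (3 * (N + 2 + e) + 3)
          ≡⟨ 6C (3 * (N + 2 + e) + 3) (cong (_∸ 1) (e₄ (N + 2 + e))) ⟨
        6 * ((3 * suc (suc (N + 2 + e)) ∸ 1) C 3) ∎)

  -- Two vertices are removed for only one family, so the naive loss exceeds the drop of the cover
  -- threshold by k + (r + 1) C 2. The pairs of high vertices absent by `NoTop` compensate for this
  -- as soon as N ≥ 5m.
  big-two : ∀ ν N x x′ → 5 * suc (suc ν) ≤ N → Big (suc (suc ν)) N x →
    x + 2 * ((N + 2) C 2) ≤ 2 * ((2 + (3 * suc ν + (N + 1)) ∸ 1) C 2) + x′ → Big (suc ν) (N + 1) x′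
  big-two ν N x x′ h (cov , _) x≤ = cov′ , clique-from-cover ν (N + 1) x′ (≤-trans ν≤ (m≤m+n N 1)) cov′
    where
    open ≤-Reasoning
    ν≤ : suc ν ≤ N
    ν≤ = ≤-trans (n≤1+n (suc ν)) (≤-trans (m≤m+n (suc (suc ν)) (4 * suc (suc ν))) h)
    k = 3 * suc ν + (N + 1)
    r = 2 * suc ν + (N + 1)
    D = (N + 2) C 2
    e₁ : ∀ ν N → 3 * suc (suc ν) + N ≡ suc (suc (3 * suc ν + (N + 1)))
    e₁ = solve-∀
    e₂ : ∀ ν N → 2 * suc (suc ν) + N + 1 ≡ suc (2 * suc ν + (N + 1) + 1)
    e₂ = solve-∀
    poly : k + (r + 1) C 2 ≤ 2 * D
    poly with m≤n⇒∃[o]m+o≡n h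
    ... | e , refl = *-cancelˡ-≤ 2 (begin
        2 * (k + (r + 1) C 2)                                          ≡⟨ *-distribˡ-+ 2 k ((r + 1) C 2) ⟩
        2 * k + 2 * ((r + 1) C 2)                                      ≡⟨ cong₂ _+_ (cong (2 *_) (e₅ ν N)) (trans
            (cong (λ v → 2 * (v C 2)) (e₃ ν N)) (2C₂ (2 * suc ν + N + 1))) ⟩
        2 * (3 * suc ν + N + 1) + suc (2 * suc ν + N + 1) * (2 * suc ν + N + 1) ≤⟨ two-poly (suc ν) e ⟩
        2 * (suc (N + 1) * (N + 1))                                    ≡⟨ cong (2 *_) (trans (sym (2C₂ (N
            + 1))) (cong (λ v → 2 * (v C 2)) (e₄ N))) ⟩
        2 * (2 * D)                                                    ∎)
      where
      e₃ : ∀ ν N → 2 * suc ν + (N + 1) + 1 ≡ suc (2 * suc ν + N + 1)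
      e₃ = solve-∀
      e₄ : ∀ N → suc (N + 1) ≡ N + 2
      e₄ = solve-∀
      e₅ : ∀ ν N → 3 * suc ν + (N + 1) ≡ 3 * suc ν + N + 1
      e₅ = solve-∀
    A = k C 2
    B = k C 3
    E = (r + 1) C 2
    G = (r + 1) C 3
    cov′ : B < x′ + G
    cov′ = +-cancelʳ-< (2 * (k + A) + 2 * D) _ _ (begin-strict
      B + (2 * (k + A) + 2 * D)               ≡⟨ s₁ B k A D ⟩
      k + A + (A + B) + (k + 2 * D)            ≡⟨ cong (_+ (k
          + 2 * D)) (trans (cong₂ _+_ (sym (Pascal₂ k)) (sym (Pascal₃ k))) (sym (Pascal₃ (suc k)))) ⟩
      suc (suc k) C 3 + (k + 2 * D)            ≡⟨ cong (λ v → v C 3 + (k + 2 * D)) (e₁ ν N) ⟨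
      (3 * suc (suc ν) + N) C 3 + (k + 2 * D)  <⟨ +-monoˡ-< (k + 2 * D) cov ⟩
      x + (2 * suc (suc ν) + N + 1) C 3 + (k + 2 * D) ≡⟨ cong (λ v → x + v + (k
          + 2 * D)) (trans (cong (_C 3) (e₂ ν N)) (Pascal₃ (r + 1))) ⟩
      x + (E + G) + (k + 2 * D)                ≡⟨ s₂ x E G k D ⟩
      (x + 2 * D) + (k + E) + G                ≤⟨ +-monoˡ-≤ G (+-mono-≤ x≤ poly) ⟩
      (2 * (suc k C 2) + x′) + 2 * D + G       ≡⟨ cong (λ v → 2 * v + x′ + 2 * D + G) (Pascal₂ k) ⟩
      (2 * (k + A) + x′) + 2 * D + G           ≡⟨ s₃ (2 * (k + A)) x′ D G ⟩
      x′ + G + (2 * (k + A) + 2 * D)           ∎)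
      where
      s₁ : ∀ B k A D → B + (2 * (k + A) + 2 * D) ≡ k + A + (A + B) + (k + 2 * D)
      s₁ = solve-∀
      s₂ : ∀ x E G k D → x + (E + G) + (k + 2 * D) ≡ (x + 2 * D) + (k + E) + G
      s₂ = solve-∀
      s₃ : ∀ a x D G → (a + x) + 2 * D + G ≡ x + G + (a + 2 * D)
      s₃ = solve-∀

  -- Removing `q` families with 2q bottom and q top vertices leaves N = q + w unchanged. Per family
  -- at most 2A + g - 2B edges are lost: bottom vertices cost `A` each, less the `B` absent high
  -- pairs, and a top vertex costs `g`. `cover-rate` and `clique-rate` compare this with the drop of
  -- the two thresholds, which is where thinness is used.
  module Batch (q w ν : ℕ) (g : ℕ) (thin : 40 * g ≤ (suc ν + q) * (suc ν + q)) (2w≤ : 2 * w ≤ suc ν) (500q≤ : 500 * q ≤ suc ν) (1000≤ : 1000 ≤ suc ν) where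
    private
      open ≤-Reasoning
      μ = suc ν
      N = q + w
      k = 3 * μ + N
      s = q + q
      A = (s + k ∸ 1) C 2
      B = (w + 2) C 2
      e = 2 * (q + μ) + N

      A≤ : 2 * A ≤ (3 * μ + 3 * q + w) * (3 * μ + 3 * q + w)
      A≤ = ≤-trans (2C₂≤sq (s + k ∸ 1)) (*-mono-≤ le le)
        where
        e₁ : ∀ q μ w → q + q + (3 * μ + (q + w)) ≡ 3 * μ + 3 * q + w
        e₁ = solve-∀
        le : s + k ∸ 1 ≤ 3 * μ + 3 * q + w
        le = ≤-trans (m∸n≤m (s + k) 1) (≤-reflexive (e₁ q μ w))

      B≥ : w * w ≤ 2 * B
      B≥ = ≤-trans (certify {A = 0} {B = 0} z≤n (lem w)) (≤-reflexive (trans (sym (2C₂ (w + 1))) (cong (λ v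
          → 2 * (v C 2)) (e₁ w))))
        where
        lem : ∀ w → suc (w + 1) * (w + 1) + 0 ≡ w * w + 0 + (3 * w + 2)
        lem = solve-∀
        e₁ : ∀ w → suc (w + 1) ≡ w + 2
        e₁ = solve-∀

      amgm : ∀ a b → 4 * (a * b) ≤ a * a + 4 * (b * b)
      amgm a b with ≤-total a (2 * b)
      ... | inj₁ p with m≤n⇒∃[o]m+o≡n p
      ...   | o , eq = certify {A = 0} {B = 0} {rest = o * o} z≤n (trans (l₁ a b) (trans (cong (λ v → a * a
          + v * v) (sym eq)) (trans (l₂ a o) (cong (λ v → v + 0 + o * o) (trans (cong (λ v
          → 2 * (a * v)) eq) (l₃ a b))))))
        where
        l₃ : ∀ a b → 2 * (a * (2 * b)) ≡ 4 * (a * b)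
        l₃ = solve-∀
        l₁ : ∀ a b → a * a + 4 * (b * b) + 0 ≡ a * a + 2 * b * (2 * b)
        l₁ = solve-∀
        l₂ : ∀ a o → a * a + (a + o) * (a + o) ≡ 2 * (a * (a + o)) + 0 + o * o
        l₂ = solve-∀
      amgm a b | inj₂ p with m≤n⇒∃[o]m+o≡n p
      ...   | o , refl = certify {A = 0} {B = 0} z≤n (lem b o)
        where
        lem : ∀ b o → (2 * b + o) * (2 * b + o) + 4 * (b * b) + 0 ≡ 4 * ((2 * b + o) * b) + 0 + o * o
        lem = solve-∀

      cover-rate : 2 * A + g + 2 * (e C 2) ≤ 3 * (k C 2) + 2 * B
      cover-rate = *-cancelˡ-≤ 40 (+-cancelʳ-≤ (60 * k) _ _ (begin
        40 * (2 * A + g + 2 * (e C 2)) + 60 * k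
          ≡⟨ s₁ A g (e C 2) k ⟩
        40 * (2 * A) + 40 * g + 40 * (2 * (e C 2)) + 60 * k
          ≤⟨ +-monoˡ-≤ (60 * k) (+-mono-≤ (+-monoˡ-≤ (40 * g) (*-monoʳ-≤ 40 A≤)) (*-monoʳ-≤ 40 (≤-trans (2C₂≤sq e)
              (≤-reflexive (cong (λ v → v * v) (e₁ q μ w)))))) ⟩
        40 * ((3 * μ + 3 * q + w) * (3 * μ + 3 * q + w)) + 40 * g + 40 * ((2 * μ + 3 * q + w) * (2 * μ + 3 * q + w)) + 60 * k
          ≡⟨ cong (λ v → 40 * ((3 * μ + 3 * q + w) * (3 * μ + 3 * q + w)) + 40 * g + 40 * ((2 * μ + 3 * q
              + w) * (2 * μ + 3 * q + w)) + 60 * v) k≡ ⟩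
        40 * ((3 * μ + 3 * q + w) * (3 * μ + 3 * q + w)) + 40 * g + 40 * ((2 * μ + 3 * q + w) * (2 * μ + 3 * q
            + w)) + 60 * (3 * μ + q + w)
          ≤⟨ batch-cover-poly μ q w g thin 2w≤ 500q≤ (amgm μ w) 1000≤ ⟩
        60 * ((3 * μ + q + w) * (3 * μ + q + w)) + 40 * (w * w)
          ≡⟨ cong (λ v → 60 * (v * v) + 40 * (w * w)) k≡ ⟨
        60 * (k * k) + 40 * (w * w)
          ≤⟨ +-monoʳ-≤ (60 * (k * k)) (*-monoʳ-≤ 40 B≥) ⟩
        60 * (k * k) + 40 * (2 * B)
          ≡⟨ cong (λ v → 60 * v + 40 * (2 * B)) (sq₂ k) ⟨
        60 * (2 * (k C 2) + k) + 40 * (2 * B)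
          ≡⟨ s₂ (k C 2) k B ⟩
        40 * (3 * (k C 2) + 2 * B) + 60 * k ∎))
        where
        k≡ : k ≡ 3 * μ + q + w
        k≡ = sym (+-assoc (3 * μ) q w)
        e₁ : ∀ q μ w → 2 * (q + μ) + (q + w) ≡ 2 * μ + 3 * q + w
        e₁ = solve-∀
        s₁ : ∀ A g E k → 40 * (2 * A + g + 2 * E) + 60 * k ≡ 40 * (2 * A) + 40 * g + 40 * (2 * E) + 60 * k
        s₁ = solve-∀
        s₂ : ∀ K k B → 60 * (2 * K + k) + 40 * (2 * B) ≡ 40 * (3 * K + 2 * B) + 60 * k
        s₂ = solve-∀

      clique-rate : 2 * A + g ≤ 3 * ((3 * μ ∸ 1) C 2)
      clique-rate = *-cancelˡ-≤ 40 (+-cancelʳ-≤ (60 * (9 * μ)) _ _ (begin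
        40 * (2 * A + g) + 60 * (9 * μ)
          ≡⟨ cong (_+ 60 * (9 * μ)) (*-distribˡ-+ 40 (2 * A) g) ⟩
        40 * (2 * A) + 40 * g + 60 * (9 * μ)
          ≤⟨ +-monoˡ-≤ (60 * (9 * μ)) (+-monoˡ-≤ (40 * g) (*-monoʳ-≤ 40 A≤)) ⟩
        40 * ((3 * μ + 3 * q + w) * (3 * μ + 3 * q + w)) + 40 * g + 60 * (9 * μ)
          ≤⟨ batch-clique-poly μ q w g thin 2w≤ 500q≤ 1000≤ ⟩
        60 * (9 * (μ * μ))
          ≤⟨ m≤m+n _ 120 ⟩
        60 * (9 * (μ * μ)) + 120
          ≡⟨ s₁ ν ⟩
        60 * (suc (3 * ν + 1) * (3 * ν + 1)) + 60 * (9 * μ)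
          ≡⟨ cong (λ v → 60 * v + 60 * (9 * μ)) (trans (sym (2C₂ (3 * ν + 1))) (cong (λ v → 2 * (v C 2)) (sym 3μ∸1))) ⟩
        60 * (2 * ((3 * μ ∸ 1) C 2)) + 60 * (9 * μ)
          ≡⟨ cong (_+ 60 * (9 * μ)) (s₂ ((3 * μ ∸ 1) C 2)) ⟩
        40 * (3 * ((3 * μ ∸ 1) C 2)) + 60 * (9 * μ) ∎))
        where
        3μ∸1 : 3 * μ ∸ 1 ≡ suc (3 * ν + 1)
        3μ∸1 = trans (cong (_∸ 1) (*-suc 3 ν)) (cong suc (+-comm 1 (3 * ν)))
        s₁ : ∀ ν → 60 * (9 * (suc ν * suc ν)) + 120 ≡ 60 * (suc (3 * ν + 1) * (3 * ν + 1)) + 60 * (9 * suc ν)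
        s₁ = solve-∀
        s₂ : ∀ v → 60 * (2 * v) ≡ 40 * (3 * v)
        s₂ = solve-∀

    big-batch : ∀ x y x′ → Big (q + μ) N x → x ≤ y + q * g → y + s * B ≤ s * A + x′ → Big μ N x′
    big-batch x y x′ (cov , clq) x≤ y≤ = cov′ , clq′
      where
      x-bound : x + s * B ≤ s * A + x′ + q * g
      x-bound = begin
        x + s * B             ≤⟨ +-monoˡ-≤ (s * B) x≤ ⟩
        y + q * g + s * B     ≡⟨ t₁ y (q * g) (s * B) ⟩
        y + s * B + q * g     ≤⟨ +-monoˡ-≤ (q * g) y≤ ⟩
        s * A + x′ + q * g    ∎
        where
        t₁ : ∀ a b c → a + b + c ≡ a + c + b
        t₁ = solve-∀
      cov′ : k C 3 < x′ + (2 * μ + N + 1) C 3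
      cov′ = +-cancelʳ-< (q * (3 * (k C 2) + 2 * B)) _ _ (begin-strict
        k C 3 + q * (3 * (k C 2) + 2 * B)                      ≡⟨ t₁ (k C 3) q (k C 2) B ⟩
        k C 3 + 3 * q * (k C 2) + s * B                        ≤⟨ +-monoˡ-≤ (s * B) (C₃-grow k (3 * q)) ⟩
        (k + 3 * q) C 3 + s * B                                ≡⟨ cong (λ v → v C 3 + s * B) (t₂ q μ N) ⟩
        (3 * (q + μ) + N) C 3 + s * B                          <⟨ +-monoˡ-< (s * B) cov ⟩
        x + (2 * (q + μ) + N + 1) C 3 + s * B                  ≤⟨ +-monoˡ-≤ (s * B) (+-monoʳ-≤ x (≤-trans
            (≤-reflexive (cong (_C 3) (t₃ q μ N))) (C₃-grow′ (2 * μ + N + 1) (2 * q) e (≤-reflexive (t₄ q μ N))))) ⟩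
        x + ((2 * μ + N + 1) C 3 + 2 * q * (e C 2)) + s * B    ≡⟨ t₅ x ((2 * μ + N + 1) C 3) (2 * q * (e C 2)) (s * B) ⟩
        (x + s * B) + (2 * μ + N + 1) C 3 + 2 * q * (e C 2)    ≤⟨ +-monoˡ-≤ (2 * q * (e C 2)) (+-monoˡ-≤ ((2 * μ
            + N + 1) C 3) x-bound) ⟩
        (s * A + x′ + q * g) + (2 * μ + N + 1) C 3 + 2 * q * (e C 2) ≡⟨ t₆ q A x′ g ((2 * μ + N + 1) C 3) (e C 2) ⟩
        x′ + (2 * μ + N + 1) C 3 + q * (2 * A + g + 2 * (e C 2)) ≤⟨ +-monoʳ-≤ (x′ + (2 * μ + N
            + 1) C 3) (*-monoʳ-≤ q cover-rate) ⟩
        x′ + (2 * μ + N + 1) C 3 + q * (3 * (k C 2) + 2 * B)   ∎)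
        where
        t₁ : ∀ a q b B → a + q * (3 * b + 2 * B) ≡ a + 3 * q * b + (q + q) * B
        t₁ = solve-∀
        t₂ : ∀ q μ N → 3 * μ + N + 3 * q ≡ 3 * (q + μ) + N
        t₂ = solve-∀
        t₃ : ∀ q μ N → 2 * (q + μ) + N + 1 ≡ 2 * μ + N + 1 + 2 * q
        t₃ = solve-∀
        t₄ : ∀ q μ N → 2 * μ + N + 1 + 2 * q ≡ suc (2 * (q + μ) + N)
        t₄ = solve-∀
        t₅ : ∀ a b c d → a + (b + c) + d ≡ (a + d) + b + c
        t₅ = solve-∀
        t₆ : ∀ q A x g c E → ((q + q) * A + x + q * g) + c + 2 * q * E ≡ x + c + q * (2 * A + g + 2 * E)
        t₆ = solve-∀
      clq′ : (3 * μ ∸ 1) C 3 < x′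
      clq′ = +-cancelʳ-< (q * (3 * ((3 * μ ∸ 1) C 2))) _ _ (begin-strict
        (3 * μ ∸ 1) C 3 + q * (3 * ((3 * μ ∸ 1) C 2))      ≡⟨ t₁ ((3 * μ ∸ 1) C 3) q ((3 * μ ∸ 1) C 2) ⟩
        (3 * μ ∸ 1) C 3 + 3 * q * ((3 * μ ∸ 1) C 2)        ≤⟨ C₃-grow (3 * μ ∸ 1) (3 * q) ⟩
        (3 * μ ∸ 1 + 3 * q) C 3                            ≡⟨ cong (_C 3) t₂ ⟩
        (3 * (q + μ) ∸ 1) C 3                              <⟨ clq ⟩
        x                                                  ≤⟨ m≤m+n x (s * B) ⟩
        x + s * B                                          ≤⟨ x-bound ⟩
        s * A + x′ + q * g                                 ≡⟨ t₃ q A x′ g ⟩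
        x′ + q * (2 * A + g)                               ≤⟨ +-monoʳ-≤ x′ (*-monoʳ-≤ q clique-rate) ⟩
        x′ + q * (3 * ((3 * μ ∸ 1) C 2))                   ∎)
        where
        t₁ : ∀ a q b → a + q * (3 * b) ≡ a + 3 * q * b
        t₁ = solve-∀
        t₂ : 3 * μ ∸ 1 + 3 * q ≡ 3 * (q + μ) ∸ 1
        t₂ = trans (cong (λ v → v ∸ 1 + 3 * q) (*-suc 3 ν)) (sym (cong (_∸ 1) (t₄ q ν)))
          where
          t₄ : ∀ q ν → 3 * (q + suc ν) ≡ suc (suc (suc (3 * ν + 3 * q)))
          t₄ = solve-∀
        t₃ : ∀ q A x g → (q + q) * A + x + q * g ≡ x + q * (2 * A + g)
        t₃ = solve-∀

  widen-poly : ∀ N p → 10 * N + 9 ≤ p → suc (suc (3 * p + N + 2)) * suc (3 * p + N + 2) * (3 * p + N + 2)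
      ≤ suc (suc (3 * p)) * suc (3 * p) * (3 * p) + suc (suc (2 * p + N + 2)) * suc (2 * p + N + 2) * (2 * p + N + 2)
  widen-poly N p h0 = certify (*-monoʳ-≤ (3 * p * p + 3 * p + p * N) h0) (identity N p)
    where
    identity : ∀ N p → suc (suc (3 * p)) * suc (3 * p) * (3 * p) + suc (suc (2 * p + N + 2)) * suc (2 * p + N
        + 2) * (2 * p + N + 2) + (3 * p * p + 3 * p + p * N) * (10 * N + 9) ≡ suc (suc (3 * p + N
        + 2)) * suc (3 * p + N + 2) * (3 * p + N + 2) + (3 * p * p + 3 * p + p * N) * p + (7 * p + 21 * N * p
        + 6 * p * p + 7 * N * N * p + 14 * N * p * p + 5 * p * p * p)
    identity = solve-∀

  -- Below the threshold the clique dominates, so N may be increased to about m / 10.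
  big-widen : ∀ N r x x′ → (3 * (10 * suc N + r) ∸ 1) C 3 < x → x ≤ x′ → Big (10 * suc N + r) (suc N) x′
  big-widen N r x x′ clq x≤x′ = cov , <-≤-trans clq x≤x′
    where
    open ≤-Reasoning
    p = 10 * N + 9 + r
    e₁ : ∀ N r → 3 * (10 * suc N + r) + suc N ≡ suc (suc (3 * (10 * N + 9 + r) + N + 2))
    e₁ = solve-∀
    e₂ : ∀ N r → 2 * (10 * suc N + r) + suc N + 1 ≡ suc (suc (2 * (10 * N + 9 + r) + N + 2))
    e₂ = solve-∀
    e₃ : ∀ N r → 3 * (10 * suc N + r) ≡ suc (suc (suc (3 * (10 * N + 9 + r))))
    e₃ = solve-∀
    Q = (3 * (10 * suc N + r) ∸ 1) C 3
    G = (2 * (10 * suc N + r) + suc N + 1) C 3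
    cov : (3 * (10 * suc N + r) + suc N) C 3 < x′ + G
    cov = ≤-<-trans (*-cancelˡ-≤ 6 (begin
        6 * ((3 * (10 * suc N + r) + suc N) C 3)   ≡⟨ 6C (3 * p + N + 2) (e₁ N r) ⟩
        suc (suc (3 * p + N + 2)) * suc (3 * p + N + 2) * (3 * p + N + 2)  ≤⟨ widen-poly N p (m≤m+n (10 * N + 9) r) ⟩
        suc (suc (3 * p)) * suc (3 * p) * (3 * p) + suc (suc (2 * p + N + 2)) * suc (2 * p + N + 2) * (2 * p + N + 2)
          ≡⟨ cong₂ _+_ (6C (3 * p) (cong (_∸ 1) (e₃ N r))) (6C (2 * p + N + 2) (e₂ N r)) ⟨
        6 * Q + 6 * G                              ≡⟨ *-distribˡ-+ 6 Q G ⟨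
        6 * (Q + G)                                ∎))
      (+-monoˡ-< G (<-≤-trans clq x≤x′))

-- Stuck families against the edge hypothesis.

module Regions where

  open Sums
  open Families
  open Moves
  open Polynomials
  open Thresholds
  open import Data.Nat
  open import Data.Nat.Properties
  open import Data.Nat.Combinatorics using (_C_)
  open import Data.Nat.Tactic.RingSolver using (solve-∀)
  open import Data.Product using (_×_; _,_; proj₁; proj₂)
  open import Data.Sum using (inj₁; inj₂)
  open import Data.Empty using (⊥)
  open import Relation.Nullary using (¬_)
  open import Relation.Binary.PropositionalEquality

  -- Each region thus needs a comparison of leading coefficients only: quadratic errors disappear
  -- once `m` is above a constant.
  cubic-absurd : ∀ {A B E} D m → A * (m * m * m) ≤ B * (m * m * m) + E * (m * m) → A ≡ B + D → E < D * m → 0 < m → ⊥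
  cubic-absurd {B = B} D m@(suc _) h refl lt _ = <⇒≱ (*-monoˡ-< (m * m) lt) (≤-trans (≤-reflexive (lem D m))
    (+-cancelˡ-≤ (B * (m * m * m)) _ _ (≤-trans (≤-reflexive (sym (*-distribʳ-+ (m * m * m) B D))) h)))
    where
    lem : ∀ D m → D * m * (m * m) ≡ D * (m * m * m)
    lem = solve-∀

  12vm≤ : ∀ m v → 12 * (v * m) ≤ m * m + 36 * (v * v)
  12vm≤ m v with ≤-total m (6 * v)
  ... | inj₁ p with m≤n⇒∃[o]m+o≡n p
  ...   | o , eq = ≤-trans (≤-trans (≤-reflexive (trans (l₁ v m) (cong (λ u
      → 2 * u * m) (sym eq)))) (≤-trans (m≤m+n _ (o * o)) (≤-reflexive (l₂ m o))))
                     (≤-reflexive (trans (cong (λ u → m * m + u * u) eq) (l₃ m v)))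
    where
    l₁ : ∀ v m → 12 * (v * m) ≡ 2 * (6 * v) * m
    l₁ = solve-∀
    l₂ : ∀ m o → 2 * (m + o) * m + o * o ≡ m * m + (m + o) * (m + o)
    l₂ = solve-∀
    l₃ : ∀ m v → m * m + 6 * v * (6 * v) ≡ m * m + 36 * (v * v)
    l₃ = solve-∀
  12vm≤ m v | inj₂ p with m≤n⇒∃[o]m+o≡n p
  ...   | o , refl = ≤-trans (m≤m+n _ (o * o)) (≤-reflexive (lem v o))
    where
    lem : ∀ v o → 12 * (v * (6 * v + o)) + o * o ≡ (6 * v + o) * (6 * v + o) + 36 * (v * v)
    lem = solve-∀

  module Heavy (m N g x m₀ : ℕ) (m₀≤m : m₀ ≤ m) (0<m : 0 < m)
    (clique-side : 2 * x ≤ 9 * (m * m) + 2 * (N * g)) where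

    private
      n = 3 * m + N
      r = 2 * m + N

    -- At `h` = 100, the value used, these are the two conditions that `heavy-ok` asks to refute.
    Stuck : ℕ → Set
    Stuck h = 50 * h * (m * g) ≤ 100 * h * x + m * m * m × 100 * h * g ≤ (301 * h) * (m * m)

    private
      coarse : ∀ h .{{_ : NonZero h}} → 50 * h * (m * g) ≤ 100 * h * x + m * m * m → 50 * (m * g) ≤ 100 * x + m * m * m
      coarse h@(suc k) p = *-cancelˡ-≤ h (begin
        h * (50 * (m * g))                          ≡⟨ l₁ h (m * g) ⟩
        50 * h * (m * g)                            ≤⟨ p ⟩
        100 * h * x + m * m * m                     ≤⟨ +-monoʳ-≤ (100 * h * x) (m≤m+n (m * m * m) (k * (m * m * m))) ⟩
        100 * h * x + h * (m * m * m)               ≡⟨ l₂ h x (m * m * m) ⟩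
        h * (100 * x + m * m * m)                   ∎)
        where
        open ≤-Reasoning
        l₁ : ∀ h y → h * (50 * y) ≡ 50 * h * y
        l₁ = solve-∀
        l₂ : ∀ h x z → 100 * h * x + h * z ≡ h * (100 * x + z)
        l₂ = solve-∀

      coarse′ : ∀ h .{{_ : NonZero h}} → 100 * h * g ≤ 301 * h * (m * m) → 100 * g ≤ 301 * (m * m)
      coarse′ h p = *-cancelˡ-≤ h (≤-trans (≤-reflexive (l₁ h g)) (≤-trans p (≤-reflexive (sym (l₂ h (m * m))))))
        where
        l₁ : ∀ h y → h * (100 * y) ≡ 100 * h * y
        l₁ = solve-∀
        l₂ : ∀ h y → h * (301 * y) ≡ 301 * h * y
        l₂ = solve-∀

      finish : ∀ {A B K} D → N ≤ 5 * m → A * (m * m * m) ≤ B * (m * m * m) + K * (n * n) → A ≡ B + D → K * 64 < D * m₀ → ⊥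
      finish {A} {B} {K} D N≤ p eq lt = cubic-absurd {A} {B} {K * 64} D m
        (≤-trans p (+-monoʳ-≤ (B * (m * m * m)) (≤-trans (*-monoʳ-≤ K (≤-trans (*-mono-≤ n≤ n≤) (≤-reflexive (lem
            m)))) (≤-reflexive (sym (*-assoc K 64 (m * m)))))))
        eq (<-≤-trans lt (*-monoʳ-≤ D m₀≤m)) 0<m
        where
        n≤ : n ≤ 8 * m
        n≤ = ≤-trans (+-monoʳ-≤ (3 * m) N≤) (≤-reflexive (sym (*-distribʳ-+ m 3 5)))
        lem : ∀ m → 8 * m * (8 * m) ≡ 64 * (m * m)
        lem = solve-∀

    fat-cond : ∀ h s D → h ≡ s + D → 450 * h * s < D * m₀ → 100 * N ≤ 49 * m → m * m ≤ s * g → ¬ Stuck h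
    fat-cond h s D eq lt N≤ fat (p , _) = cubic-absurd {h} {s} {450 * h * s} D m
      (≤-trans (fat-poly m N g x h s p clique-side N≤ fat) (≤-reflexive (+-comm (450 * h * s * (m * m)) (s * (m * m * m)))))
      eq (<-≤-trans lt (*-monoʳ-≤ D m₀≤m)) 0<m

    module _ (cover-side : n * n * n + 6 * x ≤ 27 * (m * m * m) + 6 * (N * g) + r * r * r + 3 * (n * n)) where

      gap-cond : ∀ h .{{_ : NonZero h}} t u D → 100 * (15 * (t * u) + 3 * (t * t)) ≡ 806 * (u * u) + D
          → 300 * (u * u) * 64 < D * m₀ →
        1200 * 64 < 75 * m₀ → t * m ≤ u * N → N ≤ 5 * m → ¬ Stuck h
      gap-cond h t u D eq lt lt′ N≥ N≤ (p , p′) with ≤-total (2 * N) m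
      ... | inj₁ low = finish {100 * (15 * (t * u) + 3 * (t * t))} {806 * (u * u)} {300 * (u * u)} D N≤
        (gap-poly-low m N g x t u (coarse h p) cover-side N≥ low) eq lt
      ... | inj₂ high with m≤n⇒∃[o]m+o≡n high
      ...   | v , veq = finish {75} {0} {1200} 75 N≤
        (≤-trans (gap-poly-high m N g x v (coarse h p) cover-side (≤-reflexive (sym veq)) (coarse′ h p′) (≤-reflexive
            veq) (12vm≤ m v))
          (m≤n+m (1200 * (n * n)) (0 * (m * m * m)))) refl lt′

  module Region (μ N : ℕ) (F : Fam) (down : Down F) (noTop : NoTop (3 * suc μ) F)
    (big : Big (suc μ) N (cnt (3 * suc μ + N) F)) where

    private
      open ≤-Reasoning
      m = suc μ
      M = 3 * m
      g = deg M F
      x = miss M F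
      n = 3 * m + N
      r = 2 * m + N

      -- This is the trade-off of the proof: each of the N vertices from 3m on is the last vertex of
      -- at most `g` edges, and `x` triples are missing below.
      count : cnt n F + x ≤ M C 3 + N * g
      count = begin
        cnt n F + x                ≤⟨ +-monoˡ-≤ x (cnt-suffix μ down noTop M N (m∸n≤m M 1)) ⟩
        cnt M F + N * g + x        ≡⟨ lem (cnt M F) (N * g) x ⟩
        cnt M F + x + N * g        ≡⟨ cong (_+ N * g) (cnt+miss M F) ⟩
        M C 3 + N * g              ∎
        where
        lem : ∀ a b c → a + b + c ≡ a + c + b
        lem = solve-∀

      M≡ : M ≡ suc (M ∸ 1)
      M≡ = trans (*-suc 3 μ) (cong suc (sym (cong (_∸ 1) (*-suc 3 μ))))

    clique-side : 2 * x ≤ 9 * (m * m) + 2 * (N * g)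
    clique-side = begin
      2 * x                                ≤⟨ *-monoʳ-≤ 2 x≤ ⟩
      2 * ((M ∸ 1) C 2 + N * g)            ≡⟨ *-distribˡ-+ 2 ((M ∸ 1) C 2) (N * g) ⟩
      2 * ((M ∸ 1) C 2) + 2 * (N * g)      ≤⟨ +-monoˡ-≤ (2 * (N * g)) (≤-trans (*-monoʳ-≤ 2 (C₂-mono (m∸n≤m M 1))) (2C₂≤sq M)) ⟩
      M * M + 2 * (N * g)                  ≡⟨ cong (_+ 2 * (N * g)) (lem m) ⟩
      9 * (m * m) + 2 * (N * g)            ∎
      where
      lem : ∀ m → 3 * m * (3 * m) ≡ 9 * (m * m)
      lem = solve-∀
      lem₂ : ∀ a b c → a + b + c ≡ b + (a + c)
      lem₂ = solve-∀
      x≤ : x ≤ (M ∸ 1) C 2 + N * g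
      x≤ = +-cancelˡ-≤ ((M ∸ 1) C 3) _ _ (begin
        (M ∸ 1) C 3 + x                    ≤⟨ +-monoˡ-≤ x (<⇒≤ (proj₂ big)) ⟩
        cnt n F + x                        ≤⟨ count ⟩
        M C 3 + N * g                      ≡⟨ cong (_+ N * g) (trans (cong (_C 3) M≡) (Pascal₃ (M ∸ 1))) ⟩
        (M ∸ 1) C 2 + (M ∸ 1) C 3 + N * g  ≡⟨ lem₂ ((M ∸ 1) C 2) ((M ∸ 1) C 3) (N * g) ⟩
        (M ∸ 1) C 3 + ((M ∸ 1) C 2 + N * g) ∎)

    cover-side : n * n * n + 6 * x ≤ 27 * (m * m * m) + 6 * (N * g) + r * r * r + 3 * (n * n)
    cover-side = begin
      n * n * n + 6 * x
        ≤⟨ +-monoˡ-≤ (6 * x) (≤-trans (m≤m+n (n * n * n) (2 * n)) (≤-reflexive (sym (cube₃ n)))) ⟩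
      6 * (n C 3) + 3 * (n * n) + 6 * x
        ≡⟨ l₁ (n C 3) (3 * (n * n)) x ⟩
      6 * (n C 3 + x) + 3 * (n * n)
        ≤⟨ +-monoˡ-≤ (3 * (n * n)) (*-monoʳ-≤ 6 (begin
             n C 3 + x                              ≤⟨ +-monoˡ-≤ x (<⇒≤ (proj₁ big)) ⟩
             cnt n F + (r + 1) C 3 + x              ≡⟨ l₂ (cnt n F) ((r + 1) C 3) x ⟩
             cnt n F + x + (r + 1) C 3              ≤⟨ +-monoˡ-≤ ((r + 1) C 3) count ⟩
             M C 3 + N * g + (r + 1) C 3            ∎)) ⟩
      6 * (M C 3 + N * g + (r + 1) C 3) + 3 * (n * n)
        ≡⟨ cong (_+ 3 * (n * n)) (l₃ (M C 3) (N * g) ((r + 1) C 3)) ⟩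
      6 * (M C 3) + 6 * (N * g) + 6 * ((r + 1) C 3) + 3 * (n * n)
        ≤⟨ +-monoˡ-≤ (3 * (n * n)) (+-mono-≤ (+-monoˡ-≤ (6 * (N * g)) M-bound) r-bound) ⟩
      27 * (m * m * m) + 6 * (N * g) + r * r * r + 3 * (n * n) ∎
      where
      l₁ : ∀ a b c → 6 * a + b + 6 * c ≡ 6 * (a + c) + b
      l₁ = solve-∀
      l₂ : ∀ a b c → a + b + c ≡ a + c + b
      l₂ = solve-∀
      l₃ : ∀ a b c → 6 * (a + b + c) ≡ 6 * a + 6 * b + 6 * c
      l₃ = solve-∀
      l₄ : ∀ m → 3 * m * (3 * m) * (3 * m) ≡ 27 * (m * m * m)
      l₄ = solve-∀
      r-bound : 6 * ((r + 1) C 3) ≤ r * r * r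
      r-bound = ≤-trans (≤-reflexive (cong (λ v → 6 * (v C 3)) (+-comm r 1))) (≤-trans (m≤m+n _ r) (≤-reflexive (cube₃′ r)))
      M-bound : 6 * (M C 3) ≤ 27 * (m * m * m)
      M-bound = ≤-trans (+-cancelʳ-≤ (3 * (M * M)) _ _ (≤-trans (≤-reflexive (cube₃ M))
        (+-monoʳ-≤ (M * M * M) (*-mono-≤ {2} {3} (s≤s (s≤s z≤n)) (m≤m*n M M))))) (≤-reflexive (l₄ m))

    light-cond : 2 * N ≤ m → 2 * x ≤ m * g + 9 * (m * m)
    light-cond 2N≤m = ≤-trans clique-side (≤-trans (≤-reflexive (+-comm (9 * (m * m)) _))
      (+-monoˡ-≤ (9 * (m * m)) (≤-trans (≤-reflexive (sym (*-assoc 2 N g))) (*-monoˡ-≤ g 2N≤m))))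

-- Block sizes, rates and constants of the greedy choice.

module NibbleParameters where

  open Families
  open Selection using (Selects)
  open Quota
  open Matchings
  open Nibble
  open Moves
  open Thresholds
  open Regions
  open import Data.Nat
  open import Data.Nat.Properties
  open import Data.Nat.DivMod using (_/_; _%_; m≡m%n+[m/n]*n; m%n<n)
  open import Data.Nat.Tactic.RingSolver using (solve-∀)
  open import Data.List using (List; []; _∷_; length)
  open import Data.List.Relation.Unary.All using (All; []; _∷_)
  import Data.List.Relation.Unary.All as All
  open import Data.Product using (∃; _×_; _,_; ∃₂)
  open import Data.Sum using (_⊎_; inj₁; inj₂)
  open import Relation.Nullary using (Dec; yes; no; ¬_)
  open import Relation.Binary.PropositionalEquality

  find : ∀ {P : Fam → Set} → (∀ F → Dec (P F)) → ∀ Cs → (∃₂ λ F Rest → Split (F ∷ []) Rest Cs × P F) ⊎ All (λ F → ¬ P F) Cs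
  find P? []       = inj₂ []
  find P? (F ∷ Cs) with P? F
  ... | yes p = inj₁ (F , Cs , F ∷ˡ allʳ Cs , p)
  ... | no ¬p with find P? Cs
  ...   | inj₁ (G , Rest , sp , p) = inj₁ (G , F ∷ Rest , F ∷ʳ sp , p)
  ...   | inj₂ none                = inj₂ (¬p ∷ none)

  -- The capacity cD(b+1) is at least 3Dm - D(b+1), where D(b+1) ≤ m/2 because D is small against
  -- `c`. The targets leave a slack of m, and r² ≤ mW with 4W < m keeps the excess below m/2.
  roomy : ∀ c D b m s r W → 0 < m → 0 < b → s + m ≤ 3 * D * m → 12 * D ≤ c → suc c * b < 3 * m → 3 * m ≤ suc c * b + suc c →
    4 * W < m → r * r ≤ m * W → r + s < c * D * suc b
  roomy c D b m s r W 0<m 0<b s+m≤ 12D≤c fits M≤ W<m r²≤ = ≰⇒> λ full → <-irrefl refl (<-≤-trans tight (m²≤ full))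
    where
    open ≤-Reasoning
    4Db≤m : 4 * (D * b) ≤ m
    4Db≤m = *-cancelˡ-≤ 3 (begin
      3 * (4 * (D * b))       ≡⟨ l₁ D b ⟩
      12 * D * b              ≤⟨ *-monoˡ-≤ b (≤-trans 12D≤c (n≤1+n c)) ⟩
      suc c * b               ≤⟨ <⇒≤ fits ⟩
      3 * m                   ∎)
      where
      l₁ : ∀ D b → 3 * (4 * (D * b)) ≡ 12 * D * b
      l₁ = solve-∀
    2D≤m : 2 * (D * suc b) ≤ m
    2D≤m = begin
      2 * (D * suc b)         ≤⟨ *-monoʳ-≤ 2 (*-monoʳ-≤ D (+-monoˡ-≤ b 0<b)) ⟩
      2 * (D * (b + b))       ≡⟨ l₁ D b ⟩
      4 * (D * b)             ≤⟨ 4Db≤m ⟩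
      m                       ∎
      where
      l₁ : ∀ D b → 2 * (D * (b + b)) ≡ 4 * (D * b)
      l₁ = solve-∀
    m²≤ : c * D * suc b ≤ r + s → m * m ≤ 4 * (r * r)
    m²≤ full = ≤-trans (*-mono-≤ p p) (≤-reflexive (l₁ r))
      where
      l₁ : ∀ r → 2 * r * (2 * r) ≡ 4 * (r * r)
      l₁ = solve-∀
      l₂ : ∀ c D b → D * (suc c * b) ≡ c * D * b + D * b
      l₂ = solve-∀
      l₃ : ∀ r s d → r + s + d ≡ s + (r + d)
      l₃ = solve-∀
      l₄ : ∀ D m → 3 * D * m ≡ D * (3 * m)
      l₄ = solve-∀
      m≤ : m ≤ r + D * suc b
      m≤ = +-cancelˡ-≤ s _ _ (begin
        s + m                             ≤⟨ s+m≤ ⟩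
        3 * D * m                         ≡⟨ l₄ D m ⟩
        D * (3 * m)                       ≤⟨ *-monoʳ-≤ D (≤-trans M≤ (≤-reflexive (trans (+-comm (suc c * b) (suc c))
            (sym (*-suc (suc c) b))))) ⟩
        D * (suc c * suc b)               ≡⟨ l₂ c D (suc b) ⟩
        c * D * suc b + D * suc b         ≤⟨ +-monoˡ-≤ (D * suc b) full ⟩
        r + s + D * suc b                 ≡⟨ l₃ r s (D * suc b) ⟩
        s + (r + D * suc b)               ∎)
      p : m ≤ 2 * r
      p = +-cancelʳ-≤ m _ _ (begin
        m + m                             ≡⟨ cong (m +_) (+-identityʳ m) ⟨
        2 * m                             ≤⟨ *-monoʳ-≤ 2 m≤ ⟩
        2 * (r + D * suc b)               ≡⟨ *-distribˡ-+ 2 r (D * suc b) ⟩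
        2 * r + 2 * (D * suc b)           ≤⟨ +-monoʳ-≤ (2 * r) 2D≤m ⟩
        2 * r + m                         ∎)
    tight : 4 * (r * r) < m * m
    tight = begin-strict
      4 * (r * r)                         ≤⟨ *-monoʳ-≤ 4 r²≤ ⟩
      4 * (m * W)                         ≡⟨ l₁ m W ⟩
      m * (4 * W)                         <⟨ *-monoʳ-< m ⦃ >-nonZero 0<m ⦄ W<m ⟩
      m * m                               ∎
      where
      l₁ : ∀ m w → 4 * (m * w) ≡ m * (4 * w)
      l₁ = solve-∀

  -- A fat family gains k against the balanced rate 3D and a thin one loses 1, so a proportion of 2/k fat
  -- families pays for everything; k/D, D/c and the reciprocal of m₀ are negligible one after the other.
  record Constants : Set where
    field
      c D k a m₀ : ℕ
      c≥     : 1000000 ≤ c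
      a+k    : a + k ≡ 3 * D
      k≤a    : 157500 * k ≤ a
      0<a    : 0 < a
      27A<c  : 27 * (3 * D + 1) < c
      2000≤k : 2000 ≤ k
      12D≤c  : 12 * D ≤ c
      W<m₀   : 4 * (9 * (c * D * (c * D)) + c * ((3 * D + 1) * (3 * D + 1))) < m₀
      wide₀  : suc c * (suc c * suc (suc c)) < m₀
      fat₀   : 450 * 100 * 40 < 60 * m₀
      gap₀   : 300 * (100 * 100) * 64 < 10300 * m₀
      gap₁   : 1200 * 64 < 75 * m₀
      2000≤m₀ : 2000 ≤ m₀

  module Parameters (constants : Constants) where
    open Constants constants

    A = 3 * D + 1

    a≤A : a ≤ A
    a≤A = ≤-trans (m≤m+n a k) (≤-trans (≤-reflexive a+k) (m≤m+n (3 * D) 1))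

    module Nibbling (m : ℕ) (m₀≤m : m₀ ≤ m) where
      private
        open ≤-Reasoning
        M = 3 * m

        0<m : 0 < m
        0<m = <-≤-trans (≤-trans z<s 2000≤m₀) m₀≤m

        1≤M : 1 ≤ M
        1≤M = ≤-trans 0<m (m≤m+n m _)

        -- Dividing M ∸ 1 instead of `M` keeps the blocks strictly below `M`, so that the vertex M ∸
        -- 1 which completes the pairs lies after all of them.
        b = (M ∸ 1) / suc c

        division : M ∸ 1 ≡ (M ∸ 1) % suc c + b * suc c
        division = m≡m%n+[m/n]*n (M ∸ 1) (suc c)

        fits : suc c * b < M
        fits = begin-strict
          suc c * b                        ≡⟨ *-comm (suc c) b ⟩
          b * suc c                        ≤⟨ m≤n+m (b * suc c) ((M ∸ 1) % suc c) ⟩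
          (M ∸ 1) % suc c + b * suc c      ≡⟨ division ⟨
          M ∸ 1                            <⟨ ∸-monoʳ-< (s≤s z≤n) 1≤M ⟩
          M                                ∎

        M≤ : M ≤ suc c * b + suc c
        M≤ = begin
          M                                     ≡⟨ m+[n∸m]≡n 1≤M ⟨
          suc (M ∸ 1)                           ≡⟨ cong suc division ⟩
          suc ((M ∸ 1) % suc c) + b * suc c     ≤⟨ +-monoˡ-≤ (b * suc c) (m%n<n (M ∸ 1) (suc c)) ⟩
          suc c + b * suc c                     ≡⟨ trans (cong (suc c +_) (*-comm b (suc c))) (+-comm (suc c) (suc c * b)) ⟩
          suc c * b + suc c                     ∎

        wide : suc c * suc (suc c) ≤ b
        wide = ≮⇒≥ λ b< → <-irrefl refl (begin-strict
          M                                     ≤⟨ M≤ ⟩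
          suc c * b + suc c                     ≡⟨ trans (+-comm (suc c * b) (suc c)) (sym (*-suc (suc c) b)) ⟩
          suc c * suc b                         ≤⟨ *-monoʳ-≤ (suc c) b< ⟩
          suc c * (suc c * suc (suc c))         <⟨ wide₀ ⟩
          m₀                                    ≤⟨ m₀≤m ⟩
          m                                     ≤⟨ m≤m+n m _ ⟩
          M                                     ∎)

      heavy-sel : ∀ {F} → Down F → ¬ (50 * 100 * (m * deg M F) ≤ 100 * 100 * miss M F
          + m * m * m × 100 * 100 * deg M F ≤ 301 * 100 * (m * m)) →
        Selects F M c b D a
      heavy-sel {F} down = Quotas.heavy-ok F down m c b D wide fits M≤ c≥ a k a+k k≤a 0<a

      light-sel : ∀ {F} → Down F → 2 * miss M F ≤ m * deg M F + 9 * (m * m) → Selects F M c b D A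
      light-sel {F} down = Quotas.light-ok F down m c b D wide fits M≤ c≥ A ≤-refl 27A<c

      open Process M c b D A

      rates : ∀ {As Bs Cs} → Split As Bs Cs → All (λ F → Selects F M c b D a) As → All (λ F → Selects F M c b D A) Bs →
        ∃ λ s → Rates Cs s × s + k * length As ≡ 3 * D * length Cs + length Bs
      rates []       []       []       = 0 , [] , trans (*-zeroʳ k) (sym (trans (+-identityʳ _) (*-zeroʳ (3 * D))))
      rates {F ∷ As} {Bs} {_ ∷ Cs} (F ∷ˡ sp) (p ∷ ps) qs with rates sp ps qs
      ... | s , R , eq = a + s , (a≤A , p) ∷ R , (begin-equality
          a + s + k * suc (length As)                  ≡⟨ l₁ a s k (length As) ⟩
          (a + k) + (s + k * length As)                ≡⟨ cong₂ _+_ a+k eq ⟩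
          3 * D + (3 * D * length Cs + length Bs)      ≡⟨ l₂ (3 * D) (length Cs) (length Bs) ⟩
          3 * D * suc (length Cs) + length Bs          ∎)
        where
        l₁ : ∀ a s k n → a + s + k * suc n ≡ (a + k) + (s + k * n)
        l₁ = solve-∀
        l₂ : ∀ d n b → d + (d * n + b) ≡ d * suc n + b
        l₂ = solve-∀
      rates {As} {F ∷ Bs} {_ ∷ Cs} (F ∷ʳ sp) ps (q ∷ qs) with rates sp ps qs
      ... | s , R , eq = A + s , (≤-refl , q) ∷ R , (begin-equality
          3 * D + 1 + s + k * length As                ≡⟨ +-assoc (3 * D + 1) s _ ⟩
          3 * D + 1 + (s + k * length As)              ≡⟨ cong (3 * D + 1 +_) eq ⟩
          3 * D + 1 + (3 * D * length Cs + length Bs)  ≡⟨ l₂ (3 * D) (length Cs) (length Bs) ⟩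
          3 * D * suc (length Cs) + suc (length Bs)    ∎)
        where
        l₂ : ∀ d n b → d + 1 + (d * n + b) ≡ d * suc n + suc b
        l₂ = solve-∀

      private
        slow : ∀ s p q → s + k * p ≡ 3 * D * m + q → q + m ≤ k * p → s + m ≤ 3 * D * m
        slow s p q eq enough = +-cancelʳ-≤ q _ _ (begin
          s + m + q       ≡⟨ trans (+-assoc s m q) (cong (s +_) (+-comm m q)) ⟩
          s + (q + m)     ≤⟨ +-monoʳ-≤ s enough ⟩
          s + k * p       ≡⟨ eq ⟩
          3 * D * m + q   ∎)

        W<m : 4 * W < m
        W<m = <-≤-trans W<m₀ m₀≤m

        room : ∀ s r → s + m ≤ 3 * D * m → r * r ≤ m * W → r + s < c * D * suc b
        room s r s+m≤ h = roomy c D b m s r W 0<m (<-≤-trans z<s wide) s+m≤ 12D≤c fits M≤ W<m h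

      nibbled : ∀ {As Bs Fs} → length Fs ≡ m → Split As Bs Fs → All (λ F → Selects F M c b D a) As → All (λ F
          → Selects F M c b D A) Bs →
        length Bs + m ≤ k * length As → Solvable Fs
      nibbled {As} {Bs} {Fs} len sp ps qs enough =
        let s , R , eq = rates sp ps qs
            s+m≤       = slow s (length As) (length Bs) (subst (λ v → s + k * length As ≡ 3 * D * v + length Bs) len eq) enough
            U , RU     = nibble R (λ r h → room s r s+m≤ (subst (λ v → r * r ≤ v * W) len h))
            V , RV , _ = compress (subst (λ v → RM (Dom (3 * v)) Fs U) (sym len) RU)
        in V , RV

-- The individual reduction steps.

module Reductions where

  open Sums
  open Families
  open Matchings
  open Moves
  open Thresholds
  open import Data.Bool using (T)
  open import Data.Nat
  open import Data.Nat.Properties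
  open import Data.Nat.DivMod using (_/_; _%_; m≡m%n+[m/n]*n; m%n<n)
  open import Data.Nat.Combinatorics using (_C_)
  open import Data.Nat.Tactic.RingSolver using (solve-∀)
  open import Data.List using (List; []; _∷_; length; map)
  open import Data.List.Properties using (length-map)
  open import Data.List.Relation.Unary.Any using (here; there)
  open import Data.List.Relation.Unary.All using (All; []; _∷_)
  import Data.List.Relation.Unary.All as All
  import Data.List.Relation.Unary.All.Properties as Allₚ
  open import Data.List.Membership.Propositional using (_∈_)
  open import Data.Product using (_×_; _,_; proj₂)
  open import Data.Sum using (_⊎_; inj₁; inj₂)
  open import Data.Empty using (⊥-elim)
  open import Relation.Binary.PropositionalEquality

  Rich : ℕ → ℕ → Fam → Set
  Rich m N F = Big m N (cnt (3 * m + N) F)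

  Claim : ℕ → ℕ → Set
  Claim m N = ∀ Fs → length Fs ≡ m → All Down Fs → All (Rich m N) Fs → Solvable Fs

  3*suc∸1 : ∀ μ → 3 * suc μ ∸ 1 ≡ suc (suc (3 * μ))
  3*suc∸1 μ = cong (_∸ 1) (*-suc 3 μ)

  3*suc∸2 : ∀ μ → 3 * suc μ ∸ 2 ≡ suc (3 * μ)
  3*suc∸2 μ = cong (_∸ 2) (*-suc 3 μ)

  shifted-claim : ∀ s m N {Rest} → length Rest ≡ m → All Down Rest → All (λ F → Rich m N (shift s F)) Rest → Claim m N →
    Solvable (map (shift s) Rest)
  shifted-claim s m N {Rest} len downs rich claim = claim (map (shift s) Rest) (trans (length-map (shift s) Rest) len)
    (Allₚ.map⁺ (All.map (λ {F} → shift-Down s {F}) downs)) (Allₚ.map⁺ rich)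

  zip-down : ∀ {P Q : Fam → Set} → (∀ F → Down F → P F → Q F) → ∀ {Fs} → All Down Fs → All P Fs → All Q Fs
  zip-down f []              []       = []
  zip-down f (_∷_ {F} d ds) (p ∷ ps) = f F d p ∷ zip-down f ds ps

  zip : ∀ {P Q : Fam → Set} {Fs} → All P Fs → All Q Fs → All (λ F → P F × Q F) Fs
  zip []       []       = []
  zip (p ∷ ps) (q ∷ qs) = (p , q) ∷ zip ps qs

  solve-[] : ∀ Fs → length Fs ≡ 0 → Solvable Fs
  solve-[] [] _ = [] , []

  -- After compression the other families live on [1 , 3m ∸ 3], which leaves the edge (0 , 3m ∸ 2 , 3m ∸ 1) free.
  use-first : ∀ μ N {F Rest Fs} → Split (F ∷ []) Rest Fs → length Rest ≡ μ → T (F 0 (3 * suc μ ∸ 2) (3 * suc μ ∸ 1)) →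
    All Down Rest → All (Rich (suc μ) N) Rest → (∀ ν → μ ≡ suc ν → Claim μ (N + 2)) → Solvable Fs
  use-first μ N {F} {Rest} sp len e downs rich ih = assemble 1 sp downs (solve μ len rich ih)
      (add y>0 y<z e (λ ()) (λ ()) (λ ()) []) outside
    where
    y = 3 * suc μ ∸ 2
    z = 3 * suc μ ∸ 1
    y>0 : 0 < y
    y>0 = ≤-trans z<s (≤-reflexive (sym (3*suc∸2 μ)))
    y<z : y < z
    y<z = ≤-reflexive (trans (cong suc (3*suc∸2 μ)) (sym (3*suc∸1 μ)))
    outside : ∀ {u} → u ∈ _ → u < 1 ⊎ 1 + 3 * length Rest ≤ u
    outside (here refl)                 = inj₁ z<s
    outside (there (here refl))         = inj₂ (≤-reflexive (trans (cong (λ v → suc (3 * v)) len) (sym (3*suc∸2 μ))))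
    outside (there (there (here refl))) = inj₂ (≤-trans (≤-reflexive (trans (cong (λ v
        → suc (3 * v)) len) (sym (3*suc∸2 μ)))) (<⇒≤ y<z))
    solve : ∀ μ → length Rest ≡ μ → All (Rich (suc μ) N) Rest → (∀ ν → μ ≡ suc ν → Claim μ (N + 2))
        → Solvable (map (shift 1) Rest)
    solve zero    len rich ih = solve-[] _ (trans (length-map (shift 1) Rest) len)
    solve (suc ν) len rich ih = shifted-claim 1 (suc ν) (N + 2) len downs
      (All.map (λ {G} big → big-first ν N _ _ big (≤-trans (≤-reflexive (cong (λ n → cnt n G) (eq ν N))) (cnt-first (3 * suc ν + (N + 2)) G))) rich)
      (ih ν refl)
      where
      eq : ∀ ν N → 3 * suc (suc ν) + N ≡ suc (3 * suc ν + (N + 2))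
      eq = solve-∀

  -- The other families, moved to the vertices from 2 on and compressed, occupy [2 , 3m ∸ 1), so the
  -- edge (0 , 1 , 3m ∸ 1) stays free.
  use-two : ∀ μ N {F Rest Fs} → 5 * suc μ ≤ N → Split (F ∷ []) Rest Fs → length Rest ≡ μ → T (F 0 1 (3 * suc μ ∸ 1)) →
    All Down Rest → All (NoTop (3 * suc μ)) Rest → All (Rich (suc μ) N) Rest → (∀ ν → μ ≡ suc ν → Claim μ (N + 1)) → Solvable Fs
  use-two μ N {F} {Rest} N≥ sp len e downs noTops rich ih = assemble 2 sp downs (solve μ N≥ len noTops rich ih)
      (add z<s 1<z e (λ ()) (λ ()) (λ ()) []) outside
    where
    z = 3 * suc μ ∸ 1
    1<z : 1 < z
    1<z = ≤-trans (s≤s (s≤s z≤n)) (≤-reflexive (sym (3*suc∸1 μ)))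
    outside : ∀ {u} → u ∈ _ → u < 2 ⊎ 2 + 3 * length Rest ≤ u
    outside (here refl)                 = inj₁ z<s
    outside (there (here refl))         = inj₁ (s<s z<s)
    outside (there (there (here refl))) = inj₂ (≤-reflexive (trans (cong (λ v → suc (suc (3 * v))) len) (sym (3*suc∸1 μ))))
    solve : ∀ μ → 5 * suc μ ≤ N → length Rest ≡ μ → All (NoTop (3 * suc μ)) Rest → All (Rich (suc μ) N) Rest → (∀ ν
        → μ ≡ suc ν → Claim μ (N + 1)) →
      Solvable (map (shift 2) Rest)
    solve zero    N≥ len noTops rich ih = solve-[] _ (trans (length-map (shift 2) Rest) len)
    solve (suc ν) N≥ len noTops rich ih = shifted-claim 2 (suc ν) (N + 1) len downs
      (zip-down (λ G down (noTop , big) → big-two ν N _ _ N≥ big (bound G down noTop)) downs (zip noTops rich))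
      (ih ν refl)
      where
      k = 3 * suc ν + (N + 1)
      eq : ∀ ν N → 3 * suc (suc ν) + N ≡ 2 + (3 * suc ν + (N + 1))
      eq = solve-∀
      d≤k : N + 2 ≤ k
      d≤k = ≤-trans (≤-reflexive (l₁ N)) (+-monoˡ-≤ (N + 1) (≤-trans (s≤s z≤n) (≤-reflexive (sym (*-suc 3 ν)))))
        where
        l₁ : ∀ N → N + 2 ≡ 1 + (N + 1)
        l₁ = solve-∀
      bound : ∀ G → Down G → NoTop (3 * suc (suc ν)) G →
        cnt (3 * suc (suc ν) + N) G + 2 * ((N + 2) C 2) ≤ 2 * ((2 + k ∸ 1) C 2) + cnt k (shift 2 G)
      bound G down noTop = ≤-trans (≤-reflexive (cong (λ n → cnt n G + 2 * ((N + 2) C 2)) (eq ν N)))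
        (cnt-prefix 2 k (N + 2) G d≤k λ x y z x<2 h y<z → top-false (suc ν) down noTop x y z
          (<-≤-trans x<2 (≤-trans 2≤ (y≥ y h))) (y≥ y h) y<z)
        where
        l₁ : ∀ ν N → 2 + (3 * suc ν + (N + 1)) ≡ suc (3 * suc ν) + (N + 2)
        l₁ = solve-∀
        y≥ : ∀ y → 2 + k ≤ y + (N + 2) → 3 * suc (suc ν) ∸ 2 ≤ y
        y≥ y h = ≤-trans (≤-reflexive (3*suc∸2 (suc ν))) (+-cancelʳ-≤ (N + 2) _ _ (≤-trans (≤-reflexive (sym (l₁ ν N))) h))
        2≤ : 2 ≤ 3 * suc (suc ν) ∸ 2
        2≤ = ≤-trans (s≤s (≤-trans (s≤s z≤n) (≤-reflexive (sym (*-suc 3 ν))))) (≤-reflexive (sym (3*suc∸2 (suc ν))))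

  -- The special edges use [0 , 2q) and the top `q` vertices of [0 , 3m). What lies between has
  -- exactly the size that the compressed matching of the other families needs.
  use-batch : ∀ μ q w ν {As Bs Fs} → suc μ ≡ q + suc ν → 2 * w ≤ suc ν → 500 * q ≤ suc ν → 1000 ≤ suc ν →
    Split As Bs Fs → length As ≡ q → length Bs ≡ suc ν → All Down As → All Down Bs →
    All (λ F → T (F (q + q ∸ 2) (suc (q + q ∸ 2)) (3 * suc μ ∸ 1))) As →
    All (NoTop (3 * suc μ)) Bs → All (λ F → 40 * deg (3 * suc μ) F ≤ suc μ * suc μ) Bs → All (Rich (suc μ) (q + w)) Bs →
    Claim (suc ν) (q + w) → Solvable Fs
  use-batch μ q w ν {As} {Bs} eq 2w≤ 500q≤ 1000≤ sp lenA lenB downA downB es noTops thins rich ih =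
    let U , R , where′ = specials L q lenA L+q q+q<L downA es
    in assemble (q + q) sp downB
         (shifted-claim (q + q) (suc ν) N lenB downB
           (zip-down (λ G down (noTop , thin , big) → shrunk G down noTop thin big) downB (zip noTops (zip thins rich))) ih)
         R (λ u∈ → outside (where′ u∈))
    where
    open ≤-Reasoning
    m = suc μ
    M = 3 * m
    N = q + w
    s = q + q
    k = 3 * suc ν + N
    L = s + 3 * suc ν
    L+q : L + q ≡ M
    L+q = trans (l₁ q ν) (cong (3 *_) (sym eq))
      where
      l₁ : ∀ q ν → q + q + 3 * suc ν + q ≡ 3 * (q + suc ν)
      l₁ = solve-∀
    q+q<L : q + q < L
    q+q<L = m<m+n s (≤-trans z<s (≤-reflexive (sym (*-suc 3 ν))))
    outside : ∀ {u} → u < s ⊎ (L ≤ u × u < L + q) → u < s ⊎ s + 3 * length Bs ≤ u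
    outside (inj₁ lt)       = inj₁ lt
    outside (inj₂ (ge , _)) = inj₂ (≤-trans (≤-reflexive (cong (λ v → s + 3 * v) lenB)) ge)
    total : 3 * m + N ≡ s + k + q
    total = trans (cong (λ v → 3 * v + N) eq) (l₁ q ν N)
      where
      l₁ : ∀ q ν N → 3 * (q + suc ν) + N ≡ q + q + (3 * suc ν + N) + q
      l₁ = solve-∀
    M∸1≤ : M ∸ 1 ≤ s + k
    M∸1≤ = ≤-trans (m∸n≤m M 1) (≤-trans (≤-reflexive (sym L+q)) (≤-trans (+-monoʳ-≤ L (m≤m+n q w)) (≤-reflexive
        (+-assoc s (3 * suc ν) N))))
    w+2≤k : w + 2 ≤ k
    w+2≤k = ≤-trans (≤-reflexive (+-comm w 2)) (+-mono-≤ (≤-trans (s≤s (s≤s z≤n)) (≤-reflexive (sym (*-suc 3 ν)))) (m≤n+m w q))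
    shrunk : ∀ G → Down G → NoTop M G → 40 * deg M G ≤ m * m → Rich m N G → Rich (suc ν) N (shift s G)
    shrunk G down noTop thin big = Batch.big-batch q w ν (deg M G)
        (≤-trans thin (≤-reflexive (cong (λ v → v * v) (trans eq (+-comm q (suc ν)))))) 2w≤ 500q≤ 1000≤
        (cnt (3 * m + N) G) (cnt (s + k) G) (cnt k (shift s G)) (subst (λ v → Big v N (cnt (3 * m + N) G)) eq big)
        (≤-trans (≤-reflexive (cong (λ n → cnt n G) total)) (cnt-suffix μ down noTop (s + k) q M∸1≤))
        (cnt-prefix s k (w + 2) G w+2≤k λ x y z x<s h y<z → top-false μ down noTop x y z
          (<-≤-trans x<s (≤-trans s≤ (y≥ y h))) (y≥ y h) y<z)
      where
      l₁ : ∀ q w ν → suc (suc ((q + q) + (3 * suc ν + (q + w)))) ≡ 3 * (q + suc ν) + (w + 2)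
      l₁ = solve-∀
      y≥ : ∀ y → s + k ≤ y + (w + 2) → M ∸ 2 ≤ y
      y≥ y h = m≤n+o⇒m∸n≤o M 2 (+-cancelʳ-≤ (w + 2) _ _ (begin
        M + (w + 2)                         ≡⟨ cong (λ v → 3 * v + (w + 2)) eq ⟩
        3 * (q + suc ν) + (w + 2)           ≡⟨ l₁ q w ν ⟨
        suc (suc (s + k))                   ≤⟨ s≤s (s≤s h) ⟩
        suc (suc (y + (w + 2)))             ∎))
      s≤ : s ≤ M ∸ 2
      s≤ = begin
        s                                   ≤⟨ m≤m+n s (3 * ν + q + 1) ⟩
        s + (3 * ν + q + 1)                 ≡⟨ l₂ q ν ⟨
        3 * (q + suc ν) ∸ 2                 ≡⟨ cong (λ v → 3 * v ∸ 2) eq ⟨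
        M ∸ 2                               ∎
        where
        l₃ : ∀ q ν → 3 * (q + suc ν) ≡ suc (suc (q + q + (3 * ν + q + 1)))
        l₃ = solve-∀
        l₂ : ∀ q ν → 3 * (q + suc ν) ∸ 2 ≡ q + q + (3 * ν + q + 1)
        l₂ q ν = cong (_∸ 2) (l₃ q ν)

  cnt-mono : ∀ {n n′} F → n ≤ n′ → cnt n F ≤ cnt n′ F
  cnt-mono F = sum-range-mono λ z → tri₂ z λ x y → 𝟙 (F x y z)

  -- Additional vertices do not lower the edge counts, and up to m / 10 the clique hypothesis alone
  -- implies both parts of `Big`.
  widen : ∀ m N → N ≤ m / 10 → 10 ≤ m → Claim m (m / 10) → Claim m N
  widen m N N≤ 10≤m claim Fs len downs rich = claim Fs len downs (All.map (λ {F} → up F) rich)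
    where
    up : ∀ F → Rich m N F → Rich m (m / 10) F
    up F big with m / 10 | m≡m%n+[m/n]*n m 10
    ... | zero   | div = ⊥-elim (<⇒≱ (m%n<n m 10) (≤-trans 10≤m (≤-reflexive (trans div (+-identityʳ _)))))
    ... | suc N₀ | div = subst (λ v → Big v (suc N₀) (cnt (3 * m + suc N₀) F)) (sym m≡)
          (big-widen N₀ (m % 10) _ _ (subst (λ v → (3 * v ∸ 1) C 3 < cnt (3 * m + N) F) m≡ (proj₂ big))
            (cnt-mono F (+-monoʳ-≤ (3 * m) N≤)))
      where
      m≡ : m ≡ 10 * suc N₀ + m % 10
      m≡ = trans div (trans (+-comm (m % 10) _) (cong (_+ m % 10) (*-comm (suc N₀) 10)))

-- The induction on the number of families.

module MainInduction where

  open Families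
  open Matchings
  open Moves
  open Regions
  open NibbleParameters
  open Reductions
  open import Data.Bool using (T)
  open import Data.Bool.Properties using (T?)
  open import Data.Nat
  open import Data.Nat.Properties
  open import Data.Nat.DivMod using (_/_; _%_; m≡m%n+[m/n]*n; m%n<n; m*n/n≡m; /-monoˡ-≤)
  open import Data.Nat.Induction using (<-rec)
  open import Data.Nat.Tactic.RingSolver using (solve-∀)
  open import Data.List using (List; []; _∷_; length; map)
  open import Data.List.Relation.Unary.All using (All; []; _∷_)
  import Data.List.Relation.Unary.All as All
  open import Data.Product using (_×_; _,_; proj₁; proj₂; ∃₂)
  open import Data.Sum using (_⊎_; inj₁; inj₂)
  open import Data.Empty using (⊥-elim)
  open import Relation.Nullary using (¬_)
  open import Relation.Binary.PropositionalEquality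

  module Induction (constants : Constants) where
    open Constants constants
    open Parameters constants

    split-len : ∀ {F Rest Fs μ} → Split (F ∷ []) Rest Fs → length Fs ≡ suc μ → length Rest ≡ μ
    split-len sp len = suc-injective (trans (split-length sp) len)

    -- No step lowers N, so N ≥ 5m₀ survives the induction and N ≤ 5m forces m ≥ m₀; small m is
    -- handled by the step for N ≥ 5m. The bound m ≤ 1000N ensures that a batch of at most m/1000
    -- families has q ≤ N, as the parameter w = N - q of `use-batch` requires.
    module Core (μ N : ℕ) (large : 5 * m₀ ≤ N) (m≤ : suc μ ≤ 1000 * N) (ih : ∀ {m′} → m′ < suc μ → ∀ N′ → 5 * m₀ ≤ N′ → Claim m′ N′) where
      open ≤-Reasoning
      m = suc μ
      M = 3 * m

      module Middle (N≤5m : N ≤ 5 * m) (Fs : List Fam) (len : length Fs ≡ m) (downs : All Down Fs) (rich : All (Rich m N) Fs)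
        (noTops : All (NoTop M) Fs) where

        m₀≤m : m₀ ≤ m
        m₀≤m = *-cancelˡ-≤ 5 (≤-trans large N≤5m)

        open Nibbling m m₀≤m

        Fat : Fam → Set
        Fat F = m * m ≤ 40 * deg M F

        -- At ν = 0.49 the quantity 15ν + 3ν² equals 8.0703, which is above 8.06; in millionths the
        -- margin is the constant 10300.
        gap : 49 * m ≤ 100 * N → Solvable Fs
        gap N≥ = nibbled len (all-first Fs) (zip-down (λ F down (noTop , big) → heavy-sel {F} down
            (Heavy.gap-cond m N (deg M F) (miss M F) m₀ m₀≤m z<s (Region.clique-side μ N F down noTop big)
              (Region.cover-side μ N F down noTop big) 100 49 100 10300 refl gap₀ gap₁ N≥ N≤5m)) downs (zip noTops rich))
          [] (≤-trans (≤-reflexive (sym len)) (m≤n*m (length Fs) k ⦃ >-nonZero (≤-trans (s≤s z≤n) 2000≤k) ⦄))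
          where
          all-first : ∀ Fs → Split Fs [] Fs
          all-first []       = []
          all-first (F ∷ Fs) = F ∷ˡ all-first Fs

        module Thin (N≤ : 100 * N ≤ 49 * m) where

          2N≤m : 2 * N ≤ m
          2N≤m = *-cancelˡ-≤ 50 (begin
            50 * (2 * N)  ≡⟨ *-assoc 50 2 N ⟨
            100 * N       ≤⟨ N≤ ⟩
            49 * m        ≤⟨ m≤n+m (49 * m) m ⟩
            50 * m        ∎)

          -- Since k ≥ 2000, the fat families gain at least 2m in total: m for the loss of at most 1
          -- on each other family, and m for the slack demanded by `roomy`.
          many-fat : ∀ {As Bs} → Split As Bs Fs → All Fat As → m ≤ 1000 * length As → Solvable Fs
          many-fat {As} {Bs} sp fats many = nibbled len sp
              (zip-down (λ F down (noTop , big , fat) → heavy-sel {F} down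
                (Heavy.fat-cond m N (deg M F) (miss M F) m₀ m₀≤m z<s (Region.clique-side μ N F down noTop big) 100 40
                    60 refl fat₀ N≤ fat))
                (proj₁ (split-All sp downs)) (zip (proj₁ (split-All sp noTops)) (zip (proj₁ (split-All sp rich)) fats)))
              (zip-down (λ F down (noTop , big) → light-sel {F} down (Region.light-cond μ N F down noTop big 2N≤m))
                (proj₂ (split-All sp downs)) (zip (proj₂ (split-All sp noTops)) (proj₂ (split-All sp rich))))
              (begin
                length Bs + m             ≤⟨ +-monoˡ-≤ m (≤-trans (m≤n+m (length Bs) (length As)) (≤-reflexive (trans
                    (split-length sp) len))) ⟩
                m + m                     ≤⟨ +-mono-≤ many many ⟩
                1000 * length As + 1000 * length As ≡⟨ *-distribʳ-+ (length As) 1000 1000 ⟨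
                2000 * length As          ≤⟨ *-monoˡ-≤ (length As) 2000≤k ⟩
                k * length As             ∎)

          batch : ∀ {As Bs} q n → Split As Bs Fs → length As ≡ q → length Bs ≡ n → 0 < q → 1000 * q ≤ m →
            All (λ F → T (F (q + q ∸ 2) (suc (q + q ∸ 2)) (M ∸ 1))) As → All (λ F → ¬ Fat F) Bs → Solvable Fs
          batch q zero sp lenA lenB 0<q 1000q≤ es thins = ⊥-elim (<⇒≱ (m<n+m q (≤-trans 0<q (m≤n*m q 999)))
              (≤-trans (≤-reflexive (+-comm (999 * q) q)) (≤-trans 1000q≤ (≤-reflexive (trans (sym len) (trans (sym
                  (split-length sp)) (trans (cong₂ _+_ lenA lenB) (+-identityʳ q))))))))
          batch {As} {Bs} q (suc ν) sp lenA lenB 0<q 1000q≤ es thins =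
              use-batch μ q w ν m≡ 2w≤ 500q≤ 1000≤ sp lenA lenB (proj₁ (split-All sp downs)) (proj₂ (split-All sp downs)) es
                (proj₂ (split-All sp noTops)) (All.map (λ {F} ¬fat → <⇒≤ (≰⇒> ¬fat)) thins) (subst (λ v → All (Rich m v) Bs) N≡ (proj₂ (split-All sp rich)))
                (subst (Claim (suc ν)) N≡ (ih ν<μ N large))
            where
            n = suc ν
            m≡ : m ≡ q + n
            m≡ = trans (sym len) (trans (sym (split-length sp)) (cong₂ _+_ lenA lenB))
            ν<μ : n < m
            ν<μ = ≤-trans (m<n+m n 0<q) (≤-reflexive (sym m≡))
            q≤N : q ≤ N
            q≤N = *-cancelˡ-≤ 1000 (≤-trans 1000q≤ m≤)
            w = N ∸ q
            N≡ : N ≡ q + w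
            N≡ = sym (m+[n∸m]≡n q≤N)
            999q≤ : 999 * q ≤ n
            999q≤ = +-cancelˡ-≤ q _ _ (≤-trans 1000q≤ (≤-reflexive m≡))
            500q≤ : 500 * q ≤ n
            500q≤ = ≤-trans (*-monoˡ-≤ q (m≤m+n 500 499)) 999q≤
            q≤n : q ≤ n
            q≤n = ≤-trans (m≤n*m q 999) 999q≤
            1000≤ : 1000 ≤ n
            1000≤ = *-cancelˡ-≤ 2 (≤-trans 2000≤m₀ (≤-trans m₀≤m (≤-trans (≤-reflexive m≡) (≤-trans (+-monoˡ-≤ n q≤n)
                (≤-reflexive (cong (n +_) (sym (+-identityʳ n))))))))
            2w≤ : 2 * w ≤ n
            2w≤ = *-cancelˡ-≤ 50 (≤-trans (≤-reflexive (sym (*-assoc 50 2 w))) (+-cancelˡ-≤ (100 * q) _ _ (begin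
              100 * q + 100 * w     ≡⟨ *-distribˡ-+ 100 q w ⟨
              100 * (q + w)         ≡⟨ cong (100 *_) N≡ ⟨
              100 * N               ≤⟨ N≤ ⟩
              49 * m                ≡⟨ cong (49 *_) m≡ ⟩
              49 * (q + n)          ≡⟨ *-distribˡ-+ 49 q n ⟩
              49 * q + 49 * n       ≤⟨ +-mono-≤ (*-monoˡ-≤ q (m≤m+n 49 51)) (m≤n+m (49 * n) n) ⟩
              100 * q + 50 * n      ∎)))

          extras : ∀ Fs → All Down Fs → All (Rich m N) Fs → All (λ F → T (F 0 1 (M ∸ 1))) Fs
          extras Fs downs rich = zip-down (λ F down big → has-extra (3 * m
              + N) {M} {F} down (≤-trans (s≤s (s≤s z≤n)) (≤-reflexive (sym (3*suc∸1 μ)))) (proj₂ big)) downs rich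

          few-fat : ∀ {As Bs} → Split As Bs Fs → All Fat As → All (λ F → ¬ Fat F) Bs → 1000 * length As ≤ m → Solvable Fs
          few-fat {[]} {[]} sp [] [] few with () ← trans (split-length sp) len
          few-fat {[]} {B ∷ Bs} sp [] (thin ∷ thins) few = batch 1 (length Bs) (one sp) refl refl z<s
              (≤-trans (m≤m+n 1000 1000) (≤-trans 2000≤m₀ m₀≤m))
              (All.head (subst (All _) (sym (none sp)) (extras Fs downs rich)) ∷ []) thins
            where
            none : ∀ {Bs Cs} → Split [] Bs Cs → Bs ≡ Cs
            none []         = refl
            none (F ∷ʳ sp) = cong (F ∷_) (none sp)
            one : ∀ {B Bs Cs} → Split [] (B ∷ Bs) Cs → Split (B ∷ []) Bs Cs
            one (B ∷ʳ sp) = B ∷ˡ sp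
          few-fat {A ∷ As} {Bs} sp fats thins few = batch (suc t) (length Bs) sp refl refl z<s few
              (zip-down (λ F down fat → subst (λ v → T (F v (suc v) (M ∸ 1))) (sym t+t) (has-pair {M} {F} t down lt
                  (big {F} fat))) (proj₁ (split-All sp downs)) fats) thins
            where
            t = length As
            t+t : suc t + suc t ∸ 2 ≡ t + t
            t+t = cong (_∸ 1) (+-suc t t)
            lt : suc (t + t) < M ∸ 1
            lt = begin-strict
              suc (t + t)        ≤⟨ s≤s (+-mono-≤ t≤ t≤) ⟩
              suc (μ + μ)        <⟨ s<s (≤-trans (≤-reflexive (cong suc (cong (μ +_) (sym (+-identityʳ μ))))) (s≤s
                  (*-monoˡ-≤ μ (m≤m+n 2 1)))) ⟩
              suc (suc (3 * μ))  ≡⟨ 3*suc∸1 μ ⟨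
              M ∸ 1              ∎
              where
              t≤ : t ≤ μ
              t≤ = s≤s⁻¹ (≤-trans (m≤n*m (suc t) 1000) few)
            big : ∀ {F} → Fat F → (t + t) * M < deg M F
            big {F} fat = *-cancelˡ-< 40 _ _ (<-≤-trans (begin-strict
              40 * ((t + t) * M)   ≡⟨ l₁ t m ⟩
              240 * t * m          ≤⟨ *-monoˡ-≤ m (*-monoˡ-≤ t (m≤m+n 240 760)) ⟩
              1000 * t * m         <⟨ *-monoˡ-< m (<-≤-trans (*-monoʳ-< 1000 (n<1+n t)) few) ⟩
              m * m                ∎) fat)
              where
              l₁ : ∀ t m → 40 * ((t + t) * (3 * m)) ≡ 240 * t * m
              l₁ = solve-∀

          thin-case : Solvable Fs
          thin-case =
            let As , Bs , sp , fats , thins = separate (λ F → m * m ≤? 40 * deg M F) Fs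
            in decide sp fats thins (≤-total (1000 * length As) m)
            where
            decide : ∀ {As Bs} → Split As Bs Fs → All Fat As → All (λ F → ¬ Fat F) Bs → 1000 * length As ≤ m ⊎ m
                ≤ 1000 * length As → Solvable Fs
            decide sp fats thins (inj₁ few)  = few-fat sp fats thins few
            decide sp fats thins (inj₂ many) = many-fat sp fats many

        middle : 100 * N ≤ 49 * m ⊎ 49 * m ≤ 100 * N → Solvable Fs
        middle (inj₁ N≤) = Thin.thin-case N≤
        middle (inj₂ N≥) = gap N≥

      no-top : ∀ Fs → length Fs ≡ m → All Down Fs → All (Rich m N) Fs → All (NoTop M) Fs → 5 * m ≤ N ⊎ N ≤ 5 * m → Solvable Fs
      no-top Fs len downs rich noTops (inj₂ N≤) = Middle.middle N≤ Fs len downs rich noTops (≤-total (100 * N) (49 * m))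
      no-top (F ∷ Rest) len (down ∷ downs) (big ∷ rich) (_ ∷ noTops) (inj₁ N≥) =
        use-two μ N N≥ (F ∷ˡ allʳ Rest) (suc-injective len) (has-extra (3 * m
            + N) {M} {F} down (≤-trans (s≤s (s≤s z≤n)) (≤-reflexive (sym (3*suc∸1 μ)))) (proj₂ big))
          downs noTops rich (λ ν eq → ih ≤-refl (N + 1) (≤-trans large (m≤m+n N 1)))

      claim : Claim m N
      claim Fs len downs rich = decide (find (λ F → T? (F 0 (M ∸ 2) (M ∸ 1))) Fs)
        where
        decide : (∃₂ λ F Rest → Split (F ∷ []) Rest Fs × T (F 0 (M ∸ 2) (M ∸ 1))) ⊎ All (NoTop M) Fs → Solvable Fs
        decide (inj₁ (F , Rest , sp , e)) = use-first μ N sp (split-len sp len) e (proj₂ (split-All sp downs)) (proj₂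
            (split-All sp rich))
          λ ν eq → ih ≤-refl (N + 2) (≤-trans large (m≤m+n N 2))
        decide (inj₂ noTops) = no-top Fs len downs rich noTops (≤-total (5 * m) N)

    -- If m > 1000N, then N is first raised to m / 10 at the same m. This is legitimate because the
    -- induction is on m alone, with the claim for all admissible N.
    claims : ∀ m N → 5 * m₀ ≤ N → Claim m N
    claims = <-rec _ step
      where
      step : ∀ m → (∀ {m′} → m′ < m → ∀ N → 5 * m₀ ≤ N → Claim m′ N) → ∀ N → 5 * m₀ ≤ N → Claim m N
      step zero    ih N large Fs len _ _ = solve-[] Fs len
      step (suc μ) ih N large = decide (≤-<-connex (suc μ) (1000 * N))
        where
        decide : suc μ ≤ 1000 * N ⊎ 1000 * N < suc μ → Claim (suc μ) N
        decide (inj₁ m≤)  = Core.claim μ N large m≤ ih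
        decide (inj₂ <m) = widen (suc μ) N N≤ 10≤ (Core.claim μ (suc μ / 10) (≤-trans large N≤) m≤ ih)
          where
          0<N : 0 < N
          0<N = <-≤-trans (≤-trans (s≤s z≤n) 2000≤m₀) (≤-trans (m≤n*m m₀ 5) large)
          N≤ : N ≤ suc μ / 10
          N≤ = ≤-trans (≤-reflexive (sym (m*n/n≡m N 10))) (/-monoˡ-≤ 10 (≤-trans (≤-reflexive (*-comm N 10)) (≤-trans
              (*-monoˡ-≤ N (m≤m+n 10 990)) (<⇒≤ <m))))
          10≤ : 10 ≤ suc μ
          10≤ = ≤-trans (*-mono-≤ (m≤m+n 10 990) 0<N) (<⇒≤ <m)
          m≤ : suc μ ≤ 1000 * (suc μ / 10)
          m≤ = begin
            suc μ                                ≡⟨ m≡m%n+[m/n]*n (suc μ) 10 ⟩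
            suc μ % 10 + suc μ / 10 * 10         ≤⟨ +-monoˡ-≤ (suc μ / 10 * 10) (≤-trans (<⇒≤ (m%n<n (suc μ) 10))
                (*-monoˡ-≤ 10 (≤-trans 0<N N≤))) ⟩
            suc μ / 10 * 10 + suc μ / 10 * 10    ≡⟨ *-distribˡ-+ (suc μ / 10) 10 10 ⟨
            suc μ / 10 * 20                      ≡⟨ *-comm (suc μ / 10) 20 ⟩
            20 * (suc μ / 10)                    ≤⟨ *-monoˡ-≤ (suc μ / 10) (m≤m+n 20 980) ⟩
            1000 * (suc μ / 10)                  ∎
            where open ≤-Reasoning

-- Adjacent shifts of families of subsets.

module Shifting where

  open Sums using (𝟙)
  open import Data.Bool using (Bool; true; false; _∧_; _∨_; not; T)
  open import Data.Bool.Properties using () renaming (_≟_ to _≟ᵇ_)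
  open import Data.Nat
  open import Data.Nat.Properties
  open import Data.Nat.Induction using (<-wellFounded)
  open import Data.Nat.Tactic.RingSolver using (solve-∀)
  open import Data.Fin as Fin using (Fin; zero; suc)
  open import Data.Fin.Properties using (any?)
  open import Data.Fin.Subset using (Subset; ∣_∣)
  open import Data.Vec using ([]; _∷_)
  open import Data.Product using (Σ; _×_; _,_)
  open import Data.Empty using (⊥-elim)
  open import Function using (_∘_)
  open import Induction.WellFounded using (Acc; acc)
  open import Relation.Nullary using (yes; no; ¬_)
  open import Relation.Nullary.Decidable using (_×-dec_)
  open import Relation.Binary.PropositionalEquality
  open import Algebra.Properties.CommutativeSemigroup +-commutativeSemigroup using (interchange)

  sumV : ∀ n → (Subset n → ℕ) → ℕ
  sumV zero    f = f []
  sumV (suc n) f = sumV n (f ∘ (true ∷_)) + sumV n (f ∘ (false ∷_))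

  sumV-cong : ∀ n {f g} → (∀ v → f v ≡ g v) → sumV n f ≡ sumV n g
  sumV-cong zero    h = h []
  sumV-cong (suc n) h = cong₂ _+_ (sumV-cong n (h ∘ (true ∷_))) (sumV-cong n (h ∘ (false ∷_)))

  sumV-mono : ∀ n {f g} → (∀ v → f v ≤ g v) → sumV n f ≤ sumV n g
  sumV-mono zero    h = h []
  sumV-mono (suc n) h = +-mono-≤ (sumV-mono n (h ∘ (true ∷_))) (sumV-mono n (h ∘ (false ∷_)))

  sumV-+ : ∀ n f g → sumV n (λ v → f v + g v) ≡ sumV n f + sumV n g
  sumV-+ zero    f g = refl
  sumV-+ (suc n) f g = trans (cong₂ _+_ (sumV-+ n (f ∘ (true ∷_)) (g ∘ (true ∷_))) (sumV-+ n (f ∘ (false ∷_)) (g ∘ (false ∷_))))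
    (interchange (sumV n (f ∘ (true ∷_))) _ _ _)

  term≤sumV : ∀ n f v → f v ≤ sumV n f
  term≤sumV zero    f []          = ≤-refl
  term≤sumV (suc n) f (true  ∷ v) = ≤-trans (term≤sumV n (f ∘ (true ∷_)) v) (m≤m+n _ _)
  term≤sumV (suc n) f (false ∷ v) = ≤-trans (term≤sumV n (f ∘ (false ∷_)) v) (m≤n+m _ _)

  τ : ∀ {n} → Fin n → Subset (suc n) → Subset (suc n)
  τ zero    (a ∷ b ∷ v) = b ∷ a ∷ v
  τ (suc p) (a ∷ v)     = a ∷ τ p v

  lo hi : ∀ {n} → Fin n → Subset (suc n) → Bool
  lo zero    (a ∷ b ∷ v) = a
  lo (suc p) (a ∷ v)     = lo p v
  hi zero    (a ∷ b ∷ v) = b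
  hi (suc p) (a ∷ v)     = hi p v

  lo-τ : ∀ {n} (p : Fin n) v → lo p (τ p v) ≡ hi p v
  lo-τ zero    (a ∷ b ∷ v) = refl
  lo-τ (suc p) (a ∷ v)     = lo-τ p v

  hi-τ : ∀ {n} (p : Fin n) v → hi p (τ p v) ≡ lo p v
  hi-τ zero    (a ∷ b ∷ v) = refl
  hi-τ (suc p) (a ∷ v)     = hi-τ p v

  τ-τ : ∀ {n} (p : Fin n) v → τ p (τ p v) ≡ v
  τ-τ zero    (a ∷ b ∷ v) = refl
  τ-τ (suc p) (a ∷ v)     = cong (a ∷_) (τ-τ p v)

  τ-fix : ∀ {n} (p : Fin n) v → lo p v ≡ hi p v → τ p v ≡ v
  τ-fix zero    (a ∷ b ∷ v) refl = refl
  τ-fix (suc p) (a ∷ v)     h    = cong (a ∷_) (τ-fix p v h)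

  ∣τ∣ : ∀ {n} (p : Fin n) v → ∣ τ p v ∣ ≡ ∣ v ∣
  ∣τ∣ zero    (true  ∷ true  ∷ v) = refl
  ∣τ∣ zero    (true  ∷ false ∷ v) = refl
  ∣τ∣ zero    (false ∷ true  ∷ v) = refl
  ∣τ∣ zero    (false ∷ false ∷ v) = refl
  ∣τ∣ (suc p) (true  ∷ v)         = cong suc (∣τ∣ p v)
  ∣τ∣ (suc p) (false ∷ v)         = ∣τ∣ p v

  sumV-τ : ∀ {n} (p : Fin n) f → sumV (suc n) (f ∘ τ p) ≡ sumV (suc n) f
  sumV-τ {suc n} zero    f = interchange (sumV n λ v → f (true ∷ true ∷ v)) _ _ _
  sumV-τ {suc n} (suc p) f = cong₂ _+_ (sumV-τ p (f ∘ (true ∷_))) (sumV-τ p (f ∘ (false ∷_)))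

  -- The sum of the elements.
  wt : ∀ {n} → Subset n → ℕ
  wt []      = 0
  wt (a ∷ v) = ∣ v ∣ + wt v

  wt-τ : ∀ {n} (p : Fin n) v → lo p v ≡ true → hi p v ≡ false → wt (τ p v) ≡ suc (wt v)
  wt-τ zero    (.true ∷ .false ∷ v) refl refl = refl
  wt-τ (suc p) (a ∷ v)              l    h    = trans (cong₂ _+_ (∣τ∣ p v) (wt-τ p v l h)) (+-suc ∣ v ∣ (wt v))

  Family : ℕ → Set
  Family n = Subset n → Bool

  shiftBit : Bool → Bool → Bool → Bool → Bool
  shiftBit true  false x y = x ∨ y
  shiftBit false true  x y = x ∧ y
  shiftBit true  true  x y = x
  shiftBit false false x y = x

  S : ∀ {n} → Fin n → Family (suc n) → Family (suc n)
  S p 𝓕 v = shiftBit (lo p v) (hi p v) (𝓕 v) (𝓕 (τ p v))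

  unstable : Bool → Bool → Bool → Bool → Bool
  unstable l h x y = not l ∧ h ∧ x ∧ not y

  U : ∀ {n} → Fin n → Family (suc n) → ℕ
  U {n} p 𝓕 = sumV (suc n) λ v → 𝟙 (unstable (lo p v) (hi p v) (𝓕 v) (𝓕 (τ p v)))

  size measure : ∀ {n} → Family n → ℕ
  size    {n} 𝓕 = sumV n λ v → 𝟙 (𝓕 v)
  measure {n} 𝓕 = sumV n λ v → 𝟙 (𝓕 v) * wt v

  module _ {n : ℕ} (p : Fin n) where

    -- The involution `τ p` permutes the subsets, so twice a sum is a sum over the pairs that it
    -- exchanges.
    sumV-pairs : ∀ f g → (∀ v → f v + f (τ p v) ≡ g v + g (τ p v)) → sumV (suc n) f ≡ sumV (suc n) g
    sumV-pairs f g h = *-cancelˡ-≡ (sumV (suc n) f) (sumV (suc n) g) 2 (trans (double f) (trans (sumV-cong (suc n) h)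
        (sym (double g))))
      where
      double : ∀ f → 2 * sumV (suc n) f ≡ sumV (suc n) (λ v → f v + f (τ p v))
      double f = trans (cong (sumV (suc n) f +_) (+-identityʳ _))
        (trans (cong (sumV (suc n) f +_) (sym (sumV-τ p f))) (sym (sumV-+ (suc n) f (f ∘ τ p))))

    -- It suffices to compare the pairs {v , τ p v} in which v contains the lower of the two elements only.
    by-pairs : ∀ f g → (∀ v → lo p v ≡ true → hi p v ≡ false → f v + f (τ p v) ≡ g v + g (τ p v)) →
      (∀ v → lo p v ≡ hi p v → f v ≡ g v) → sumV (suc n) f ≡ sumV (suc n) g
    by-pairs f g h h₌ = sumV-pairs f g go
      where
      fixed : ∀ v → lo p v ≡ hi p v → f v + f (τ p v) ≡ g v + g (τ p v)
      fixed v e = cong₂ _+_ (h₌ v e) (h₌ (τ p v) (trans (lo-τ p v) (trans (sym e) (sym (hi-τ p v)))))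
      go : ∀ v → f v + f (τ p v) ≡ g v + g (τ p v)
      go v with lo p v in l | hi p v in r
      ... | true  | false = h v l r
      ... | true  | true  = fixed v (trans l (sym r))
      ... | false | false = fixed v (trans l (sym r))
      ... | false | true  = begin
        f v + f (τ p v)               ≡⟨ +-comm (f v) _ ⟩
        f (τ p v) + f v               ≡⟨ cong (λ u → f (τ p v) + f u) (τ-τ p v) ⟨
        f (τ p v) + f (τ p (τ p v))   ≡⟨ h (τ p v) (trans (lo-τ p v) r) (trans (hi-τ p v) l) ⟩
        g (τ p v) + g (τ p (τ p v))   ≡⟨ cong (λ u → g (τ p v) + g u) (τ-τ p v) ⟩
        g (τ p v) + g v               ≡⟨ +-comm _ (g v) ⟩
        g v + g (τ p v)               ∎
        where open ≡-Reasoning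

    module _ (𝓕 : Family (suc n)) where

      S-lower : ∀ v → lo p v ≡ true → hi p v ≡ false → S p 𝓕 v ≡ 𝓕 v ∨ 𝓕 (τ p v)
      S-lower v l h rewrite l | h = refl

      S-upper : ∀ v → lo p v ≡ true → hi p v ≡ false → S p 𝓕 (τ p v) ≡ 𝓕 (τ p v) ∧ 𝓕 v
      S-upper v l h rewrite lo-τ p v | hi-τ p v | l | h | τ-τ p v = refl

      S-fixed : ∀ v → lo p v ≡ hi p v → S p 𝓕 v ≡ 𝓕 v
      S-fixed v e with lo p v | hi p v
      S-fixed v refl | true  | .true  = refl
      S-fixed v refl | false | .false = refl

      size-S : size (S p 𝓕) ≡ size 𝓕
      size-S = by-pairs (λ v → 𝟙 (S p 𝓕 v)) (λ v → 𝟙 (𝓕 v)) (λ v l h → trans (cong₂ (λ a b → 𝟙 a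
          + 𝟙 b) (S-lower v l h) (S-upper v l h)) (lem (𝓕 v) (𝓕 (τ p v))))
                            (λ v e → cong 𝟙 (S-fixed v e))
        where
        lem : ∀ x y → 𝟙 (x ∨ y) + 𝟙 (y ∧ x) ≡ 𝟙 x + 𝟙 y
        lem true  true  = refl
        lem true  false = refl
        lem false true  = refl
        lem false false = refl

      -- A set that the shift moves has one element lowered by 1, so the measure drops by exactly
      -- the number `U` of moved sets. Hence repeated shifting terminates, and it can stop only when
      -- all families are stable.
      measure-S : measure (S p 𝓕) + U p 𝓕 ≡ measure 𝓕
      measure-S = trans (sym (sumV-+ (suc n) (λ v → 𝟙 (S p 𝓕 v) * wt v) (λ v → 𝟙 (u v))))
        (by-pairs (λ v → 𝟙 (S p 𝓕 v) * wt v + 𝟙 (u v)) (λ v → 𝟙 (𝓕 v) * wt v) pair fixed)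
        where
        u : Subset (suc n) → Bool
        u v = unstable (lo p v) (hi p v) (𝓕 v) (𝓕 (τ p v))
        u-lower : ∀ v → lo p v ≡ true → u v ≡ false
        u-lower v l rewrite l = refl
        u-upper : ∀ v → lo p v ≡ true → hi p v ≡ false → u (τ p v) ≡ 𝓕 (τ p v) ∧ not (𝓕 v)
        u-upper v l h rewrite lo-τ p v | hi-τ p v | l | h | τ-τ p v = refl
        lem : ∀ x y w → 𝟙 (x ∨ y) * w + 0 + (𝟙 (y ∧ x) * suc w + 𝟙 (y ∧ not x)) ≡ 𝟙 x * w + 𝟙 y * suc w
        lem true  true  w = l₁ w
          where
          l₁ : ∀ w → 1 * w + 0 + (1 * suc w + 0) ≡ 1 * w + 1 * suc w
          l₁ = solve-∀
        lem true  false w = +-identityʳ (1 * w + 0)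
        lem false true  w = l₁ w
          where
          l₁ : ∀ w → 1 * w + 0 + 1 ≡ 1 * suc w
          l₁ = solve-∀
        lem false false w = refl
        pair : ∀ v → lo p v ≡ true → hi p v ≡ false →
          (𝟙 (S p 𝓕 v) * wt v + 𝟙 (u v)) + (𝟙 (S p 𝓕 (τ p v)) * wt (τ p v) + 𝟙 (u (τ p v))) ≡ 𝟙 (𝓕 v) * wt v
              + 𝟙 (𝓕 (τ p v)) * wt (τ p v)
        pair v l h rewrite S-lower v l h | S-upper v l h | u-lower v l | u-upper v l h | wt-τ p v l h = lem (𝓕 v) (𝓕
            (τ p v)) (wt v)
        fixed : ∀ v → lo p v ≡ hi p v → 𝟙 (S p 𝓕 v) * wt v + 𝟙 (u v) ≡ 𝟙 (𝓕 v) * wt v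
        fixed v e = trans (cong₂ (λ a b → 𝟙 a * wt v + 𝟙 b) (S-fixed v e) (u-fixed v e)) (+-identityʳ _)
          where
          u-fixed : ∀ v → lo p v ≡ hi p v → u v ≡ false
          u-fixed v e with lo p v | hi p v
          u-fixed v refl | true  | .true  = refl
          u-fixed v refl | false | .false = refl

      S-card : ∀ {c} → (∀ v → T (𝓕 v) → ∣ v ∣ ≡ c) → ∀ v → T (S p 𝓕 v) → ∣ v ∣ ≡ c
      S-card h v t with lo p v | hi p v | 𝓕 v in x | 𝓕 (τ p v) in y
      ... | true  | false | true  | _     = h v (subst T (sym x) _)
      ... | true  | false | false | true  = trans (sym (∣τ∣ p v)) (h (τ p v) (subst T (sym y) _))
      ... | false | true  | true  | true  = h v (subst T (sym x) _)
      ... | true  | true  | true  | _     = h v (subst T (sym x) _)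
      ... | false | false | true  | _     = h v (subst T (sym x) _)

  Disj : ∀ {n} → Subset n → Subset n → Set
  Disj {zero}  []      []      = 0 ≡ 0
  Disj {suc n} (a ∷ u) (b ∷ v) = a ∧ b ≡ false × Disj u v

  Disj-τ : ∀ {n} (p : Fin n) u v → Disj u v → Disj (τ p u) (τ p v)
  Disj-τ zero    (a ∷ b ∷ u) (c ∷ d ∷ v) (x , y , z) = y , x , z
  Disj-τ (suc p) (a ∷ u)     (b ∷ v)     (x , y)     = x , Disj-τ p u v y

  Disj-lo : ∀ {n} (p : Fin n) u v → Disj u v → lo p u ≡ true → lo p v ≡ false
  Disj-lo zero    (.true ∷ b ∷ u) (c ∷ d ∷ v) (x , _) refl = x
  Disj-lo (suc p) (a ∷ u)         (b ∷ v)     (_ , y) l    = Disj-lo p u v y l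

  Rainbow : ∀ {m n} → (Fin m → Family n) → Set
  Rainbow {m} {n} 𝓕 = Σ (Fin m → Subset n) λ e → (∀ i → T (𝓕 i (e i))) × (∀ i j → ¬ i ≡ j → Disj (e i) (e j))

  -- If some e i is not in 𝓕 i then exchanging p and p + 1 in all the edges repairs the matching.
  Rainbow-S : ∀ {m n} (p : Fin n) (𝓕 : Fin m → Family (suc n)) → Rainbow (S p ∘ 𝓕) → Rainbow 𝓕
  Rainbow-S p 𝓕 (e , e∈ , dis) with any? (λ i → (lo p (e i) ≟ᵇ true) ×-dec ((hi p (e i) ≟ᵇ false) ×-dec (𝓕 i (e i) ≟ᵇ false)))
  ... | yes (t , l , h , f) = τ p ∘ e , swapped , λ i j i≢j → Disj-τ p (e i) (e j) (dis i j i≢j)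
    where
    swapped : ∀ i → T (𝓕 i (τ p (e i)))
    swapped i with i Fin.≟ t
    ... | yes refl = subst T (trans (S-lower p (𝓕 i) (e i) l h) (cong (_∨ 𝓕 i (τ p (e i))) f)) (e∈ i)
    -- By disjointness from e t, the edge e i does not contain the lower element. If it contains the
    -- upper one, the shifted family has it only when it and its image are both in 𝓕 i; otherwise
    -- `τ p` fixes it.
    ... | no  i≢t with lo p (e i) in l′ | hi p (e i) in h′ | Disj-lo p (e t) (e i) (dis t i (λ eq
        → i≢t (sym eq))) l | 𝓕 i (e i) in x | 𝓕 i (τ p (e i)) in y | e∈ i
    ...   | true  | _     | () | _    | _     | _
    ...   | false | true  | _ | true  | true  | _ = _
    ...   | false | false | _ | true  | true  | _ = _
    ...   | false | false | _ | true  | false | _ with () ← trans (sym x) (trans (cong (𝓕 i) (sym (τ-fix p (e i)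
        (trans l′ (sym h′))))) y)
  ... | no none = e , kept , dis
    where
    kept : ∀ i → T (𝓕 i (e i))
    kept i with lo p (e i) in l | hi p (e i) in h | 𝓕 i (e i) in x | 𝓕 i (τ p (e i)) | e∈ i
    ... | _     | _     | true  | _ | _ = _
    ... | true  | false | false | _ | _ = none (i , l , h , x)
    ... | true  | true  | false | _ | ()
    ... | false | true  | false | _ | ()
    ... | false | false | false | _ | ()

  Stable : ∀ {n} → Family (suc n) → Set
  Stable {n} 𝓕 = ∀ p v → lo p v ≡ false → hi p v ≡ true → T (𝓕 v) → T (𝓕 (τ p v))

  U≡0⇒stable : ∀ {n} (𝓕 : Family (suc n)) → (∀ p → U p 𝓕 ≡ 0) → Stable 𝓕
  U≡0⇒stable {n} 𝓕 h p v l r t with 𝓕 v in x | 𝓕 (τ p v) in y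
  ... | true | true  = _
  ... | true | false = ⊥-elim (<⇒≱ (≤-trans one (term≤sumV (suc n) (λ v
      → 𝟙 (unstable (lo p v) (hi p v) (𝓕 v) (𝓕 (τ p v)))) v)) (≤-reflexive (h p)))
    where
    one : 1 ≤ 𝟙 (unstable (lo p v) (hi p v) (𝓕 v) (𝓕 (τ p v)))
    one rewrite l | r | x | y = ≤-refl

  total : ∀ {m} → (Fin m → ℕ) → ℕ
  total {zero}  f = 0
  total {suc m} f = f zero + total (f ∘ suc)

  total-mono : ∀ {m} {f g : Fin m → ℕ} → (∀ i → f i ≤ g i) → total f ≤ total g
  total-mono {zero}  h = z≤n
  total-mono {suc m} h = +-mono-≤ (h zero) (total-mono (h ∘ suc))

  total-< : ∀ {m} {f g : Fin m → ℕ} → (∀ i → f i ≤ g i) → ∀ i → f i < g i → total f < total g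
  total-< h zero    lt = +-mono-<-≤ lt (total-mono (h ∘ suc))
  total-< h (suc i) lt = +-mono-≤-< (h zero) (total-< (h ∘ suc) i lt)

  record Stabilised {m n} (c : ℕ) (𝓕 : Fin m → Family (suc n)) : Set where
    field
      𝓖       : Fin m → Family (suc n)
      stable  : ∀ i → Stable (𝓖 i)
      size≡   : ∀ i → size (𝓖 i) ≡ size (𝓕 i)
      card    : ∀ i v → T (𝓖 i v) → ∣ v ∣ ≡ c
      rainbow : Rainbow 𝓖 → Rainbow 𝓕

  stabilise : ∀ {m n} c (𝓕 : Fin m → Family (suc n)) → (∀ i v → T (𝓕 i v) → ∣ v ∣ ≡ c) → Stabilised c 𝓕
  stabilise {m} {n} c 𝓕 h = go 𝓕 h (<-wellFounded _)
    where
    go : ∀ 𝓕 → (∀ i v → T (𝓕 i v) → ∣ v ∣ ≡ c) → Acc _<_ (total (measure ∘ 𝓕)) → Stabilised c 𝓕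
    go 𝓕 h (acc rec) with any? (λ p → any? (λ i → 0 <? U p (𝓕 i)))
    ... | yes (p , i , pos) = record
      { 𝓖 = 𝓖 ; stable = stable ; size≡ = λ j → trans (size≡ j) (size-S p (𝓕 j)) ; card = card ; rainbow = Rainbow-S
          p 𝓕 ∘ rainbow }
      where
      decrease : ∀ j → measure (S p (𝓕 j)) ≤ measure (𝓕 j)
      decrease j = ≤-trans (m≤m+n _ (U p (𝓕 j))) (≤-reflexive (measure-S p (𝓕 j)))
      strict : measure (S p (𝓕 i)) < measure (𝓕 i)
      strict = ≤-trans (m<m+n _ pos) (≤-reflexive (measure-S p (𝓕 i)))
      open Stabilised (go (S p ∘ 𝓕) (λ j → S-card p (𝓕 j) (h j)) (rec (total-< decrease i strict)))
    ... | no none = record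
      { 𝓖 = 𝓕 ; stable = λ i → U≡0⇒stable (𝓕 i) (λ p → n≤0⇒n≡0 (≮⇒≥ λ pos → none (p , i , pos)))
      ; size≡ = λ _ → refl ; card = h ; rainbow = λ r → r }

-- Increasing triples as three-element subsets.

module Triples where

  open Sums
  open Families using (Fam; Down; cnt)
  open Shifting
  open import Data.Bool using (true; false; _∧_; T)
  open import Data.Nat
  open import Data.Nat.Properties
  open import Data.Fin as Fin using (Fin; zero; suc; toℕ)
  open import Data.Fin.Subset using (Subset; ∣_∣; _∩_) renaming (⊥ to ∅)
  open import Data.Vec using ([]; _∷_; lookup)
  open import Data.Product using (∃; _×_; _,_)
  open import Data.Sum using (_⊎_; inj₁; inj₂)
  open import Data.Empty using (⊥; ⊥-elim)
  open import Function using (_∘_)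
  open import Relation.Nullary using (¬_)
  open import Relation.Binary.PropositionalEquality

  set₀ : ∀ n → Subset n
  set₀ zero    = []
  set₀ (suc n) = false ∷ set₀ n

  set₁ : ∀ {n} → ℕ → Subset n
  set₁ {zero}  x       = []
  set₁ {suc n} zero    = true ∷ set₀ n
  set₁ {suc n} (suc x) = false ∷ set₁ x

  set₂ : ∀ {n} → ℕ → ℕ → Subset n
  set₂ {zero}  x       y = []
  set₂ {suc n} zero    y = true ∷ set₁ (pred y)
  set₂ {suc n} (suc x) y = false ∷ set₂ x (pred y)

  -- The set {x , y , z} for x < y < z; the later arguments are lowered along with the tail.
  set₃ : ∀ {n} → ℕ → ℕ → ℕ → Subset n
  set₃ {zero}  x       y z = []
  set₃ {suc n} zero    y z = true ∷ set₂ (pred y) (pred z)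
  set₃ {suc n} (suc x) y z = false ∷ set₃ x (pred y) (pred z)

  Step : ∀ {n} → Fin n → Subset (suc n) → Subset (suc n) → Set
  Step p u v = lo p u ≡ false × hi p u ≡ true × τ p u ≡ v

  Reach : ∀ {n} → Subset n → Subset n → Set
  Reach {zero}  u v = ⊥
  Reach {suc n} u v = ∃ λ p → Step p u v

  reach-∷ : ∀ {n} a {u v : Subset n} → Reach u v → Reach (a ∷ u) (a ∷ v)
  reach-∷ {suc n} a (p , l , h , t) = suc p , l , h , cong (a ∷_) t

  reach-0 : ∀ {n} {u : Subset n} → Reach (false ∷ true ∷ u) (true ∷ false ∷ u)
  reach-0 = zero , refl , refl , refl

  dec₁ : ∀ n x → suc x < n → Reach {n} (set₁ (suc x)) (set₁ x)
  dec₁ (suc (suc n)) zero    _       = reach-0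
  dec₁ (suc n)       (suc x) (s<s p) = reach-∷ false (dec₁ n x p)

  dec₂ʸ : ∀ n x y → x < y → suc y < n → Reach {n} (set₂ x (suc y)) (set₂ x y)
  dec₂ʸ (suc n) zero    (suc y) _       (s<s q) = reach-∷ true (dec₁ n y q)
  dec₂ʸ (suc n) (suc x) (suc y) (s<s p) (s<s q) = reach-∷ false (dec₂ʸ n x y p q)

  dec₂ˣ : ∀ n x y → suc x < y → y < n → Reach {n} (set₂ (suc x) y) (set₂ x y)
  dec₂ˣ (suc (suc n)) zero    (suc (suc y)) _       _       = reach-0
  dec₂ˣ (suc n)       (suc x) (suc y)       (s<s p) (s<s q) = reach-∷ false (dec₂ˣ n x y p q)
  dec₂ˣ (suc zero)    zero    (suc (suc y)) _       (s<s ())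
  dec₂ˣ (suc (suc n)) zero    (suc zero)    (s<s ()) _

  dec₃ᶻ : ∀ n x y z → x < y → y < z → suc z < n → Reach {n} (set₃ x y (suc z)) (set₃ x y z)
  dec₃ᶻ (suc n) zero    (suc y) (suc z) _       (s<s q) (s<s r) = reach-∷ true (dec₂ʸ n y z q r)
  dec₃ᶻ (suc n) (suc x) (suc y) (suc z) (s<s p) (s<s q) (s<s r) = reach-∷ false (dec₃ᶻ n x y z p q r)

  dec₃ʸ : ∀ n x y z → x < y → suc y < z → z < n → Reach {n} (set₃ x (suc y) z) (set₃ x y z)
  dec₃ʸ (suc n) zero    (suc y) (suc z) _       (s<s q) (s<s r) = reach-∷ true (dec₂ˣ n y z q r)
  dec₃ʸ (suc n) (suc x) (suc y) (suc z) (s<s p) (s<s q) (s<s r) = reach-∷ false (dec₃ʸ n x y z p q r)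

  dec₃ˣ : ∀ n x y z → suc x < y → y < z → z < n → Reach {n} (set₃ (suc x) y z) (set₃ x y z)
  dec₃ˣ (suc (suc n)) zero    (suc (suc y)) (suc z)       _       (s<s _) _       = reach-0
  dec₃ˣ (suc zero)    zero    (suc (suc y)) (suc z)       _       _       (s<s ())
  dec₃ˣ (suc (suc n)) zero    (suc zero)    (suc z)       (s<s ()) _ _
  dec₃ˣ (suc n)       (suc x) (suc y)       (suc z)       (s<s p) (s<s q) (s<s r) = reach-∷ false (dec₃ˣ n x y z p q r)

  descend : ∀ {x′ x} (P : ℕ → Set) → x′ ≤ x → (∀ u → x′ ≤ u → u < x → P (suc u) → P u) → P x → P x′
  descend {x′} {x} P x′≤x step px with m≤n⇒∃[o]m+o≡n x′≤x
  ... | o , refl = go o step px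
    where
    go : ∀ o → (∀ u → x′ ≤ u → u < x′ + o → P (suc u) → P u) → P (x′ + o) → P x′
    go zero    step px = subst P (+-identityʳ x′) px
    go (suc o) step px = go o (λ u p q → step u p (≤-trans q (+-monoʳ-≤ x′ (n≤1+n o))))
      (step (x′ + o) (m≤m+n x′ o) (+-monoʳ-< x′ (n<1+n o)) (subst P (+-suc x′ o) px))

  -- The guard is needed because `set₃` drops elements outside [0 , n), so that a triple out of
  -- range would be read as a smaller set.
  toFam : ∀ {n} → Family n → Fam
  toFam {n} 𝓖 x y z = (z <ᵇ n) ∧ 𝓖 (set₃ x y z)

  T-∧ : ∀ {a b} → T a → T b → T (a ∧ b)
  T-∧ {true} _ t = t

  T-∧ˡ : ∀ {a b} → T (a ∧ b) → T a
  T-∧ˡ {true} _ = _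

  T-∧ʳ : ∀ {a b} → T (a ∧ b) → T b
  T-∧ʳ {true} t = t

  -- The coordinates are lowered one unit at a time, first x, then y, then z; in this order the
  -- triple stays strictly increasing, and every unit step is one adjacent exchange.
  toFam-Down : ∀ {n} (𝓖 : Family (suc n)) → Stable 𝓖 → Down (toFam 𝓖)
  toFam-Down {n} 𝓖 stable {x} {y} {z} {x′} {y′} {z′} x<y y<z x′≤x y′≤y z′≤z x′<y′ y′<z′ t =
    T-∧ (<⇒<ᵇ (≤-<-trans z′≤z z<n))
      (descend (λ v → T (𝓖 (set₃ x′ y′ v))) z′≤z (λ u p q → move (dec₃ᶻ (suc n) x′ y′ u x′<y′ (<-≤-trans y′<z′ p)
          (≤-<-trans q z<n)))
        (descend (λ v → T (𝓖 (set₃ x′ v z))) y′≤y (λ u p q → move (dec₃ʸ (suc n) x′ u z (<-≤-trans x′<y′ p)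
            (≤-<-trans q y<z) z<n))
          (descend (λ v → T (𝓖 (set₃ v y z))) x′≤x (λ u p q → move (dec₃ˣ (suc n) u y z (≤-<-trans q x<y) y<z z<n)) (T-∧ʳ t))))
    where
    z<n : z < suc n
    z<n = <ᵇ⇒< z (suc n) (T-∧ˡ t)
    move : ∀ {u v} → Reach u v → T (𝓖 u) → T (𝓖 v)
    move (p , l , h , refl) = stable p _ l h

  zeroV : ∀ n {f : Subset n → ℕ} → (∀ v → f v ≡ 0) → sumV n f ≡ 0
  zeroV zero    h = h []
  zeroV (suc n) h = cong₂ _+_ (zeroV n (h ∘ (true ∷_))) (zeroV n (h ∘ (false ∷_)))

  Supp : ∀ {n} → ℕ → (Subset n → ℕ) → Set
  Supp c f = ∀ v → ¬ ∣ v ∣ ≡ c → f v ≡ 0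

  supp-true : ∀ {n c} {f : Subset (suc n) → ℕ} → Supp (suc c) f → Supp c (f ∘ (true ∷_))
  supp-true h v ne = h (true ∷ v) (ne ∘ suc-injective)

  supp-false : ∀ {n c} {f : Subset (suc n) → ℕ} → Supp c f → Supp c (f ∘ (false ∷_))
  supp-false h v = h (false ∷ v)

  sumV₀ : ∀ n (f : Subset n → ℕ) → Supp 0 f → sumV n f ≡ f (set₀ n)
  sumV₀ zero    f h = refl
  sumV₀ (suc n) f h = cong₂ _+_ (zeroV n λ v → h (true ∷ v) λ ()) (sumV₀ n _ (supp-false h))

  sumV₁ : ∀ n (f : Subset n → ℕ) → Supp 1 f → sumV n f ≡ sum n λ x → f (set₁ x)
  sumV₁ zero    f h = h [] λ ()
  sumV₁ (suc n) f h = cong₂ _+_ (sumV₀ n _ (supp-true h)) (sumV₁ n _ (supp-false h))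

  sumV₂ : ∀ n (f : Subset n → ℕ) → Supp 2 f → sumV n f ≡ tri₂ n λ x y → f (set₂ x y)
  sumV₂ zero    f h = h [] λ ()
  sumV₂ (suc n) f h = trans (cong₂ _+_ (sumV₁ n _ (supp-true h)) (sumV₂ n _ (supp-false h))) (sym (tri₂-suc n λ x y
      → f (set₂ x y)))

  sumV₃ : ∀ n (f : Subset n → ℕ) → Supp 3 f → sumV n f ≡ tri₃ n λ x y z → f (set₃ x y z)
  sumV₃ zero    f h = h [] λ ()
  sumV₃ (suc n) f h = trans (cong₂ _+_ (sumV₂ n _ (supp-true h)) (sumV₃ n _ (supp-false h))) (sym (tri₃-suc n λ x y z
      → f (set₃ x y z)))

  size≤cnt : ∀ {n} (𝓖 : Family n) → (∀ v → T (𝓖 v) → ∣ v ∣ ≡ 3) → size 𝓖 ≤ cnt n (toFam 𝓖)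
  size≤cnt {n} 𝓖 card = ≤-trans (≤-reflexive (sumV₃ n _ supp)) (tri₃-mono n λ x y z _ _ z<n → 𝟙-mono (T-∧ (<⇒<ᵇ z<n)))
    where
    supp : Supp 3 (𝟙 ∘ 𝓖)
    supp v ne with 𝓖 v in eq
    ... | false = refl
    ... | true  = ⊥-elim (ne (card v (subst T (sym eq) _)))

  no-set₀ : ∀ n q → ¬ lookup (set₀ n) q ≡ true
  no-set₀ (suc n) (suc q) h = no-set₀ n q h

  in-set₁ : ∀ {n} x q → lookup (set₁ {n} x) q ≡ true → toℕ q ≡ x
  in-set₁ zero    zero    h = refl
  in-set₁ zero    (suc q) h = ⊥-elim (no-set₀ _ q h)
  in-set₁ (suc x) (suc q) h = cong suc (in-set₁ x q h)

  in-set₂ : ∀ {n} x y q → x < y → lookup (set₂ {n} x y) q ≡ true → toℕ q ≡ x ⊎ toℕ q ≡ y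
  in-set₂ zero    y       zero    _       h = inj₁ refl
  in-set₂ zero    (suc y) (suc q) _       h = inj₂ (cong suc (in-set₁ y q h))
  in-set₂ (suc x) (suc y) (suc q) (s<s p) h with in-set₂ x y q p h
  ... | inj₁ e = inj₁ (cong suc e)
  ... | inj₂ e = inj₂ (cong suc e)

  in-set₃ : ∀ {n} x y z q → x < y → y < z → lookup (set₃ {n} x y z) q ≡ true → toℕ q ≡ x ⊎ toℕ q ≡ y ⊎ toℕ q ≡ z
  in-set₃ zero    y       z       zero    _       _       h = inj₁ refl
  in-set₃ zero    (suc y) (suc z) (suc q) _       (s<s r) h with in-set₂ y z q r h
  ... | inj₁ e = inj₂ (inj₁ (cong suc e))
  ... | inj₂ e = inj₂ (inj₂ (cong suc e))
  in-set₃ (suc x) (suc y) (suc z) (suc q) (s<s p) (s<s r) h with in-set₃ x y z q p r h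
  ... | inj₁ e        = inj₁ (cong suc e)
  ... | inj₂ (inj₁ e) = inj₂ (inj₁ (cong suc e))
  ... | inj₂ (inj₂ e) = inj₂ (inj₂ (cong suc e))

  disjoint : ∀ {n} (u v : Subset n) → (∀ q → lookup u q ≡ true → lookup v q ≡ true → ⊥) → Disj u v
  disjoint []          []          h = refl
  disjoint (true ∷ u)  (true ∷ v)  h = ⊥-elim (h zero refl refl)
  disjoint (true ∷ u)  (false ∷ v) h = refl , disjoint u v (h ∘ suc)
  disjoint (false ∷ u) (b ∷ v)     h = refl , disjoint u v (h ∘ suc)

  Disj⇒∩ : ∀ {n} (u v : Subset n) → Disj u v → u ∩ v ≡ ∅
  Disj⇒∩ []      []      _       = refl
  Disj⇒∩ (a ∷ u) (b ∷ v) (e , d) = cong₂ _∷_ e (Disj⇒∩ u v d)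

-- Return to hypergraphs, and the numerical constants.

module Conclusion where

  open import Defs
  open Sums
  open Families using (Fam; cnt)
  open Matchings
  open Moves using (Solvable)
  open Thresholds using (Big)
  open NibbleParameters using (Constants)
  open Reductions
  open MainInduction
  open Shifting
  open Triples
  open import Data.Bool using (Bool; T)
  import Data.Bool.Properties as Bool
  open import Data.Nat
  open import Data.Nat.Properties
  open import Data.Nat.Combinatorics using (_C_)
  open import Data.Nat.DivMod using (_/_; m*n/n≡m; /-monoˡ-≤)
  open import Data.Fin as Fin using (Fin; zero; suc)
  open import Data.Fin.Subset using (Subset; ∣_∣)
  open import Data.Vec using (Vec; []; _∷_; lookup)
  open import Data.Vec.Properties using (≡-dec)
  open import Data.List using (List; []; _∷_; length; tabulate)
  open import Data.List.Properties using (length-tabulate)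
  open import Data.List.Relation.Unary.All using (All; []; _∷_)
  import Data.List.Relation.Unary.All as All
  import Data.List.Relation.Unary.All.Properties as Allₚ
  import Data.List.Relation.Unary.AllPairs as AllPairs
  open import Data.List.Relation.Unary.Any using (here; there)
  open import Data.List.Relation.Unary.Unique.Propositional using (Unique)
  open import Data.List.Membership.Propositional using (_∈_; _∉_)
  open import Data.Product using (Σ; _,_)
  open import Data.Sum using (_⊎_; inj₁; inj₂)
  open import Data.Empty using (⊥; ⊥-elim)
  open import Function using (_∘_)
  open import Relation.Nullary using (yes; no; ¬_)
  open import Relation.Nullary.Decidable using (toWitness; ⌊_⌋)
  open import Relation.Binary.PropositionalEquality

  module _ {n : ℕ} where
    open import Data.List.Membership.DecPropositional (≡-dec {n = n} Bool._≟_) using (_∈?_)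

    indicator : List (Subset n) → Family n
    indicator es v = ⌊ v ∈? es ⌋

    indicator-∈ : ∀ es {v} → T (indicator es v) → v ∈ es
    indicator-∈ es = toWitness

    -- Uniqueness makes the indicators of the head and of the tail disjoint, so their sizes add up.
    length≤size : ∀ {es} → Unique es → length es ≤ size (indicator es)
    length≤size {[]}     _                     = z≤n
    length≤size {e ∷ es} (e∉ AllPairs.∷ uniq) = begin
      1 + length es                                            ≤⟨ +-mono-≤ one (length≤size uniq) ⟩
      sumV n (λ v → 𝟙 ⌊ v ≟ⱽ e ⌋) + size (indicator es)        ≡⟨ sumV-+ n _ _ ⟨
      sumV n (λ v → 𝟙 ⌊ v ≟ⱽ e ⌋ + 𝟙 (indicator es v))         ≤⟨ sumV-mono n step ⟩
      size (indicator (e ∷ es))                                ∎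
      where
      open ≤-Reasoning
      _≟ⱽ_ = ≡-dec {n = n} Bool._≟_
      one : 1 ≤ sumV n (λ v → 𝟙 ⌊ v ≟ⱽ e ⌋)
      one = ≤-trans self (term≤sumV n (λ v → 𝟙 ⌊ v ≟ⱽ e ⌋) e)
        where
        self : 1 ≤ 𝟙 ⌊ e ≟ⱽ e ⌋
        self with e ≟ⱽ e
        ... | yes _  = ≤-refl
        ... | no  ne = ⊥-elim (ne refl)
      step : ∀ v → 𝟙 ⌊ v ≟ⱽ e ⌋ + 𝟙 (indicator es v) ≤ 𝟙 (indicator (e ∷ es) v)
      step v with v ≟ⱽ e | v ∈? es
      ... | yes refl | yes v∈ = ⊥-elim (All.lookup e∉ v∈ refl)
      ... | yes _    | no  _  = ≤-refl
      ... | no  _    | yes _  = ≤-refl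
      ... | no  _    | no  _  = z≤n

  record Choices {m} (F : Fin m → Fam) (V : List ℕ) : Set where
    field
      x y z : Fin m → ℕ
      x<y   : ∀ i → x i < y i
      y<z   : ∀ i → y i < z i
      edge  : ∀ i → T (F i (x i) (y i) (z i))
      in-V  : ∀ i {w} → w ≡ x i ⊎ w ≡ y i ⊎ w ≡ z i → w ∈ V
      apart : ∀ i j → ¬ i ≡ j → ∀ {w} → w ≡ x i ⊎ w ≡ y i ⊎ w ≡ z i → w ≡ x j ⊎ w ≡ y j ⊎ w ≡ z j → ⊥

  choices : ∀ {m} (F : Fin m → Fam) {V} → RM In (tabulate F) V → Choices F V
  choices {zero}  F [] = record
    { x = λ () ; y = λ () ; z = λ () ; x<y = λ () ; y<z = λ () ; edge = λ () ; in-V = λ () ; apart = λ () }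
  choices {suc m} F (add {U = V} {x = a} {y = b} {z = c} a<b b<c e a∉ b∉ c∉ R) = record
    { x = λ { zero → a ; (suc i) → x i } ; y = λ { zero → b ; (suc i) → y i } ; z = λ { zero → c ; (suc i) → z i }
    ; x<y = λ { zero → a<b ; (suc i) → x<y i } ; y<z = λ { zero → b<c ; (suc i) → y<z i }
    ; edge = λ { zero → e ; (suc i) → edge i }
    ; in-V = λ { zero (inj₁ refl) → here refl ; zero (inj₂ (inj₁ refl)) → there (here refl) ; zero (inj₂ (inj₂ refl)) → there (there (here refl))
               ; (suc i) h → there (there (there (in-V i h))) }
    ; apart = λ { zero zero ne h h′ → ne refl ; zero (suc j) ne h h′ → fresh h (in-V j h′) ; (suc i) zero ne h h′ → fresh h′ (in-V i h)
                ; (suc i) (suc j) ne h h′ → apart i j (λ eq → ne (cong suc eq)) h h′ } }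
    where
    open Choices (choices (F ∘ suc) R)
    fresh : ∀ {w} → w ≡ a ⊎ w ≡ b ⊎ w ≡ c → w ∉ V
    fresh (inj₁ refl)        = a∉
    fresh (inj₂ (inj₁ refl)) = b∉
    fresh (inj₂ (inj₂ refl)) = c∉

  solvable⇒rainbow : ∀ {m n} (𝓖 : Fin m → Family n) → Solvable (tabulate (toFam ∘ 𝓖)) → Rainbow 𝓖
  solvable⇒rainbow {n = n} 𝓖 (V , R) = (λ i → set₃ (x i) (y i) (z i)) , (λ i → T-∧ʳ {z i <ᵇ n} (edge i)) ,
    λ i j i≢j → disjoint _ _ λ q p p′ → apart i j i≢j (in-set₃ (x i) (y i) (z i) q (x<y i) (y<z i) p) (in-set₃ (x j)
        (y j) (z j) q (x<y j) (y<z j) p′)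
    where open Choices (choices (toFam ∘ 𝓖) R)

  abstract
    -- D = 10⁹ makes k = 2000 negligible against a, c = 10¹² exceeds 27(3D + 1), and m₀ = 10⁴⁵
    -- exceeds 4W, about 3.6 · 10⁴³. Opaque, so that only the inequalities are visible afterwards.
    constants : Constants
    constants = record
      { c = 1000000000000 ; D = 1000000000 ; k = 2000 ; a = 2999998000 ; m₀ = 1000000000000000000000000000000000000000000000
      ; c≥ = ≤ᵇ⇒≤ _ _ _ ; a+k = refl ; k≤a = ≤ᵇ⇒≤ _ _ _ ; 0<a = ≤ᵇ⇒≤ _ _ _ ; 27A<c = ≤ᵇ⇒≤ _ _ _ ; 2000≤k = ≤ᵇ⇒≤ _ _ _
          ; 12D≤c = ≤ᵇ⇒≤ _ _ _
      ; W<m₀ = ≤ᵇ⇒≤ _ _ _ ; wide₀ = ≤ᵇ⇒≤ _ _ _ ; fat₀ = ≤ᵇ⇒≤ _ _ _ ; gap₀ = ≤ᵇ⇒≤ _ _ _ ; gap₁ = ≤ᵇ⇒≤ _ _ _ ; 2000≤m₀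
          = ≤ᵇ⇒≤ _ _ _ }

  open Constants constants using (m₀; 2000≤m₀)
  open Induction constants using (claims)

  K : ℕ
  K = 5 * m₀

  -- 31 is 3 · 10 + 1: if N < K then 3m ≥ 30K, so m / 10 is at least K and N may be widened to it.
  all-claims : ∀ m N → 31 * K ≤ 3 * m + N → Claim m N
  all-claims m N large = decide (≤-<-connex K N)
    where
    decide : K ≤ N ⊎ N < K → Claim m N
    decide (inj₁ K≤N) = claims m N K≤N
    decide (inj₂ N<K) = widen m N (≤-trans (<⇒≤ N<K) K≤) (≤-trans (m≤m*n 10 K ⦃ >-nonZero 0<K ⦄) 10K≤m) (claims m (m / 10) K≤)
      where
      0<K : 0 < K
      0<K = ≤-trans (≤-trans (s≤s z≤n) 2000≤m₀) (m≤n*m m₀ 5)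
      10K≤m : 10 * K ≤ m
      10K≤m = *-cancelˡ-≤ 3 (+-cancelʳ-≤ K _ _ (≤-trans (≤-reflexive (lem K)) (≤-trans large (+-monoʳ-≤ (3 * m) (<⇒≤ N<K)))))
        where
        open import Data.Nat.Tactic.RingSolver using (solve-∀)
        lem : ∀ K → 3 * (10 * K) + K ≡ 31 * K
        lem = solve-∀
      K≤ : K ≤ m / 10
      K≤ = ≤-trans (≤-reflexive (sym (m*n/n≡m K 10))) (/-monoˡ-≤ 10 (≤-trans (≤-reflexive (*-comm K 10)) 10K≤m))

  -- The truncated subtraction in `f` is harmless in this direction, since A ≤ B + (A ∸ B) always
  -- holds.
  f⇒Big : ∀ m N x → f (3 * m + N) m 3 < x → Big m N x
  f⇒Big m N x h = cover , ≤-<-trans (m≤n⊔m _ ((3 * m ∸ 1) C 3)) h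
    where
    open ≤-Reasoning
    A = (3 * m + N) C 3
    B = (3 * m + N ∸ m + 1) C 3
    e : 3 * m + N ∸ m + 1 ≡ 2 * m + N + 1
    e = cong (_+ 1) (trans (cong (_∸ m) (+-assoc m (2 * m) N)) (m+n∸m≡n m (2 * m + N)))
    cover : A < x + (2 * m + N + 1) C 3
    cover = begin-strict
      A              ≤⟨ m≤n+m∸n A B ⟩
      B + (A ∸ B)    ≡⟨ +-comm B (A ∸ B) ⟩
      A ∸ B + B      <⟨ +-monoˡ-< B (≤-<-trans (m≤m⊔n (A ∸ B) ((3 * m ∸ 1) C 3)) h) ⟩
      x + B          ≡⟨ cong (λ v → x + v C 3) e ⟩
      x + (2 * m + N + 1) C 3 ∎

  rainbow-matching : ∀ n m N → 31 * K ≤ suc n → suc n ≡ 3 * m + N → (F : Fin m → Hypergraph 3 (suc n)) →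
    ((i : Fin m) → f (suc n) m 3 < ∣ F i ∣ₑ) → RainbowMatching F
  rainbow-matching n m N large n≡ F big =
    let e , e∈ , dis = rainbow (solvable⇒rainbow 𝓖 solved)
    in e , (λ i → indicator-∈ (edges (F i)) (e∈ i)) , λ i j i≢j → Disj⇒∩ (e i) (e j) (dis i j i≢j)
    where
    𝓕 : Fin m → Family (suc n)
    𝓕 i = indicator (edges (F i))
    open Stabilised (stabilise 3 𝓕 (λ i v t → All.lookup (uniform (F i)) (indicator-∈ (edges (F i)) t)))
    rich : ∀ i → Rich m N (toFam (𝓖 i))
    rich i = f⇒Big m N _ (subst (λ v → f v m 3 < cnt v (toFam (𝓖 i))) n≡
      (<-≤-trans (big i) (≤-trans (length≤size (distinct (F i))) (≤-trans (≤-reflexive (sym (size≡ i))) (size≤cnt (𝓖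
          i) (card i))))))
    solved : Solvable (tabulate (toFam ∘ 𝓖))
    solved = all-claims m N (≤-trans large (≤-reflexive n≡)) _ (length-tabulate _)
      (Allₚ.tabulate⁺ (λ i → toFam-Down (𝓖 i) (stable i))) (Allₚ.tabulate⁺ rich)

open import Defs
open import Data.Nat using (ℕ; suc; _≤_; _<_; _*_; _∸_)
open import Data.Nat.Properties using (m+[n∸m]≡n)
open import Data.Fin using (Fin)
open import Data.Product using (Σ; _,_)
open import Relation.Binary.PropositionalEquality using (sym)

theorem1p3 : Σ ℕ λ n₀ → (n : ℕ) → n₀ ≤ n → (m : ℕ) → 1 ≤ m → 3 * m ≤ n →
    (F : Fin m → Hypergraph 3 n) → ((i : Fin m) → f n m 3 < ∣ F i ∣ₑ) →
    RainbowMatching F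
theorem1p3 = 31 * Conclusion.K , λ where
  -- Shifting is set up for a nonempty vertex set; an empty one contradicts 3m ≤ n with m positive.
  0       _     (suc m) _ ()
  (suc n) large m       _ 3m≤n → Conclusion.rainbow-matching n m (suc n ∸ 3 * m) large (sym (m+[n∸m]≡n 3m≤n))
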